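{- $\mathsf{ZF}$ and $\mathsf{BLT}_{\mathrm{ZF}}$ are definitionally equivalent, and $\mathsf{LT}^+$ and $\mathsf{BLT}^+$ are definitionally equivalent.
   Context: Two theories $S,T$ are definitionally equivalent iff there are interpretations $I$ of $S$ in $T$ and $J$ of $T$ in $S$ such that: if $S\vdash\phi$ then $T\vdash\phi^I$; $S\vdash\phi\leftrightarrow(\phi^I)^J$ for every $S$-formula $\phi$; if $T\vdash\phi$ then $S\vdash\phi^J$; and $T\vdash\phi\leftrightarrow(\phi^J)^I$ for every $T$-formula $\phi$. All theories here have sole primitive $\in$. Level Theory $\mathsf{LT}$: Extensionality, Separation, Stratification (every set is a subset of a level), with $\mathrm{pot}(a)=\{x:\exists c(x\subseteq c\in a)\}$, history: $x=\mathrm{pot}(x\cap h)$ for all $x\in h$, level: $\mathrm{pot}(h)$ for a history $h$; $\mathsf{LT}^+=\mathsf{LT}+$Endless (every level is a member of some level). Boolean Level Theory $\mathsf{BLT}$: with $\overline a=\{x:x\notin a\}$, $\mathrm{bpot}(a)=\{x:\exists c(c\in a\land c\notin c\land(x\subseteq c\lor\overline x\subseteq c))\}$, boolean-history: $h\notin h$ and $x=\mathrm{bpot}(x\cap h)$ for $x\in h$, boolean-level: $\mathrm{bpot}(h)$ for a boolean-history $h$; axioms Extensionality, Complements $\forall a\exists c(c=\overline a\land(a\notin a\leftrightarrow c\in c))$, Separation$_\notin$ (arbitrary subsets of non-self-membered sets exist and are non-self-membered), Stratification$_\notin$ (every non-self-membered set is a subset of a boolean-level). $\mathsf{BLT}^+=\mathsf{BLT}+$Endless$_\notin$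 (every boolean-level is a member of a boolean-level). $\mathsf{BLT}_{\mathrm{ZF}}=\mathsf{BLT}+$Infinity$_\notin$ (some boolean-level has a boolean-level member and, for each boolean-level $q$ in it, a boolean-level $r$ with $q\in r$ in it) $+$Unbounded$_\notin$ (for every function $P$ and every $a\notin a$ there is a boolean-level $s$ with $P(x)\in s$ for all $x\in a$). -}

module Defs where

open import Data.Nat using (ℕ; zero; suc; _+_; _∸_)
open import Data.Product using (Σ; _×_)

infixr 5 _⇒_
infix 7 _∈'_ _≈'_

data Fm : Set where
  _∈'_ : ℕ → ℕ → Fm
  _≈'_ : ℕ → ℕ → Fm
  ⊥'   : Fm
  _⇒_  : Fm → Fm → Fm
  ∀'   : Fm → Fm           -- binds de Bruijn index 0

¬'_ : Fm → Fm
¬' A = A ⇒ ⊥'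

_∧'_ : Fm → Fm → Fm
A ∧' B = ¬' (A ⇒ ¬' B)

_⇔_ : Fm → Fm → Fm
A ⇔ B = (A ⇒ B) ∧' (B ⇒ A)

ext : (ℕ → ℕ) → ℕ → ℕ
ext ρ zero = zero
ext ρ (suc k) = suc (ρ k)

ren : (ℕ → ℕ) → Fm → Fm
ren ρ (x ∈' y) = ρ x ∈' ρ y
ren ρ (x ≈' y) = ρ x ≈' ρ y
ren ρ ⊥' = ⊥'
ren ρ (A ⇒ B) = ren ρ A ⇒ ren ρ B
ren ρ (∀' A) = ∀' (ren (ext ρ) A)

inst-ρ : ℕ → ℕ → ℕ
inst-ρ x zero = x
inst-ρ x (suc k) = k

data _⊢_ (T : Fm → Set) : Fm → Set where
  ax    : ∀ {A} → T A → T ⊢ A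
  mp    : ∀ {A B} → T ⊢ (A ⇒ B) → T ⊢ A → T ⊢ B
  gen   : ∀ {A} → T ⊢ A → T ⊢ ∀' A
  ax-K  : ∀ A B → T ⊢ (A ⇒ (B ⇒ A))
  ax-S  : ∀ A B C → T ⊢ ((A ⇒ (B ⇒ C)) ⇒ ((A ⇒ B) ⇒ (A ⇒ C)))
  ax-DN : ∀ A → T ⊢ (((A ⇒ ⊥') ⇒ ⊥') ⇒ A)
  ax-∀E : ∀ A x → T ⊢ (∀' A ⇒ ren (inst-ρ x) A)
  ax-∀D : ∀ A B → T ⊢ (∀' (ren suc A ⇒ B) ⇒ (A ⇒ ∀' B))
  ax-≈R : ∀ x → T ⊢ (x ≈' x)
  ax-≈S : ∀ A x y → T ⊢ ((x ≈' y) ⇒ (ren (inst-ρ x) A ⇒ ren (inst-ρ y) A))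

-- Interpretations: an interpretation is given by a formula δ whose free
-- indices 0 and 1 play the roles of "0 ∈ 1"; it translates ∈ by δ and
-- leaves identity, connectives and (unrelativised) quantifiers fixed.

pick : ℕ → ℕ → ℕ → ℕ
pick x y zero = x
pick x y (suc _) = y

tr : Fm → Fm → Fm
tr δ (x ∈' y) = ren (pick x y) δ
tr δ (x ≈' y) = x ≈' y
tr δ ⊥' = ⊥'
tr δ (A ⇒ B) = tr δ A ⇒ tr δ B
tr δ (∀' A) = ∀' (tr δ A)

DefEquiv : (Fm → Set) → (Fm → Set) → Set
DefEquiv S T =
  Σ Fm λ I → Σ Fm λ J →
    (∀ φ → S ⊢ φ → T ⊢ tr I φ)
  × (∀ φ → S ⊢ (φ ⇔ tr J (tr I φ)))
  × (∀ φ → T ⊢ φ → S ⊢ tr J φ)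
  × (∀ φ → T ⊢ (φ ⇔ tr I (tr J φ)))

-- Convenient formula builders using de Bruijn *levels*:
-- a formula-in-progress is a function of the current binder depth.

F : Set
F = ℕ → Fm

V : Set
V = ℕ → ℕ

infix 7 _∊_ _≐_
infixr 5 _⟹_
infixr 6 _∧F_ _∨F_
infix 5 _⇔F_

_∊_ : V → V → F
(a ∊ b) m = a m ∈' b m

_≐_ : V → V → F
(a ≐ b) m = a m ≈' b m

_⟹_ : F → F → F
(A ⟹ B) m = A m ⇒ B m

¬F_ : F → F
(¬F A) m = ¬' (A m)

_∧F_ : F → F → F
(A ∧F B) m = A m ∧' B m

_∨F_ : F → F → F
(A ∨F B) m = ¬' (A m) ⇒ B m

_⇔F_ : F → F → F
(A ⇔F B) m = A m ⇔ B m

AllF : (V → F) → F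
AllF body m = ∀' (body (λ k → k ∸ suc m) (suc m))

ExF : (V → F) → F
ExF body = ¬F (AllF (λ x → ¬F (body x)))

syntax AllF (λ x → B) = All[ x ] B
syntax ExF (λ x → B) = Ex[ x ] B

ExUnique : (V → F) → F
ExUnique P = Ex[ y ] (P y ∧F (All[ y' ] (P y' ⟹ y' ≐ y)))

sen : F → Fm
sen A = A 0

-- schema parameters: index 0 (resp. 0,1) of φ is the distinguished
-- variable(s); every other free variable k of φ is a parameter, i.e. is
-- free in the resulting axiom (implicitly universally closed).
inst1 : Fm → V → F
inst1 φ x m = ren ρ φ
  where
  ρ : ℕ → ℕ
  ρ zero = x m
  ρ (suc k) = k + m

inst2 : Fm → V → V → F
inst2 φ x y m = ren ρ φ
  where
  ρ : ℕ → ℕ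
  ρ zero = x m
  ρ (suc zero) = y m
  ρ (suc (suc k)) = k + m

_⊆F_ : V → V → F
a ⊆F b = All[ z ] (z ∊ a ⟹ z ∊ b)

co⊆ : V → V → F
co⊆ x c = All[ z ] (¬F (z ∊ x) ⟹ z ∊ c)

isPot : V → V → F
isPot y a = All[ z ] (z ∊ y ⇔F Ex[ c ] (z ⊆F c ∧F c ∊ a))

isPotCap : V → V → F
isPotCap x h = All[ z ] (z ∊ x ⇔F Ex[ c ] (z ⊆F c ∧F (c ∊ x ∧F c ∊ h)))

history : V → F
history h = All[ x ] (x ∊ h ⟹ isPotCap x h)

level : V → F
level s = Ex[ h ] (history h ∧F isPot s h)

isBpot : V → V → F
isBpot y a = All[ x ] (x ∊ y ⇔F
  Ex[ c ] (c ∊ a ∧F (¬F (c ∊ c) ∧F (x ⊆F c ∨F co⊆ x c))))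

isBpotCap : V → V → F
isBpotCap x h = All[ z ] (z ∊ x ⇔F
  Ex[ c ] ((c ∊ x ∧F c ∊ h) ∧F (¬F (c ∊ c) ∧F (z ⊆F c ∨F co⊆ z c))))

bhistory : V → F
bhistory h = ¬F (h ∊ h) ∧F All[ x ] (x ∊ h ⟹ isBpotCap x h)

blevel : V → F
blevel s = Ex[ h ] (bhistory h ∧F isBpot s h)

Extensionality : Fm
Extensionality = sen (All[ a ] All[ b ] (All[ z ] (z ∊ a ⇔F z ∊ b) ⟹ a ≐ b))

Separation : Fm → Fm
Separation φ = sen (All[ a ] Ex[ b ] All[ x ] (x ∊ b ⇔F (x ∊ a ∧F inst1 φ x)))

Stratification : Fm
Stratification = sen (All[ a ] Ex[ s ] (level s ∧F a ⊆F s))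

Endless : Fm
Endless = sen (All[ s ] (level s ⟹ Ex[ t ] (level t ∧F s ∊ t)))

Complements : Fm
Complements = sen (All[ a ] Ex[ c ]
  (All[ z ] (z ∊ c ⇔F ¬F (z ∊ a)) ∧F (¬F (a ∊ a) ⇔F c ∊ c)))

Separation∉ : Fm → Fm
Separation∉ φ = sen (All[ a ] (¬F (a ∊ a) ⟹ Ex[ b ] (¬F (b ∊ b) ∧F
  All[ x ] (x ∊ b ⇔F (x ∊ a ∧F inst1 φ x)))))

Stratification∉ : Fm
Stratification∉ = sen (All[ a ] (¬F (a ∊ a) ⟹ Ex[ s ] (blevel s ∧F a ⊆F s)))

Endless∉ : Fm
Endless∉ = sen (All[ s ] (blevel s ⟹ Ex[ t ] (blevel t ∧F s ∊ t)))

Infinity∉ : Fm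
Infinity∉ = sen (Ex[ s ] (blevel s ∧F (Ex[ q ] (blevel q ∧F q ∊ s) ∧F
  All[ q ] ((blevel q ∧F q ∊ s) ⟹ Ex[ r ] (blevel r ∧F (q ∊ r ∧F r ∊ s))))))

Unbounded∉ : Fm → Fm
Unbounded∉ φ = sen (All[ x ] ExUnique (λ y → inst2 φ x y) ⟹
  All[ a ] (¬F (a ∊ a) ⟹ Ex[ s ] (blevel s ∧F
    All[ x ] (x ∊ a ⟹ Ex[ y ] (y ∊ s ∧F inst2 φ x y)))))

-- ZF (Kunen's formulation)
Foundation : Fm
Foundation = sen (All[ a ] (Ex[ x ] (x ∊ a) ⟹
  Ex[ x ] (x ∊ a ∧F All[ y ] (y ∊ x ⟹ ¬F (y ∊ a)))))

Pairing : Fm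
Pairing = sen (All[ a ] All[ b ] Ex[ c ] (a ∊ c ∧F b ∊ c))

Union : Fm
Union = sen (All[ a ] Ex[ u ] All[ y ] All[ x ] ((x ∊ y ∧F y ∊ a) ⟹ x ∊ u))

Power : Fm
Power = sen (All[ a ] Ex[ p ] All[ x ] (x ⊆F a ⟹ x ∊ p))

Infinity : Fm
Infinity = sen (Ex[ i ] (Ex[ e ] (e ∊ i ∧F All[ z ] (¬F (z ∊ e))) ∧F
  All[ x ] (x ∊ i ⟹ Ex[ s ] (s ∊ i ∧F All[ z ] (z ∊ s ⇔F (z ∊ x ∨F z ≐ x))))))

Replacement : Fm → Fm
Replacement φ = sen (All[ a ] (All[ x ] (x ∊ a ⟹ ExUnique (λ y → inst2 φ x y)) ⟹
  Ex[ b ] All[ x ] (x ∊ a ⟹ Ex[ y ] (y ∊ b ∧F inst2 φ x y))))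

data ZF : Fm → Set where
  zf-ext  : ZF Extensionality
  zf-fnd  : ZF Foundation
  zf-pair : ZF Pairing
  zf-union : ZF Union
  zf-pow  : ZF Power
  zf-inf  : ZF Infinity
  zf-sep  : ∀ φ → ZF (Separation φ)
  zf-rep  : ∀ φ → ZF (Replacement φ)

data LT : Fm → Set where
  lt-ext   : LT Extensionality
  lt-sep   : ∀ φ → LT (Separation φ)
  lt-strat : LT Stratification

data LT⁺ : Fm → Set where
  lt⁺-lt      : ∀ {A} → LT A → LT⁺ A
  lt⁺-endless : LT⁺ Endless

data BLT : Fm → Set where
  blt-ext   : BLT Extensionality
  blt-comp  : BLT Complements
  blt-sep   : ∀ φ → BLT (Separation∉ φ)
  blt-strat : BLT Stratification∉

data BLT⁺ : Fm → Set where
  blt⁺-blt     : ∀ {A} → BLT A → BLT⁺ A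
  blt⁺-endless : BLT⁺ Endless∉

data BLT-ZF : Fm → Set where
  bltzf-blt : ∀ {A} → BLT A → BLT-ZF A
  bltzf-inf : BLT-ZF Infinity∉
  bltzf-unb : ∀ φ → BLT-ZF (Unbounded∉ φ)

{-# OPTIONS --safe #-}
module Submission where

-- Derivability is replaced by truth: classical first-order logic is complete for
-- Tarskian models in which falsity may be any proposition Bot and atomic formulas
-- are stable under double negation relative to Bot, and for these models the
-- Henkin construction is constructive. It then remains to define membership
-- relations inside models of the four theories.
--
-- Let g be a definable bijection from the universe onto the non-empty sets (the
-- identity except on one definable ω-like sequence). In LT⁺ put
--   x ε y  iff  exactly one of g x ∈ y and ∅ ∈ y holds,
-- so that ∅ ∈ y says that y is high. Conversely, in BLT⁺ let ∅ belong to the high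
-- sets, and g u to those y for which u is in the low one of y and its complement.
-- The sequence moved by g is chosen so that ∈ and ε define the same g, hence the
-- two constructions are inverse to each other. The axioms about levels follow
-- by comparing the two hierarchies level by level. ZF is LT⁺ plus Infinity and
-- Replacement because in ZF every set has a rank.

-- Once `∅` serves as the mark of high sets it is lost as an ordinary member, which is why every set
-- has to be renamed to a non-empty one. Neither theory need define a well-order of the universe, so
-- `g` moves a single sequence only, and that sequence has to be recognisable from either side
-- before the other membership relation is available. In LT⁺ its terms `v` omit `∅`; hence `v ∪ {∅}`
-- is `v` with the mark reversed, the `ε`-complement of `v`, and since `g v = v ∪ {∅}`, the set
-- `{v ∪ {∅}}` is the `ε`-singleton of `v`. Complement and singleton, the natural choices in BLT⁺,
-- are thus exactly what LT⁺ sees. LT⁺ and BLT⁺ lack Infinity, so the sequence may be a proper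
-- class, and belonging to it is expressed by a set that traces a term back to `∅`. They also lack
-- Replacement: counterparts of the levels below a limit cannot be collected one by one, so each is
-- kept below every limit that its original is below. Falsity in the term model is `T ⊢ A₀` itself.
-- The contradiction that ends the completeness proof is therefore already the derivation sought.

open import Defs
open import Data.Empty using (⊥; ⊥-elim)
open import Data.Nat using (ℕ; zero; suc; _+_; _∸_; _⊔_; _<_; s≤s)
open import Data.Nat.Properties using (_≟_; _<?_; +-assoc; +-comm; +-identityʳ; +-suc; <⇒≢; m+n∸m≡n; m+n≮m; m≤m⊔n; m≤n⊔m; n≤1+n; ≤-trans)
open import Data.Product using (Σ; _×_; _,_; proj₁; proj₂)
open import Data.Sum using (_⊎_; inj₁; inj₂)
open import Data.Unit using (⊤; tt)
open import Function using (_∘_; id)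
open import Relation.Binary.PropositionalEquality using (_≡_; refl; sym; trans; cong; cong₂; subst)
open import Relation.Nullary using (yes; no)

-- Renaming

infixr 5 _▹_

_▹_ : {X : Set} → X → (ℕ → X) → ℕ → X
(x ▹ ρ) zero = x
(x ▹ ρ) (suc i) = ρ i

ren-cong : ∀ {f g} → (∀ i → f i ≡ g i) → ∀ A → ren f A ≡ ren g A
ext-cong : ∀ {f g} → (∀ i → f i ≡ g i) → ∀ i → ext f i ≡ ext g i
ext-cong e zero = refl
ext-cong e (suc i) = cong suc (e i)
ren-cong e (x ∈' y) = cong₂ _∈'_ (e x) (e y)
ren-cong e (x ≈' y) = cong₂ _≈'_ (e x) (e y)
ren-cong e ⊥' = refl
ren-cong e (A ⇒ B) = cong₂ _⇒_ (ren-cong e A) (ren-cong e B)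
ren-cong e (∀' A) = cong ∀' (ren-cong (ext-cong e) A)

ren-id : ∀ {f} → (∀ i → f i ≡ i) → ∀ A → ren f A ≡ A
ren-id e (x ∈' y) = cong₂ _∈'_ (e x) (e y)
ren-id e (x ≈' y) = cong₂ _≈'_ (e x) (e y)
ren-id e ⊥' = refl
ren-id e (A ⇒ B) = cong₂ _⇒_ (ren-id e A) (ren-id e B)
ren-id {f} e (∀' A) = cong ∀' (ren-id e′ A)
  where
  e′ : ∀ i → ext f i ≡ i
  e′ zero = refl
  e′ (suc i) = cong suc (e i)

ren-∘ : ∀ f g A → ren f (ren g A) ≡ ren (f ∘ g) A
ren-∘ f g (x ∈' y) = refl
ren-∘ f g (x ≈' y) = refl
ren-∘ f g ⊥' = refl
ren-∘ f g (A ⇒ B) = cong₂ _⇒_ (ren-∘ f g A) (ren-∘ f g B)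
ren-∘ f g (∀' A) = cong ∀' (trans (ren-∘ (ext f) (ext g) A) (ren-cong e A))
  where
  e : ∀ i → ext f (ext g i) ≡ ext (f ∘ g) i
  e zero = refl
  e (suc i) = refl

inst-ext : ∀ x f A → ren (inst-ρ x) (ren (ext f) A) ≡ ren (x ▹ f) A
inst-ext x f A = trans (ren-∘ _ _ A) (ren-cong e A)
  where
  e : ∀ i → inst-ρ x (ext f i) ≡ (x ▹ f) i
  e zero = refl
  e (suc i) = refl

inst-suc : ∀ x A → ren (inst-ρ x) (ren suc A) ≡ A
inst-suc x A = trans (ren-∘ _ _ A) (ren-id (λ _ → refl) A)

-- Only an upper bound is ever used, so a quantifier may leave it unchanged.
free-bound : Fm → ℕ
free-bound (x ∈' y) = suc x ⊔ suc y
free-bound (x ≈' y) = suc x ⊔ suc y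
free-bound ⊥' = 0
free-bound (A ⇒ B) = free-bound A ⊔ free-bound B
free-bound (∀' A) = free-bound A

ren-cong-free : ∀ {f g} A → (∀ i → i < free-bound A → f i ≡ g i) → ren f A ≡ ren g A
ren-cong-free (x ∈' y) e = cong₂ _∈'_ (e x (m≤m⊔n (suc x) (suc y))) (e y (m≤n⊔m (suc x) (suc y)))
ren-cong-free (x ≈' y) e = cong₂ _≈'_ (e x (m≤m⊔n (suc x) (suc y))) (e y (m≤n⊔m (suc x) (suc y)))
ren-cong-free ⊥' e = refl
ren-cong-free (A ⇒ B) e = cong₂ _⇒_
  (ren-cong-free A λ i p → e i (≤-trans p (m≤m⊔n (free-bound A) (free-bound B))))
  (ren-cong-free B λ i p → e i (≤-trans p (m≤n⊔m (free-bound A) (free-bound B))))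
ren-cong-free {f} {g} (∀' A) e = cong ∀' (ren-cong-free A e′)
  where
  e′ : ∀ i → i < free-bound A → ext f i ≡ ext g i
  e′ zero p = refl
  e′ (suc i) p = cong suc (e i (≤-trans (s≤s (n≤1+n i)) p))

-- An enumeration of the formulas

next-pair : ℕ × ℕ → ℕ × ℕ
next-pair (zero , b) = suc b , zero
next-pair (suc a , b) = a , suc b

unpair : ℕ → ℕ × ℕ
unpair zero = zero , zero
unpair (suc n) = next-pair (unpair n)

-- `unpair` runs through each antidiagonal from `(s , 0)` to `(0 , s)`, so `(a , b)` comes `b` steps
-- after `(a + b , 0)`.
pair-along : ∀ b a {n} → unpair n ≡ (a + b , 0) → Σ ℕ λ k → unpair k ≡ (a , b)
pair-along zero a {n} e = n , trans e (cong (_, 0) (+-identityʳ a))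
pair-along (suc b) a {n} e with pair-along b (suc a) {n} (trans e (cong (_, 0) (+-suc a b)))
... | k , q = suc k , cong next-pair q

pair-axis : ∀ s → Σ ℕ λ n → unpair n ≡ (s , 0)
pair-axis zero = 0 , refl
pair-axis (suc s) with pair-along s zero {proj₁ (pair-axis s)} (proj₂ (pair-axis s))
... | k , q = suc k , cong next-pair q

unpair-onto : ∀ a b → Σ ℕ λ k → unpair k ≡ (a , b)
unpair-onto a b = pair-along b a {proj₁ (pair-axis (a + b))} (proj₂ (pair-axis (a + b)))

pair : ℕ → ℕ → ℕ
pair a b = proj₁ (unpair-onto a b)

unpair-pair : ∀ a b → unpair (pair a b) ≡ (a , b)
unpair-pair a b = proj₂ (unpair-onto a b)

-- The first argument is fuel: it bounds the depth of the decoded formula.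
decode : ℕ → ℕ × ℕ → Fm
decode zero _ = ⊥'
decode (suc d) (0 , r) = proj₁ (unpair r) ∈' proj₂ (unpair r)
decode (suc d) (1 , r) = proj₁ (unpair r) ≈' proj₂ (unpair r)
decode (suc d) (2 , r) = decode d (unpair (proj₁ (unpair r))) ⇒ decode d (unpair (proj₂ (unpair r)))
decode (suc d) (3 , r) = ∀' (decode d (unpair r))
decode (suc d) (suc (suc (suc (suc _))) , r) = ⊥'

-- Any larger fuel works as well, which lets the two sides of an implication be decoded with a
-- common amount.
record Code (A : Fm) : Set where
  constructor mk
  field
    code depth : ℕ
    decodes : ∀ d → decode (depth + d) (unpair code) ≡ A

code-of : ∀ A → Code A
code-of (x ∈' y) = mk (pair 0 (pair x y)) 1 λ d →
  trans (cong (decode (suc d)) (unpair-pair 0 (pair x y))) (cong₂ _∈'_ (cong proj₁ (unpair-pair x y)) (cong proj₂ (unpair-pair x y)))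
code-of (x ≈' y) = mk (pair 1 (pair x y)) 1 λ d →
  trans (cong (decode (suc d)) (unpair-pair 1 (pair x y))) (cong₂ _≈'_ (cong proj₁ (unpair-pair x y)) (cong proj₂ (unpair-pair x y)))
-- Every tag above 3 decodes to `⊥'`.
code-of ⊥' = mk (pair 4 0) 1 λ d → cong (decode (suc d)) (unpair-pair 4 0)
code-of (A ⇒ B) with code-of A | code-of B
... | mk a m p | mk b n q = mk (pair 2 (pair a b)) (suc (m + n)) λ d →
  trans (cong (decode (suc (m + n + d))) (unpair-pair 2 (pair a b))) (cong₂ _⇒_
    (trans (cong (λ c → decode (m + n + d) (unpair (proj₁ c))) (unpair-pair a b))
      (trans (cong (λ k → decode k (unpair a)) (+-assoc m n d)) (p (n + d))))
    (trans (cong (λ c → decode (m + n + d) (unpair (proj₂ c))) (unpair-pair a b))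
      (trans (cong (λ k → decode k (unpair b)) (trans (cong (_+ d) (+-comm m n)) (+-assoc n m d))) (q (m + d)))))
code-of (∀' A) with code-of A
... | mk a m p = mk (pair 3 a) (suc m) λ d →
  trans (cong (decode (suc (m + d))) (unpair-pair 3 a)) (cong ∀' (p d))

enum : ℕ → Fm
enum n = decode (proj₁ (unpair n)) (unpair (proj₂ (unpair n)))

enum-onto : ∀ A → Σ ℕ λ n → enum n ≡ A
enum-onto A with code-of A
... | mk c m p = pair (m + 0) c ,
  trans (cong (λ q → decode (proj₁ q) (unpair (proj₂ q))) (unpair-pair (m + 0) c)) (p 0)

-- Stability

infix 1 _↔_

_↔_ : Set → Set → Set
A ↔ B = (A → B) × (B → A)

module Stability (Bot : Set) where

  ◇ : Set → Set
  ◇ A = (A → Bot) → Bot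

  record Stable (A : Set) : Set where
    constructor stably
    field stable : ◇ A → A
  open Stable ⦃ ... ⦄ public

  infixl 1 _>>=_
  -- The result may be any stable type, not only some `◇ G`. Inside a `do` block hypotheses under
  -- `◇` can thus be opened whenever the goal is stable; this is the classical reasoning used
  -- throughout.
  _>>=_ : {A G : Set} → ◇ A → (A → G) → ⦃ Stable G ⦄ → G
  m >>= f = stable λ ng → m λ a → ng (f a)

  return : {A : Set} → A → ◇ A
  return a na = na a

  infix 3 ¬_
  ¬_ : Set → Set
  ¬ A = A → Bot

  ∃ : {X : Set} → (X → Set) → Set
  ∃ P = ◇ (Σ _ P)

  infixr 2 _∨_
  _∨_ : Set → Set → Set
  A ∨ B = ¬ A → B

  cases : {A B : Set} → A ∨ B → ◇ (A ⊎ B)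
  cases f n = n (inj₂ (f (n ∘ inj₁)))

  em : (A : Set) → ◇ (A ⊎ ¬ A)
  em A n = n (inj₂ (n ∘ inj₁))

  absurd : {G : Set} → ⦃ Stable G ⦄ → Bot → G
  absurd b = stable λ _ → b

  left : {A B : Set} → ⦃ Stable B ⦄ → A → A ∨ B
  left a na = absurd (na a)

  right : {A B : Set} → B → A ∨ B
  right b _ = b

  instance
    stable-Bot : Stable Bot
    stable-Bot = stably λ f → f id
    stable-Π : {A : Set} {B : A → Set} → ⦃ ∀ {x} → Stable (B x) ⦄ → Stable ((x : A) → B x)
    stable-Π = stably λ f x → stable λ n → f λ g → n (g x)
    stable-× : {A B : Set} → ⦃ Stable A ⦄ → ⦃ Stable B ⦄ → Stable (A × B)
    stable-× = stably λ f → (stable λ n → f (n ∘ proj₁)) , (stable λ n → f (n ∘ proj₂))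

  stable-↔ : {A B : Set} → A ↔ B → Stable A → Stable B
  stable-↔ (f , g) (stably s) = stably λ d → f (s λ na → d (na ∘ g))

-- Models with an arbitrary falsity, and truth in them

record Frame : Set₁ where
  infix 4 _≈_
  field
    Car Bot : Set
    pt : Car
    _≈_ : Car → Car → Set
  open Stability Bot public
  field
    ⦃ ≈-stable ⦄ : ∀ {x y} → Stable (x ≈ y)
    ≈-refl : ∀ {x} → x ≈ x
    ≈-sym : ∀ {x y} → x ≈ y → y ≈ x
    ≈-trans : ∀ {x y z} → x ≈ y → y ≈ z → x ≈ z

  ∃! : (Car → Set) → Set
  ∃! P = ∃ λ y → P y × (∀ y′ → P y′ → y′ ≈ y)

  Env : Set
  Env = ℕ → Car

  record Membership (_∈_ : Car → Car → Set) : Set where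
    field
      ⦃ ∈-stable ⦄ : ∀ {x y} → Stable (x ∈ y)
      ∈-resp : ∀ {x x′ y y′} → x ≈ x′ → y ≈ y′ → x ∈ y → x′ ∈ y′

  -- Tarskian truth, except that conjunctions and existential quantifiers, which
  -- are defined connectives of the language, are read as products and (up to
  -- stability) sums.
  sem : (Car → Car → Set) → Fm → Env → Set
  sem _∈_ (x ∈' y) ρ = ρ x ∈ ρ y
  sem _∈_ (x ≈' y) ρ = ρ x ≈ ρ y
  sem _∈_ ⊥' ρ = Bot
  sem _∈_ (A ⇒ B@(_ ∈' _)) ρ = sem _∈_ A ρ → sem _∈_ B ρ
  sem _∈_ (A ⇒ B@(_ ≈' _)) ρ = sem _∈_ A ρ → sem _∈_ B ρ
  sem _∈_ (A ⇒ B@(_ ⇒ _)) ρ = sem _∈_ A ρ → sem _∈_ B ρ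
  sem _∈_ (A ⇒ B@(∀' _)) ρ = sem _∈_ A ρ → sem _∈_ B ρ
  sem _∈_ ((A ⇒ (B ⇒ ⊥')) ⇒ ⊥') ρ = sem _∈_ A ρ × sem _∈_ B ρ
  sem _∈_ (∀' (A ⇒ ⊥') ⇒ ⊥') ρ = ∃ λ x → sem _∈_ A (x ▹ ρ)
  sem _∈_ (A ⇒ ⊥') ρ = sem _∈_ A ρ → Bot
  sem _∈_ (∀' A) ρ = ∀ x → sem _∈_ A (x ▹ ρ)

  module Truth {_∈_ : Car → Car → Set} (mem : Membership _∈_) where
    open Membership mem

    private
      ⟦_⟧ : Fm → Env → Set
      ⟦_⟧ = sem _∈_

    -- `sem` matches on the shape of both sides of an implication, so its value at a general `A ⇒ B`
    -- does not reduce. This gives the uniform reading on which inductions over formulas rely. The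
    -- clauses with content are those for conjunction and existence; the former uses that the
    -- conjuncts are stable, hence the mutual recursion.
    sem-imp : ∀ A B ρ → ⟦ A ⇒ B ⟧ ρ ↔ (⟦ A ⟧ ρ → ⟦ B ⟧ ρ)
    sem-stable : ∀ A ρ → Stable (⟦ A ⟧ ρ)

    sem-stable (x ∈' y) ρ = ∈-stable
    sem-stable (x ≈' y) ρ = ≈-stable
    sem-stable ⊥' ρ = stable-Bot
    sem-stable (A ⇒ B) ρ with sem-imp A B ρ
    ... | f , g = stable-↔ (g , f) (stable-Π ⦃ sem-stable B ρ ⦄)
    sem-stable (∀' A) ρ = stable-Π ⦃ λ {x} → sem-stable A (x ▹ ρ) ⦄

    sem-imp A (_ ∈' _) ρ = id , id
    sem-imp A (_ ≈' _) ρ = id , id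
    sem-imp A (_ ⇒ _) ρ = id , id
    sem-imp A (∀' _) ρ = id , id
    sem-imp (_ ∈' _) ⊥' ρ = id , id
    sem-imp (_ ≈' _) ⊥' ρ = id , id
    sem-imp ⊥' ⊥' ρ = id , id
    sem-imp (_ ⇒ (_ ∈' _)) ⊥' ρ = id , id
    sem-imp (_ ⇒ (_ ≈' _)) ⊥' ρ = id , id
    sem-imp (_ ⇒ ⊥') ⊥' ρ = id , id
    sem-imp (_ ⇒ ∀' _) ⊥' ρ = id , id
    sem-imp (_ ⇒ (_ ⇒ (_ ∈' _))) ⊥' ρ = id , id
    sem-imp (_ ⇒ (_ ⇒ (_ ≈' _))) ⊥' ρ = id , id
    sem-imp (_ ⇒ (_ ⇒ (_ ⇒ _))) ⊥' ρ = id , id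
    sem-imp (_ ⇒ (_ ⇒ ∀' _)) ⊥' ρ = id , id
    sem-imp (A ⇒ (B ⇒ ⊥')) ⊥' ρ =
      (λ (a , b) f → proj₁ (sem-imp B ⊥' ρ) (f a) b) ,
      λ f → (stable ⦃ sem-stable A ρ ⦄ λ na → f λ a → absurd ⦃ sem-stable (B ⇒ ⊥') ρ ⦄ (na a)) ,
            (stable ⦃ sem-stable B ρ ⦄ λ nb → f λ _ → proj₂ (sem-imp B ⊥' ρ) nb)
    sem-imp (∀' (_ ∈' _)) ⊥' ρ = id , id
    sem-imp (∀' (_ ≈' _)) ⊥' ρ = id , id
    sem-imp (∀' ⊥') ⊥' ρ = id , id
    sem-imp (∀' (∀' _)) ⊥' ρ = id , id
    sem-imp (∀' (_ ⇒ (_ ∈' _))) ⊥' ρ = id , id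
    sem-imp (∀' (_ ⇒ (_ ≈' _))) ⊥' ρ = id , id
    sem-imp (∀' (_ ⇒ (_ ⇒ _))) ⊥' ρ = id , id
    sem-imp (∀' (_ ⇒ ∀' _)) ⊥' ρ = id , id
    sem-imp (∀' (A ⇒ ⊥')) ⊥' ρ =
      (λ e f → e λ (x , a) → proj₁ (sem-imp A ⊥' (x ▹ ρ)) (f x) a) ,
      (λ g n → g λ x → proj₂ (sem-imp A ⊥' (x ▹ ρ)) λ a → n (x , a))

    sem-resp : ∀ A {ρ σ} → (∀ i → ρ i ≈ σ i) → ⟦ A ⟧ ρ → ⟦ A ⟧ σ
    sem-resp (x ∈' y) e = ∈-resp (e x) (e y)
    sem-resp (x ≈' y) e p = ≈-trans (≈-sym (e x)) (≈-trans p (e y))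
    sem-resp ⊥' e = id
    sem-resp (A ⇒ B) {ρ} {σ} e p = proj₂ (sem-imp A B σ)
      λ a → sem-resp B e (proj₁ (sem-imp A B ρ) p (sem-resp A (≈-sym ∘ e) a))
    sem-resp (∀' A) e p x = sem-resp A (λ { zero → ≈-refl ; (suc i) → e i }) (p x)

    sem-ren : ∀ A {f ρ σ} → (∀ i → ρ (f i) ≈ σ i) → ⟦ ren f A ⟧ ρ ↔ ⟦ A ⟧ σ
    sem-ren (x ∈' y) e = ∈-resp (e x) (e y) , ∈-resp (≈-sym (e x)) (≈-sym (e y))
    sem-ren (x ≈' y) e = (λ p → ≈-trans (≈-sym (e x)) (≈-trans p (e y))) ,
                         (λ p → ≈-trans (e x) (≈-trans p (≈-sym (e y))))
    sem-ren ⊥' e = id , id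
    sem-ren (A ⇒ B) {f} {ρ} {σ} e with sem-ren A e | sem-ren B e
    ... | a , a′ | b , b′ =
      (λ p → proj₂ (sem-imp A B σ) (b ∘ proj₁ (sem-imp (ren f A) (ren f B) ρ) p ∘ a′)) ,
      (λ p → proj₂ (sem-imp (ren f A) (ren f B) ρ) (b′ ∘ proj₁ (sem-imp A B σ) p ∘ a))
    sem-ren (∀' A) e =
      (λ p x → proj₁ (sem-ren A (λ { zero → ≈-refl ; (suc i) → e i })) (p x)) ,
      (λ p x → proj₂ (sem-ren A (λ { zero → ≈-refl ; (suc i) → e i })) (p x))

    soundness : ∀ {T} → (∀ A → T A → ∀ ρ → ⟦ A ⟧ ρ) → ∀ {A} → T ⊢ A → ∀ ρ → ⟦ A ⟧ ρ
    soundness t (ax p) ρ = t _ p ρ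
    soundness t (mp {A} {B} p q) ρ = proj₁ (sem-imp A B ρ) (soundness t p ρ) (soundness t q ρ)
    soundness t (gen p) ρ x = soundness t p (x ▹ ρ)
    soundness t (ax-K A B) ρ = proj₂ (sem-imp A (B ⇒ A) ρ) λ a → proj₂ (sem-imp B A ρ) λ _ → a
    soundness t (ax-S A B C) ρ =
      proj₂ (sem-imp (A ⇒ B ⇒ C) ((A ⇒ B) ⇒ A ⇒ C) ρ) λ f →
      proj₂ (sem-imp (A ⇒ B) (A ⇒ C) ρ) λ g →
      proj₂ (sem-imp A C ρ) λ a →
      proj₁ (sem-imp B C ρ) (proj₁ (sem-imp A (B ⇒ C) ρ) f a) (proj₁ (sem-imp A B ρ) g a)
    soundness t (ax-DN A) ρ = proj₂ (sem-imp ((A ⇒ ⊥') ⇒ ⊥') A ρ) λ d →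
      stable ⦃ sem-stable A ρ ⦄ λ na → proj₁ (sem-imp (A ⇒ ⊥') ⊥' ρ) d (proj₂ (sem-imp A ⊥' ρ) na)
    soundness t (ax-∀E A x) ρ = proj₂ (sem-imp (∀' A) (ren (inst-ρ x) A) ρ) λ p →
      proj₂ (sem-ren A (λ { zero → ≈-refl ; (suc i) → ≈-refl })) (p (ρ x))
    soundness t (ax-∀D A B) ρ = proj₂ (sem-imp (∀' (ren suc A ⇒ B)) (A ⇒ ∀' B) ρ) λ p →
      proj₂ (sem-imp A (∀' B) ρ) λ a x →
      proj₁ (sem-imp (ren suc A) B (x ▹ ρ)) (p x) (proj₂ (sem-ren A (λ _ → ≈-refl)) a)
    soundness t (ax-≈R x) ρ = ≈-refl
    soundness t (ax-≈S A x y) ρ = λ e →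
      proj₂ (sem-imp (ren (inst-ρ x) A) (ren (inst-ρ y) A) ρ) λ a →
      proj₂ (sem-ren A {σ = ρ y ▹ ρ} (λ { zero → ≈-refl ; (suc i) → ≈-refl }))
        (sem-resp A (λ { zero → e ; (suc i) → ≈-refl })
          (proj₁ (sem-ren A {σ = ρ x ▹ ρ} (λ { zero → ≈-refl ; (suc i) → ≈-refl })) a))

record Model : Set₁ where
  field frame : Frame
  open Frame frame public
  infix 4 _∈_
  field
    _∈_ : Car → Car → Set
    mem : Membership _∈_
  open Membership mem public
  open Truth mem public

_⊨_ : Model → Fm → Set
𝔐 ⊨ A = ∀ ρ → Model.sem 𝔐 (Model._∈_ 𝔐) A ρ

Models : (Fm → Set) → Model → Set
Models T 𝔐 = ∀ A → T A → 𝔐 ⊨ A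

-- Completeness

module Derivations (T : Fm → Set) where

  all : ℕ → Fm → Fm
  all zero A = A
  all (suc k) A = ∀' (all k A)

  gen-all : ∀ k {A} → T ⊢ A → T ⊢ all k A
  gen-all zero p = p
  gen-all (suc k) p = gen (gen-all k p)

  inst-all : ∀ k A f → T ⊢ ren (λ i → f (k + i)) (all k A) → T ⊢ ren f A
  inst-all zero A f p = p
  inst-all (suc k) A f p = inst-all k A f (subst (T ⊢_)
      (trans (inst-ext (f k) _ (all k A)) (ren-cong e (all k A))) (mp (ax-∀E _ (f k)) p))
    where
    e : ∀ i → (f k ▹ λ i → f (suc k + i)) i ≡ f (k + i)
    e zero = cong f (sym (+-identityʳ k))
    e (suc i) = cong f (sym (+-suc k i))

  -- The calculus has no renaming rule. All variables that can occur in `A` are generalised and then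
  -- instantiated according to `σ`.
  ⊢-ren : ∀ {A} σ → T ⊢ A → T ⊢ ren σ A
  ⊢-ren {A} σ p = subst (T ⊢_) (ren-cong-free A low)
      (inst-all n A f (subst (T ⊢_) (sym (ren-id high (all n A))) (gen-all n p)))
    where
    n = free-bound A
    -- From `n` on, `f` shifts back, so that the renaming left over for `all n A` is the identity.
    f : ℕ → ℕ
    f i with i <? n
    ... | yes _ = σ i
    ... | no _ = i ∸ n
    low : ∀ i → i < n → f i ≡ σ i
    low i i<n with i <? n
    ... | yes _ = refl
    ... | no ≮ = ⊥-elim (≮ i<n)
    high : ∀ i → f (n + i) ≡ i
    high i with (n + i) <? n
    ... | yes p = ⊥-elim (m+n≮m n i p)
    ... | no _ = m+n∸m≡n n i

  infix 3 _⊩_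
  -- Generalisation is confined to theorems of `T`, so the deduction theorem holds without a side
  -- condition on variables.
  data _⊩_ (U : Fm → Set) : Fm → Set where
    hyp : ∀ {A} → U A → U ⊩ A
    thm : ∀ {A} → T ⊢ A → U ⊩ A
    mp  : ∀ {A B} → U ⊩ A ⇒ B → U ⊩ A → U ⊩ B

  infixl 4 _,,_
  _,,_ : (Fm → Set) → Fm → Fm → Set
  (U ,, A) B = U B ⊎ B ≡ A

  ∅ : Fm → Set
  ∅ _ = ⊥

  ⊩-map : ∀ {U W} → (∀ {A} → U A → W A) → ∀ {A} → U ⊩ A → W ⊩ A
  ⊩-map f (hyp u) = hyp (f u)
  ⊩-map f (thm p) = thm p
  ⊩-map f (mp p q) = mp (⊩-map f p) (⊩-map f q)

  deduction : ∀ {U A B} → U ,, A ⊩ B → U ⊩ A ⇒ B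
  deduction (hyp (inj₁ u)) = mp (thm (ax-K _ _)) (hyp u)
  deduction {A = A} (hyp (inj₂ refl)) = mp (mp (thm (ax-S A (A ⇒ A) A)) (thm (ax-K _ _))) (thm (ax-K _ _))
  deduction (thm p) = mp (thm (ax-K _ _)) (thm p)
  deduction (mp p q) = mp (mp (thm (ax-S _ _ _)) (deduction p)) (deduction q)

  conclude : ∀ {A} → ∅ ⊩ A → T ⊢ A
  conclude (thm p) = p
  conclude (mp p q) = mp (conclude p) (conclude q)

  last : ∀ {U A} → U ,, A ⊩ A
  last = hyp (inj₂ refl)

  weaken : ∀ {U A B} → U ⊩ B → U ,, A ⊩ B
  weaken = ⊩-map inj₁

  by-contradiction : ∀ {U A} → U ,, ¬' A ⊩ ⊥' → U ⊩ A
  by-contradiction p = mp (thm (ax-DN _)) (deduction p)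

  ¬⇒-premise : ∀ {U A B} → U ⊩ ¬' (A ⇒ B) → U ⊩ A
  ¬⇒-premise p = by-contradiction (mp (weaken p)
    (deduction (by-contradiction (mp (weaken (weaken last)) (weaken last)))))

  ¬⇒-conclusion : ∀ {U A B} → U ⊩ ¬' (A ⇒ B) → U ⊩ ¬' B
  ¬⇒-conclusion p = deduction (mp (weaken p) (mp (thm (ax-K _ _)) last))

  module Henkin (A₀ : Fm) where

    -- counter n says that ¬ A₀ and the first n Henkin axioms are contradictory.
    mutual
      witness : ℕ → ℕ
      witness n = free-bound (counter n) ⊔ free-bound (enum n)

      henkin : ℕ → Fm
      henkin n = ren (inst-ρ (witness n)) (enum n) ⇒ ∀' (enum n)

      counter : ℕ → Fm
      counter zero = ¬' (¬' A₀)
      counter (suc n) = henkin n ⇒ counter n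

    -- The witness `x` is fresh for `C` and `A`. The renaming `σ` turns `x` into index 0 and shifts
    -- the rest, which yields `(A ⇒ ∀' A) ⇒ C` with `C` and `∀' A` weakened by one variable. Under
    -- `¬' C` the premise is refuted, that is, `A` holds and `∀' A` fails; generalising over index 0
    -- gives both `∀' A` and its negation.
    drop-henkin : ∀ n → T ⊢ counter (suc n) → T ⊢ counter n
    drop-henkin n p = conclude (by-contradiction (mp (mp (thm never) last) (mp (thm always) last)))
      where
      A = enum n
      C = counter n
      x = witness n
      σ : ℕ → ℕ
      σ i with i ≟ x
      ... | yes _ = 0
      ... | no _ = suc i
      σ-fresh : ∀ i → i < x → σ i ≡ suc i
      σ-fresh i i<x with i ≟ x
      ... | yes e = ⊥-elim (<⇒≢ i<x e)
      ... | no _ = refl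
      σ-x : σ x ≡ 0
      σ-x with x ≟ x
      ... | yes _ = refl
      ... | no ≢ = ⊥-elim (≢ refl)
      in-C : ∀ i → i < free-bound C → i < x
      in-C i q = ≤-trans q (m≤m⊔n (free-bound C) (free-bound A))
      in-A : ∀ i → i < free-bound A → i < x
      in-A i q = ≤-trans q (m≤n⊔m (free-bound C) (free-bound A))
      e₁ : ren σ (ren (inst-ρ x) A) ≡ A
      e₁ = trans (ren-∘ σ (inst-ρ x) A) (trans (ren-cong-free A e) (ren-id (λ _ → refl) A))
        where
        e : ∀ i → i < free-bound A → σ (inst-ρ x i) ≡ i
        e zero _ = σ-x
        e (suc i) q = σ-fresh i (in-A i (≤-trans (n≤1+n (suc i)) q))
      e₂ : ren σ (∀' A) ≡ ren suc (∀' A)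
      e₂ = ren-cong-free (∀' A) λ i q → σ-fresh i (in-A i q)
      e₃ : ren σ C ≡ ren suc C
      e₃ = ren-cong-free C λ i q → σ-fresh i (in-C i q)
      shifted : T ⊢ ((A ⇒ ren suc (∀' A)) ⇒ ren suc C)
      shifted = subst (T ⊢_) (cong₂ _⇒_ (cong₂ _⇒_ e₁ e₂) e₃) (⊢-ren σ p)
      refuted : ∀ {U} → U ,, ¬' (ren suc C) ⊩ ¬' (A ⇒ ren suc (∀' A))
      refuted = deduction (mp (weaken last) (mp (thm shifted) last))
      always : T ⊢ (¬' C ⇒ ∀' A)
      always = mp (ax-∀D (¬' C) A) (gen (conclude (deduction (¬⇒-premise refuted))))
      never : T ⊢ (¬' C ⇒ ¬' (∀' A))
      never = subst (T ⊢_) (inst-suc 0 (¬' C ⇒ ¬' (∀' A)))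
        (mp (ax-∀E _ 0) (gen (conclude (deduction (¬⇒-conclusion refuted)))))

    Henkins : Fm → Set
    Henkins B = B ≡ ¬' A₀ ⊎ Σ ℕ λ n → B ≡ henkin n

    counter-mono : ∀ m n {B} → T ⊢ (¬' (counter n) ⇒ B) → T ⊢ (¬' (counter (m + n)) ⇒ B)
    counter-mono zero n p = p
    counter-mono (suc m) n p = conclude (deduction (mp (thm (counter-mono m n p)) (¬⇒-conclusion last)))

    -- `¬' (counter n)` serves as the conjunction of `¬' A₀` and the first `n` Henkin axioms.
    henkins-finite : ∀ {B} → Henkins ⊩ B → Σ ℕ λ n → T ⊢ (¬' (counter n) ⇒ B)
    henkins-finite (hyp (inj₁ refl)) = 0 , ax-DN _
    henkins-finite (hyp (inj₂ (n , refl))) = suc n , conclude (deduction (¬⇒-premise last))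
    henkins-finite (thm p) = 0 , mp (ax-K _ _) p
    henkins-finite (mp {B} {C} p q) with henkins-finite p | henkins-finite q
    ... | m , p′ | n , q′ = m + n , mp (mp (ax-S _ _ _)
      (subst (λ k → T ⊢ (¬' (counter k) ⇒ B ⇒ C)) (+-comm n m) (counter-mono n m p′))) (counter-mono m n q′)

    drop-all : ∀ n → T ⊢ counter n → T ⊢ A₀
    drop-all zero p = mp (ax-DN _) p
    drop-all (suc n) p = drop-all n (drop-henkin n p)

    henkins-consistent : Henkins ⊩ ⊥' → T ⊢ A₀
    henkins-consistent p with henkins-finite p
    ... | n , q = drop-all n (mp (ax-DN _) q)

    -- Stage n + 1 accepts the n-th formula if doing so keeps contradictions as
    -- strong as T ⊢ A₀, which plays the role of falsity: no decision is involved.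
    Admissible : (Fm → Set) → Fm → Set
    Admissible U B = U ,, B ⊩ ⊥' → T ⊢ A₀

    stage : ℕ → Fm → Set
    stage zero = Henkins
    stage (suc n) B = stage n B ⊎ (B ≡ enum n × Admissible (stage n) (enum n))

    Ω : Fm → Set
    Ω B = Σ ℕ λ n → stage n B

    stage-mono : ∀ m n {B} → stage n B → stage (m + n) B
    stage-mono zero n p = p
    stage-mono (suc m) n p = inj₁ (stage-mono m n p)

    Ω-finite : ∀ {B} → Ω ⊩ B → Σ ℕ λ n → stage n ⊩ B
    Ω-finite (hyp (n , u)) = n , hyp u
    Ω-finite (thm p) = 0 , thm p
    Ω-finite (mp p q) with Ω-finite p | Ω-finite q
    ... | m , p′ | n , q′ = m + n ,
      mp (⊩-map (λ {B} u → subst (λ k → stage k B) (+-comm n m) (stage-mono n m u)) p′)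
         (⊩-map (stage-mono m n) q′)

    -- Whether the `n`-th formula was accepted cannot be decided, but a derivation that uses it
    -- carries the evidence that it was admissible.
    stage-uses : ∀ n {B} → stage (suc n) ⊩ B → stage n ⊩ B ⊎ Admissible (stage n) (enum n)
    stage-uses n (hyp (inj₁ u)) = inj₁ (hyp u)
    stage-uses n (hyp (inj₂ (_ , a))) = inj₂ a
    stage-uses n (thm p) = inj₁ (thm p)
    stage-uses n (mp p q) with stage-uses n p | stage-uses n q
    ... | inj₁ p′ | inj₁ q′ = inj₁ (mp p′ q′)
    ... | inj₂ a | _ = inj₂ a
    ... | _ | inj₂ a = inj₂ a

    stage-consistent : ∀ n → stage n ⊩ ⊥' → T ⊢ A₀
    stage-consistent zero p = henkins-consistent p
    stage-consistent (suc n) p with stage-uses n p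
    ... | inj₁ q = stage-consistent n q
    ... | inj₂ a = a (⊩-map (λ { (inj₁ u) → inj₁ u ; (inj₂ (e , _)) → inj₂ e }) p)

    Ω-consistent : Ω ⊩ ⊥' → T ⊢ A₀
    Ω-consistent p with Ω-finite p
    ... | n , q = stage-consistent n q

    Ω-maximal : ∀ {B} → Admissible Ω B → Ω B
    Ω-maximal {B} a with enum-onto B
    ... | n , refl = suc n , inj₂ (refl , a ∘ ⊩-map λ { (inj₁ u) → inj₁ (n , u) ; (inj₂ e) → inj₂ e })

    Ω-closed : ∀ {B} → Ω ⊩ B → Ω B
    Ω-closed p = Ω-maximal λ q → Ω-consistent (mp (deduction q) p)

    Ω-mp : ∀ {B C} → Ω (B ⇒ C) → Ω B → Ω C
    Ω-mp p q = Ω-closed (mp (hyp p) (hyp q))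

    Ω-thm : ∀ {B} → T ⊢ B → Ω B
    Ω-thm p = Ω-closed (thm p)

    Ω-imp : ∀ {B C} → (Ω B → Ω C) → Ω (B ⇒ C)
    Ω-imp f = Ω-maximal λ p → let q = deduction p in
      Ω-consistent (mp (¬⇒-conclusion q) (hyp (f (Ω-closed (¬⇒-premise q)))))

    Ω-all : ∀ B → (∀ x → Ω (ren (inst-ρ x) B)) → Ω (∀' B)
    Ω-all B f with enum-onto B
    ... | n , refl = Ω-mp (0 , inj₂ (n , refl)) (f (witness n))

    open Stability (T ⊢ A₀)

    Ω-stable : ∀ {B} → Stable (Ω B)
    Ω-stable = stably λ d → Ω-maximal λ p → d λ b → Ω-consistent (mp (deduction p) (hyp b))

    term-frame : Frame
    term-frame = record
      { Car = ℕ ; Bot = T ⊢ A₀ ; pt = 0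
      ; _≈_ = λ x y → Ω (x ≈' y)
      ; ≈-stable = Ω-stable
      ; ≈-refl = Ω-thm (ax-≈R _)
      ; ≈-sym = ≈-sym
      ; ≈-trans = λ {x} {y} {z} p q → Ω-mp (Ω-mp (Ω-thm (ax-≈S (0 ≈' suc z) y x)) (≈-sym p)) q }
      where
      ≈-sym : ∀ {x y} → Ω (x ≈' y) → Ω (y ≈' x)
      ≈-sym {x} {y} p = Ω-mp (Ω-mp (Ω-thm (ax-≈S (0 ≈' suc x) x y)) p) (Ω-thm (ax-≈R x))

    term-model : Model
    term-model = record
      { frame = term-frame
      ; _∈_ = λ x y → Ω (x ∈' y)
      ; mem = record
        { ∈-stable = Ω-stable
        ; ∈-resp = λ {x} {x′} {y} {y′} p q r →
            Ω-mp (Ω-mp (Ω-thm (ax-≈S (suc x′ ∈' 0) y y′)) q)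
              (Ω-mp (Ω-mp (Ω-thm (ax-≈S (0 ∈' suc y) x x′)) p) r) } }

    open Model term-model using (sem; _∈_; sem-imp)

    truth : ∀ B ρ → sem _∈_ B ρ ↔ Ω (ren ρ B)
    truth (x ∈' y) ρ = id , id
    truth (x ≈' y) ρ = id , id
    truth ⊥' ρ = (λ p → Ω-maximal λ _ → p) , Ω-consistent ∘ hyp
    truth (B ⇒ C) ρ =
      (λ p → Ω-imp (proj₁ (truth C ρ) ∘ proj₁ (sem-imp B C ρ) p ∘ proj₂ (truth B ρ))) ,
      (λ p → proj₂ (sem-imp B C ρ) (proj₂ (truth C ρ) ∘ Ω-mp p ∘ proj₁ (truth B ρ)))
    truth (∀' B) ρ =
      (λ p → Ω-all _ λ x → subst Ω (sym (inst-ext x ρ B)) (proj₁ (truth B (x ▹ ρ)) (p x))) ,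
      (λ p x → proj₂ (truth B (x ▹ ρ)) (subst Ω (inst-ext x ρ B) (Ω-mp (Ω-thm (ax-∀E _ x)) p)))

    term-model-models : Models T term-model
    term-model-models B t ρ = proj₂ (truth B ρ) (Ω-thm (⊢-ren ρ (ax t)))

-- Validity in the term model puts `A` into `Ω`, where `¬' A` already is; what `Ω-consistent`
-- extracts from the clash is `T ⊢ A`.
completeness : ∀ {T A} → (∀ 𝔐 → Models T 𝔐 → 𝔐 ⊨ A) → T ⊢ A
completeness {T} {A} valid = Ω-consistent (mp (hyp (0 , inj₁ refl))
    (hyp (subst Ω (ren-id (λ _ → refl) A) (proj₁ (truth A id) (valid term-model term-model-models id)))))
  where
  open Derivations T
  open Henkin A

-- Interpretations act on models

module _ (𝔐 : Model) where
  open Model 𝔐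

  pick-env : Car → Car → Env
  pick-env x y zero = x
  pick-env x y (suc _) = y

  interpreted : Fm → Car → Car → Set
  interpreted δ x y = sem _∈_ δ (pick-env x y)

  _^_ : Fm → Model
  _^_ δ = record
    { frame = frame
    ; _∈_ = interpreted δ
    ; mem = record
      { ∈-stable = λ {x} {y} → sem-stable δ (pick-env x y)
      ; ∈-resp = λ p q → sem-resp δ (λ { zero → p ; (suc _) → q }) } }

  sem-tr : ∀ δ A ρ → sem _∈_ (tr δ A) ρ ↔ sem (interpreted δ) A ρ
  sem-tr δ (x ∈' y) ρ = sem-ren δ (λ { zero → ≈-refl ; (suc _) → ≈-refl })
  sem-tr δ (x ≈' y) ρ = id , id
  sem-tr δ ⊥' ρ = id , id
  sem-tr δ (A ⇒ B) ρ with sem-tr δ A ρ | sem-tr δ B ρ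
  ... | a , a′ | b , b′ =
    (λ p → proj₂ (Model.sem-imp (_^_ δ) A B ρ) (b ∘ proj₁ (sem-imp (tr δ A) (tr δ B) ρ) p ∘ a′)) ,
    (λ p → proj₂ (sem-imp (tr δ A) (tr δ B) ρ) (b′ ∘ proj₁ (Model.sem-imp (_^_ δ) A B ρ) p ∘ a))
  sem-tr δ (∀' A) ρ = (λ p x → proj₁ (sem-tr δ A (x ▹ ρ)) (p x)) , (λ p x → proj₂ (sem-tr δ A (x ▹ ρ)) (p x))

module _ (𝔉 : Frame) where
  open Frame 𝔉

  sem-cong : {_∈_ _ε_ : Car → Car → Set} → Membership _∈_ → Membership _ε_ →
    (∀ x y → x ∈ y ↔ x ε y) → ∀ A ρ → sem _∈_ A ρ ↔ sem _ε_ A ρ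
  sem-cong m n e (x ∈' y) ρ = e (ρ x) (ρ y)
  sem-cong m n e (x ≈' y) ρ = id , id
  sem-cong m n e ⊥' ρ = id , id
  sem-cong m n e (A ⇒ B) ρ with sem-cong m n e A ρ | sem-cong m n e B ρ
  ... | a , a′ | b , b′ =
    (λ p → proj₂ (Truth.sem-imp n A B ρ) (b ∘ proj₁ (Truth.sem-imp m A B ρ) p ∘ a′)) ,
    (λ p → proj₂ (Truth.sem-imp m A B ρ) (b′ ∘ proj₁ (Truth.sem-imp n A B ρ) p ∘ a))
  sem-cong m n e (∀' A) ρ =
    (λ p x → proj₁ (sem-cong m n e A (x ▹ ρ)) (p x)) , (λ p x → proj₂ (sem-cong m n e A (x ▹ ρ)) (p x))

  sem-⇔ : {_∈_ : Car → Car → Set} (m : Membership _∈_) → ∀ A B ρ →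
    sem _∈_ A ρ ↔ sem _∈_ B ρ → sem _∈_ (A ⇔ B) ρ
  sem-⇔ m A B ρ (f , g) = proj₂ (Truth.sem-imp m A B ρ) f , proj₂ (Truth.sem-imp m B A ρ) g

-- `inverse` is demanded for atomic formulas only; `sem-cong` and `sem-tr` extend it to all
-- formulas.
record Interprets (S T : Fm → Set) (I J : Fm) : Set₁ where
  field
    interprets : ∀ 𝔐 → Models T 𝔐 → Models S (𝔐 ^ I)
    inverse : ∀ 𝔐 → Models T 𝔐 → let open Model 𝔐 in ∀ x y → x ∈ y ↔ interpreted (𝔐 ^ I) J x y

module _ {S T : Fm → Set} {I J : Fm} (int : Interprets S T I J) where
  open Interprets int

  ⊢-interprets : ∀ A → S ⊢ A → T ⊢ tr I A
  ⊢-interprets A p = completeness λ 𝔐 t ρ →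
    proj₂ (sem-tr 𝔐 I A ρ) (Model.soundness (𝔐 ^ I) (interprets 𝔐 t) p ρ)

  ⊢-inverse : ∀ A → T ⊢ (A ⇔ tr I (tr J A))
  ⊢-inverse A = completeness λ 𝔐 t ρ →
    let open Model 𝔐
        a , a′ = sem-cong frame mem (Model.mem ((𝔐 ^ I) ^ J)) (inverse 𝔐 t) A ρ
        b , b′ = sem-tr (𝔐 ^ I) J A ρ
        c , c′ = sem-tr 𝔐 I (tr J A) ρ
    in sem-⇔ frame mem A (tr I (tr J A)) ρ (c′ ∘ b′ ∘ a , a′ ∘ b ∘ c)

def-equiv : ∀ {S T I J} → Interprets S T I J → Interprets T S J I → DefEquiv S T
def-equiv {I = I} {J} i j = I , J , ⊢-interprets i , ⊢-inverse j , ⊢-interprets j , ⊢-inverse i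

-- Definability with parameters

double : ℕ → ℕ
double zero = zero
double (suc i) = suc (suc (double i))

merge : {X : Set} → (ℕ → X) → (ℕ → X) → ℕ → X
merge r s zero = r zero
merge r s (suc zero) = s zero
merge r s (suc (suc i)) = merge (r ∘ suc) (s ∘ suc) i

merge-even : {X : Set} (r s : ℕ → X) → ∀ i → merge r s (double i) ≡ r i
merge-even r s zero = refl
merge-even r s (suc i) = merge-even (r ∘ suc) (s ∘ suc) i

merge-odd : {X : Set} (r s : ℕ → X) → ∀ i → merge r s (suc (double i)) ≡ s i
merge-odd r s zero = refl
merge-odd r s (suc i) = merge-odd (r ∘ suc) (s ∘ suc) i

module Definability (𝔐 : Model) where
  open Model 𝔐

  ≈-reflexive : ∀ {x y} → x ≡ y → x ≈ y
  ≈-reflexive refl = ≈-refl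

  Term : Set
  Term = ℕ ⊎ Car

  pattern var i = inj₁ i
  pattern con c = inj₂ c

  eval : Env → Term → Car
  eval ρ (var i) = ρ i
  eval ρ (con c) = c

  -- The language has no constants, so parameters enter through `terms`, which reads each variable
  -- of the formula either as a variable of the environment or as a fixed element.
  record Def (P : Env → Set) : Set where
    constructor def
    field
      formula : Fm
      terms : ℕ → Term
      defines : ∀ ρ → sem _∈_ formula (eval ρ ∘ terms) ↔ P ρ
  open Def

  def-stable : ∀ {P} → Def P → ∀ ρ → Stable (P ρ)
  def-stable (def φ r d) ρ = stable-↔ (d ρ) (sem-stable φ (eval ρ ∘ r))

  def-resp : ∀ {P} → Def P → ∀ {ρ σ} → (∀ i → ρ i ≈ σ i) → P ρ → P σ
  def-resp (def φ r d) {ρ} {σ} e p = proj₁ (d σ) (sem-resp φ (λ i → on-terms (r i)) (proj₂ (d ρ) p))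
    where
    on-terms : ∀ t → eval ρ t ≈ eval σ t
    on-terms (var i) = e i
    on-terms (con c) = ≈-refl

  def-↔ : ∀ {P R} → (∀ ρ → P ρ ↔ R ρ) → Def P → Def R
  def-↔ e (def φ r d) = def φ r λ ρ → proj₁ (e ρ) ∘ proj₁ (d ρ) , proj₂ (d ρ) ∘ proj₂ (e ρ)

  def-subst : ∀ {P} → Def P → (τ : ℕ → Term) → Def (λ ρ → P (λ i → eval ρ (τ i)))
  def-subst (def φ r d) τ = def φ (bind ∘ r) λ ρ →
    proj₁ (d _) ∘ sem-resp φ (λ i → ≈-reflexive (eval-bind ρ (r i))) ,
    sem-resp φ (λ i → ≈-reflexive (sym (eval-bind ρ (r i)))) ∘ proj₂ (d _)
    where
    bind : Term → Term
    bind (var i) = τ i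
    bind (con c) = con c
    eval-bind : ∀ ρ t → eval ρ (bind t) ≡ eval (λ i → eval ρ (τ i)) t
    eval-bind ρ (var i) = refl
    eval-bind ρ (con c) = refl

  infixr 5 _d⇒_
  infixr 6 _d∨_
  infixr 7 _d×_

  d⊥ : Def (λ _ → Bot)
  d⊥ = def ⊥' (λ _ → con pt) λ _ → id , id

  d⊤ : Def (λ _ → ⊤)
  d⊤ = def (⊥' ⇒ ⊥') (λ _ → con pt) λ _ → (λ _ → tt) , (λ _ → id)

  d∈ : ∀ t u → Def (λ ρ → eval ρ t ∈ eval ρ u)
  d∈ t u = def (0 ∈' 1) (t ▹ λ _ → u) λ _ → id , id

  d≈ : ∀ t u → Def (λ ρ → eval ρ t ≈ eval ρ u)
  d≈ t u = def (0 ≈' 1) (t ▹ λ _ → u) λ _ → id , id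

  _d⇒_ : ∀ {P R} → Def P → Def R → Def (λ ρ → P ρ → R ρ)
  -- The two formulas read their variables through different `terms`; even indices are given to the
  -- first and odd ones to the second.
  _d⇒_ {P} {R} (def φ r d) (def ψ s e) = def (ren double φ ⇒ ren (suc ∘ double) ψ) (merge r s) λ ρ →
    let a , a′ = sem-ren φ {double} {eval ρ ∘ merge r s} λ i → ≈-reflexive (cong (eval ρ) (merge-even r s i))
        b , b′ = sem-ren ψ {suc ∘ double} {eval ρ ∘ merge r s} λ i → ≈-reflexive (cong (eval ρ) (merge-odd r s i))
        c , c′ = sem-imp (ren double φ) (ren (suc ∘ double) ψ) (eval ρ ∘ merge r s)
    in (λ p → proj₁ (e ρ) ∘ b ∘ c p ∘ a′ ∘ proj₂ (d ρ)) , (λ p → c′ (b′ ∘ proj₂ (e ρ) ∘ p ∘ proj₁ (d ρ) ∘ a))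

  d∀ : ∀ {P} → Def P → Def (λ ρ → ∀ x → P (x ▹ ρ))
  d∀ {P} (def φ r d) = def (∀' (ren bound φ)) (shift ∘ r) λ ρ →
    (λ p x → proj₁ (d (x ▹ ρ)) (proj₁ (sem-ren φ (agrees x ρ)) (p x))) ,
    (λ p x → proj₂ (sem-ren φ (agrees x ρ)) (proj₂ (d (x ▹ ρ)) (p x)))
    where
    shift : Term → Term
    -- A dummy value: `bound` redirects every such index to the quantified variable.
    shift (var zero) = con pt
    shift (var (suc i)) = var i
    shift (con c) = con c
    index : Term → ℕ → ℕ
    index (var zero) i = zero
    index _ i = suc i
    bound : ℕ → ℕ
    bound i = index (r i) i
    agrees : ∀ x ρ i → (x ▹ (eval ρ ∘ (shift ∘ r))) (bound i) ≈ eval (x ▹ ρ) (r i)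
    agrees x ρ i = on-term (r i) refl
      where
      on-term : ∀ t → r i ≡ t → (x ▹ (eval ρ ∘ (shift ∘ r))) (index t i) ≈ eval (x ▹ ρ) t
      on-term (var zero) e = ≈-refl
      on-term (var (suc j)) e = ≈-reflexive (cong (eval ρ ∘ shift) e)
      on-term (con c) e = ≈-reflexive (cong (eval ρ ∘ shift) e)

  d¬ : ∀ {P} → Def P → Def (λ ρ → ¬ P ρ)
  d¬ p = p d⇒ d⊥

  _d∨_ : ∀ {P R} → Def P → Def R → Def (λ ρ → P ρ ∨ R ρ)
  p d∨ r = d¬ p d⇒ r

  _d×_ : ∀ {P R} → Def P → Def R → Def (λ ρ → P ρ × R ρ)
  p d× r = def-↔ (λ ρ →
      (λ f → (stable ⦃ def-stable p ρ ⦄ λ n → f λ a → absurd (n a)) ,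
             (stable ⦃ def-stable r ρ ⦄ λ n → f λ _ → n)) ,
      (λ (a , b) f → f a b))
    (d¬ (p d⇒ d¬ r))

  d∃ : ∀ {P} → Def P → Def (λ ρ → ∃ λ x → P (x ▹ ρ))
  d∃ p = def-↔ (λ ρ → (λ f n → f λ x a → n (x , a)) , (λ f n → f λ (x , a) → n x a)) (d¬ (d∀ (d¬ p)))

  _d↔_ : ∀ {P R} → Def P → Def R → Def (λ ρ → P ρ ↔ R ρ)
  p d↔ r = (p d⇒ r) d× (r d⇒ p)

  record Def₁ (F : Car → Set) : Set where
    constructor def₁
    field body : Def (λ ρ → F (ρ 0))

  record Def₂ (R : Car → Car → Set) : Set where
    constructor def₂
    field body : Def (λ ρ → R (ρ 0) (ρ 1))

  ap₁ : ∀ {F} → Def₁ F → ∀ t → Def (λ ρ → F (eval ρ t))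
  ap₁ (def₁ p) t = def-subst p (λ _ → t)

  ap₂ : ∀ {R} → Def₂ R → ∀ t u → Def (λ ρ → R (eval ρ t) (eval ρ u))
  ap₂ (def₂ p) t u = def-subst p (t ▹ λ _ → u)

  stable₁ : ∀ {F} → Def₁ F → ∀ {x} → Stable (F x)
  stable₁ (def₁ p) {x} = def-stable p (λ _ → x)

  stable₂ : ∀ {R} → Def₂ R → ∀ {x y} → Stable (R x y)
  stable₂ (def₂ p) {x} {y} = def-stable p (x ▹ λ _ → y)

  resp₁ : ∀ {F} → Def₁ F → ∀ {x y} → x ≈ y → F x → F y
  resp₁ (def₁ p) e = def-resp p {λ _ → _} {λ _ → _} λ _ → e

  resp₂ : ∀ {R} → Def₂ R → ∀ {x x′ y y′} → x ≈ x′ → y ≈ y′ → R x y → R x′ y′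
  resp₂ (def₂ p) {x} {x′} {y} {y′} d e = def-resp p {x ▹ λ _ → y} {x′ ▹ λ _ → y′} λ { zero → d ; (suc _) → e }

  def-sem : ∀ {_ε_} → Membership _ε_ → Def₂ _ε_ → ∀ A → Def (sem _ε_ A)
  def-sem m d (x ∈' y) = ap₂ d (var x) (var y)
  def-sem m d (x ≈' y) = d≈ (var x) (var y)
  def-sem m d ⊥' = d⊥
  def-sem m d (A ⇒ B) = def-↔ (λ ρ → proj₂ (Truth.sem-imp m A B ρ) , proj₁ (Truth.sem-imp m A B ρ))
    (def-sem m d A d⇒ def-sem m d B)
  def-sem m d (∀' A) = d∀ (def-sem m d A)

  -- The axiom schemas expect a formula with variables 0 and 1 distinguished, together with an
  -- environment for its other variables. The constants of a `Def` become values of that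
  -- environment.
  schema₂ : ∀ {R} → Def₂ R → Σ Fm λ ψ → Σ Env λ ρ → ∀ x y → sem _∈_ ψ (x ▹ y ▹ ρ) ↔ R x y
  schema₂ {R} (def₂ (def φ r d)) = ren bound φ , eval (λ _ → pt) ∘ r , λ x y →
    let a , a′ = sem-ren φ {bound} {x ▹ y ▹ (eval (λ _ → pt) ∘ r)} (agrees x y)
        b , b′ = d (x ▹ y ▹ λ _ → pt)
    in b ∘ a , a′ ∘ b′
    where
    index : Term → ℕ → ℕ
    index (var zero) i = 0
    index (var (suc zero)) i = 1
    index _ i = suc (suc i)
    bound : ℕ → ℕ
    bound i = index (r i) i
    agrees : ∀ x y i → (x ▹ y ▹ (eval (λ _ → pt) ∘ r)) (bound i) ≈ eval (x ▹ y ▹ λ _ → pt) (r i)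
    agrees x y i = on-term (r i) refl
      where
      on-term : ∀ t → r i ≡ t → (x ▹ y ▹ (eval (λ _ → pt) ∘ r)) (index t i) ≈ eval (x ▹ y ▹ λ _ → pt) t
      on-term (var zero) e = ≈-refl
      on-term (var (suc zero)) e = ≈-refl
      on-term (var (suc (suc j))) e = ≈-reflexive (cong (eval (λ _ → pt)) e)
      on-term (con c) e = ≈-reflexive (cong (eval (λ _ → pt)) e)

  schema₁ : ∀ {F} → Def₁ F → Σ Fm λ ψ → Σ Env λ ρ → ∀ x → sem _∈_ ψ (x ▹ ρ) ↔ F x
  schema₁ {F} F-def =
    let ψ , ρ , e = schema₂ {λ x _ → F x} (def₂ (ap₁ F-def (var 0)))
    in ψ , pt ▹ ρ , λ x → e x pt

  def-sem₁ : ∀ {_ε_} → Membership _ε_ → Def₂ _ε_ → ∀ A ρ → Def₁ (λ x → sem _ε_ A (x ▹ ρ))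
  def-sem₁ m d A ρ = def₁ (def-↔
    (λ σ → Truth.sem-resp m A (λ { zero → ≈-refl ; (suc _) → ≈-refl }) ,
           Truth.sem-resp m A (λ { zero → ≈-refl ; (suc _) → ≈-refl }))
    (def-subst (def-sem m d A) (var 0 ▹ con ∘ ρ)))

  def-sem₂ : ∀ {_ε_} → Membership _ε_ → Def₂ _ε_ → ∀ A ρ → Def₂ (λ x y → sem _ε_ A (x ▹ y ▹ ρ))
  def-sem₂ m d A ρ = def₂ (def-↔
    (λ σ → Truth.sem-resp m A (λ { zero → ≈-refl ; (suc zero) → ≈-refl ; (suc (suc _)) → ≈-refl }) ,
           Truth.sem-resp m A (λ { zero → ≈-refl ; (suc zero) → ≈-refl ; (suc (suc _)) → ≈-refl }))
    (def-subst (def-sem m d A) (var 0 ▹ var 1 ▹ con ∘ ρ)))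

-- The schemas of the given theory apply to whatever is definable from the membership of `𝔐`.
-- Definability therefore always refers to `𝔐`, while the relation written `∈` is left open and may
-- be a constructed one.
module Ambient (𝔐 : Model) where
  open Model 𝔐 public hiding (_∈_; mem; ∈-stable; ∈-resp; sem-imp; sem-stable; sem-resp; sem-ren; soundness)
  open Definability 𝔐 public hiding (d∈)

-- Level theory for an arbitrary notion of "small" set and of "fitting inside a
-- set"; LT takes Low x = ⊤ and Sub x c = x ⊆ c, while BLT takes Low x = x ∉ x and
-- Sub x c = (x ⊆ c or the complement of x is ⊆ c).

record LevelStructure (𝔐 : Model) : Set₁ where
  open Ambient 𝔐
  infix 4 _∈_ _⊆_
  field
    _∈_ : Car → Car → Set
    mem : Membership _∈_
    ∈-def : Def₂ _∈_
  open Membership mem public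

  _⊆_ : Car → Car → Set
  a ⊆ b = ∀ z → z ∈ a → z ∈ b

  field
    Low : Car → Set
    Sub : Car → Car → Set
    Low-def : Def₁ Low
    Sub-def : Def₂ Sub
    extensionality : ∀ {a b} → (∀ z → z ∈ a ↔ z ∈ b) → a ≈ b
    separation : ∀ {F} → Def₁ F → ∀ {a} → Low a → ∃ λ b → Low b × (∀ x → x ∈ b ↔ x ∈ a × F x)
    Sub-mono : ∀ {x c d} → Sub x c → c ⊆ d → Sub x d
    ⊆⇒Sub : ∀ {x c} → x ⊆ c → Sub x c
    Sub⇒⊆ : ∀ {x c} → Low x → Low c → Sub x c → x ⊆ c

module Histories {𝔐 : Model} (S : LevelStructure 𝔐) where
  open Ambient 𝔐
  open LevelStructure S public

  private
    instance
      Low-stable : ∀ {x} → Stable (Low x)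
      Low-stable = stable₁ Low-def
      Sub-stable : ∀ {x c} → Stable (Sub x c)
      Sub-stable = stable₂ Sub-def

  d∈ : ∀ t u → Def (λ ρ → eval ρ t ∈ eval ρ u)
  d∈ = ap₂ ∈-def

  d⊆ : ∀ i j → Def (λ ρ → ρ i ⊆ ρ j)
  d⊆ i j = d∀ (d∈ (var 0) (var (suc i)) d⇒ d∈ (var 0) (var (suc j)))

  ∈-respˡ : ∀ {x x′ y} → x ≈ x′ → x ∈ y → x′ ∈ y
  ∈-respˡ e = ∈-resp e ≈-refl

  ∈-respʳ : ∀ {x y y′} → y ≈ y′ → x ∈ y → x ∈ y′
  ∈-respʳ e = ∈-resp ≈-refl e

  ≈⇒⊆ : ∀ {a b} → a ≈ b → a ⊆ b
  ≈⇒⊆ e z = ∈-respʳ e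

  antisym : ∀ {a b} → a ⊆ b → b ⊆ a → a ≈ b
  antisym p q = extensionality λ z → p z , q z

  Low-⊆ : ∀ {a b} → Low a → b ⊆ a → Low b
  Low-⊆ {a} {b} low b⊆a = do
    (c , low-c , c-def) ← separation (def₁ (d∈ (var 0) (con b))) low
    resp₁ Low-def (extensionality λ z → proj₂ ∘ proj₁ (c-def z) , λ z∈b → proj₂ (c-def z) (b⊆a z z∈b , z∈b)) low-c

  History : Car → Set
  History h = Low h × (∀ x → x ∈ h → Low x × (∀ z → z ∈ x ↔ ∃ λ c → c ∈ x × c ∈ h × Sub z c))

  IsPot : Car → Car → Set
  IsPot s h = ∀ z → z ∈ s ↔ ∃ λ c → c ∈ h × Sub z c

  Level : Car → Set
  Level s = ∃ λ h → History h × IsPot s h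

  Level-def : Def₁ Level
  Level-def = def₁ (d∃ (
    (ap₁ Low-def (var 0) d×
      d∀ (d∈ (var 0) (var 1) d⇒ (ap₁ Low-def (var 0) d×
        d∀ (d∈ (var 0) (var 1) d↔
          d∃ (d∈ (var 0) (var 2) d× (d∈ (var 0) (var 3) d× ap₂ Sub-def (var 1) (var 0)))))))
    d× d∀ (d∈ (var 0) (var 2) d↔ d∃ (d∈ (var 0) (var 2) d× ap₂ Sub-def (var 1) (var 0)))))

  -- A counterexample c would yield the Russell set of the intersection of all
  -- counterexamples, which belongs to each of them.
  history-induction : ∀ {F h} → Def₁ F → History h →
    (∀ y → y ∈ h → (∀ z → z ∈ h → z ∈ y → F z) → F y) → ∀ y → y ∈ h → F y
  history-induction {F} {h} F-def (low-h , H) step c c∈h = stable λ ¬Fc → do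
      (d , _ , d-def) ← separation
        (def₁ (d¬ (d∈ (var 0) (var 0)) d×
          d∀ (d∈ (var 0) (con h) d⇒ d¬ (ap₁ F-def (var 0)) d⇒ d∈ (var 1) (var 0))))
        (proj₁ (H c c∈h))
      let in-all : ∀ y → y ∈ h → ¬ F y → d ∈ y
          in-all y y∈h ¬Fy = stable λ d∉y → ¬Fy (step y y∈h λ z z∈h z∈y → stable λ ¬Fz →
            d∉y (proj₂ (proj₂ (H y y∈h) d) (return (z , z∈y , z∈h ,
              ⊆⇒Sub λ w w∈d → proj₂ (proj₂ (proj₁ (d-def w) w∈d)) z z∈h ¬Fz))))
          d∉d : ¬ d ∈ d
          d∉d d∈d = proj₁ (proj₂ (proj₁ (d-def d) d∈d)) d∈d
      d∉d (proj₂ (d-def d) (in-all c c∈h ¬Fc , d∉d , in-all))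
    where
    instance
      F-stable : ∀ {x} → Stable (F x)
      F-stable = stable₁ F-def

  Transitive : Car → Set
  Transitive c = ∀ y → y ∈ c → Sub y c

  history-transitive : ∀ {h} → History h → ∀ c → c ∈ h → Transitive c
  history-transitive {h} hist@(low-h , H) = history-induction
    (def₁ (d∀ (d∈ (var 0) (var 1) d⇒ ap₂ Sub-def (var 0) (var 1)))) hist
    λ c c∈h ih y y∈c → do
      (d , d∈c , d∈h , y-d) ← proj₁ (proj₂ (H c c∈h) y) y∈c
      Sub-mono y-d λ x x∈d → proj₂ (proj₂ (H c c∈h) x) (return (d , d∈c , d∈h , ih d d∈h d∈c x x∈d))

-- In BLT the lowness of levels is a theorem about histories, so it comes in between `Histories` and
-- `Levels`.
record LowLevels {𝔐 : Model} (S : LevelStructure 𝔐) : Set where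
  open Histories S
  field Level⇒Low : ∀ {s} → Level s → Low s

module Levels {𝔐 : Model} {S : LevelStructure 𝔐} (L : LowLevels S) where
  open Ambient 𝔐
  open Histories S public
  open LowLevels L public

  private
    instance
      Low-stable : ∀ {x} → Stable (Low x)
      Low-stable = stable₁ Low-def
      Sub-stable : ∀ {x c} → Stable (Sub x c)
      Sub-stable = stable₂ Sub-def

  level-transitive : ∀ {s} → Level s → Transitive s
  level-transitive {s} level y y∈s = do
    (h , hist , pot) ← level
    (c , c∈h , y-c) ← proj₁ (pot y) y∈s
    Sub-mono y-c λ x x∈c → proj₂ (pot x) (return (c , c∈h , history-transitive hist c c∈h x x∈c))

  level-⊆ : ∀ {s r} → Level s → r ∈ s → Low r → r ⊆ s
  level-⊆ level r∈s low = Sub⇒⊆ low (Level⇒Low level) (level-transitive level _ r∈s)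

  level-potent : ∀ {s c z} → Level s → c ∈ s → Low c → Sub z c → z ∈ s
  level-potent {s} {c} {z} level c∈s low z-c = do
    (h , hist , pot) ← level
    (d , d∈h , c-d) ← proj₁ (pot c) c∈s
    proj₂ (pot z) (return (d , d∈h , Sub-mono z-c (Sub⇒⊆ low (proj₁ (proj₂ hist d d∈h)) c-d)))

  -- The history that witnesses this is the part of `h` inside `c`.
  history-level : ∀ {h} → History h → ∀ c → c ∈ h → Level c
  history-level {h} hist@(low-h , H) c c∈h = do
    (g , low-g , g-def) ← separation (def₁ (d∈ (var 0) (con c))) low-h
    return (g
      , (low-g , λ x x∈g →
          let x∈h , x∈c = proj₁ (g-def x) x∈g
              low-x , pot-x = H x x∈h
              x⊆c = Sub⇒⊆ low-x (proj₁ (H c c∈h)) (history-transitive hist c c∈h x x∈c)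
          in low-x , λ z →
            (λ z∈x → do
              (e , e∈x , e∈h , z-e) ← proj₁ (pot-x z) z∈x
              return (e , e∈x , proj₂ (g-def e) (e∈h , x⊆c e e∈x) , z-e)) ,
            (λ p → do
              (e , e∈x , e∈g , z-e) ← p
              proj₂ (pot-x z) (return (e , e∈x , proj₁ (proj₁ (g-def e) e∈g) , z-e))))
      , λ z →
          (λ z∈c → do
            (e , e∈c , e∈h , z-e) ← proj₁ (proj₂ (H c c∈h) z) z∈c
            return (e , proj₂ (g-def e) (e∈h , e∈c) , z-e)) ,
          (λ p → do
            (e , e∈g , z-e) ← p
            let e∈h , e∈c = proj₁ (g-def e) e∈g
            proj₂ (proj₂ (H c c∈h) z) (return (e , e∈c , e∈h , z-e))))

  level-sublevels : ∀ {s z} → Level s → z ∈ s → ∃ λ r → r ∈ s × Level r × Sub z r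
  level-sublevels {s} {z} level z∈s = do
    (h , hist , pot) ← level
    (c , c∈h , z-c) ← proj₁ (pot z) z∈s
    return (c , proj₂ (pot c) (return (c , c∈h , ⊆⇒Sub λ _ → id)) , history-level hist c c∈h , z-c)

  sublevel-history : ∀ {h} → Low h → (∀ r → r ∈ h → Level r) →
    (∀ r → r ∈ h → ∀ q → q ∈ r → Level q → q ∈ h) → History h
  sublevel-history low levels down = low , λ r r∈h → Level⇒Low (levels r r∈h) , λ z →
    (λ z∈r → do
      (q , q∈r , lq , z-q) ← level-sublevels (levels r r∈h) z∈r
      return (q , q∈r , down r r∈h q q∈r lq , z-q)) ,
    (λ p → do
      (q , q∈r , q∈h , z-q) ← p
      level-potent (levels r r∈h) q∈r (Level⇒Low (levels q q∈h)) z-q)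

  -- The common source of successor levels, suprema and covers at limits. The class `G` need not be
  -- given as a set: the low set `t` contains all of it.
  make-level : ∀ {G t} → Def₁ G → Low t → (∀ r → G r → Level r) → (∀ r q → G r → q ∈ r → Level q → G q) →
    (∀ z → z ∈ t ↔ ∃ λ r → G r × Sub z r) → Level t
  make-level {G} {t} G-def low levels down t-def = do
    (h , low-h , h-def) ← separation G-def low
    return (h
      , sublevel-history low-h (λ r r∈h → levels r (proj₂ (proj₁ (h-def r) r∈h)))
          (λ r r∈h q q∈r lq →
            let r∈t , Gr = proj₁ (h-def r) r∈h
                Gq = down r q Gr q∈r lq
            in proj₂ (h-def q) (proj₂ (t-def q) (return (q , Gq , ⊆⇒Sub λ _ → id)) , Gq))
      , λ z →
          (λ z∈t → do
            (r , Gr , z-r) ← proj₁ (t-def z) z∈t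
            return (r , proj₂ (h-def r) (proj₂ (t-def r) (return (r , Gr , ⊆⇒Sub λ _ → id)) , Gr) , z-r)) ,
          (λ p → do
            (r , r∈h , z-r) ← p
            proj₂ (t-def z) (return (r , proj₂ (proj₁ (h-def r) r∈h) , z-r))))

  next-level : ∀ {s t} → Level s → Low t → (∀ z → z ∈ t ↔ Sub z s) → Level t
  next-level {s} level low t-def = make-level
    (def₁ (ap₁ Level-def (var 0) d× d∀ (d∈ (var 0) (var 1) d⇒ d∈ (var 0) (con s)))) low
    (λ r → proj₁)
    (λ r q (_ , r⊆s) q∈r lq → lq , level-⊆ level (r⊆s q q∈r) (Level⇒Low lq))
    λ z → (λ z∈t → return (s , (level , λ _ → id) , proj₁ (t-def z) z∈t)) ,
          (λ p → do
            (r , (_ , r⊆s) , z-r) ← p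
            proj₂ (t-def z) (Sub-mono z-r r⊆s))

  -- The levels in `s` form a history, to which `history-induction` applies.
  level-induction : ∀ {F} → Def₁ F → (∀ s → Level s → (∀ r → r ∈ s → Level r → F r) → F s) →
    ∀ s → Level s → F s
  level-induction {F} F-def step s ls = do
      (h , low-h , h-def) ← separation Level-def (Level⇒Low ls)
      let hist = sublevel-history low-h (λ r → proj₂ ∘ proj₁ (h-def r))
            λ r r∈h q q∈r lq → let r∈s , lr = proj₁ (h-def r) r∈h
              in proj₂ (h-def q) (level-⊆ ls r∈s (Level⇒Low lr) q q∈r , lq)
          below = history-induction F-def hist λ y y∈h ih →
            let y∈s , ly = proj₁ (h-def y) y∈h
            in step y ly λ r r∈y lr →
              ih r (proj₂ (h-def r) (level-⊆ ls y∈s (Level⇒Low ly) r r∈y , lr)) r∈y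
      step s ls λ r r∈s lr → below r (proj₂ (h-def r) (r∈s , lr))
    where
    instance
      F-stable : ∀ {x} → Stable (F x)
      F-stable = stable₁ F-def

  level-irrefl : ∀ {s} → Level s → ¬ s ∈ s
  level-irrefl = level-induction (def₁ (d¬ (d∈ (var 0) (var 0)))) (λ s ls ih s∈s → ih s s∈s ls s∈s) _

  data Comparison (s t : Car) : Set where
    below : s ∈ t → Comparison s t
    equal : s ≈ t → Comparison s t
    above : t ∈ s → Comparison s t

  Comparable : Car → Car → Set
  Comparable s t = s ∈ t ∨ s ≈ t ∨ t ∈ s

  compare′ : ∀ {s t} → Comparable s t → ◇ (Comparison s t)
  compare′ c = do
    (inj₁ p) ← cases c where
      (inj₂ d) → do
        (inj₁ p) ← cases d where
          (inj₂ q) → return (above q)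
        return (equal p)
    return (below p)

  -- Double induction. If neither level belongs to the other, each element of `s` fits in a level
  -- `r` of `s`, and the only possible comparison of `r` with `t` is `r ∈ t`. So `s ⊆ t`, and the
  -- inner induction gives the converse in the same way.
  comparable : ∀ s → Level s → ∀ t → Level t → Comparable s t
  comparable = level-induction
    (def₁ (d∀ (ap₁ Level-def (var 0) d⇒ (d∈ (var 1) (var 0) d∨ d≈ (var 1) (var 0) d∨ d∈ (var 0) (var 1)))))
    λ s ls ih → level-induction (def₁ (d∈ (con s) (var 0) d∨ d≈ (con s) (var 0) d∨ d∈ (var 0) (con s)))
      λ t lt jh s∉t s≉t → stable λ t∉s → s≉t (antisym
        (λ z z∈s → do
          (r , r∈s , lr , z-r) ← level-sublevels ls z∈s
          (below r∈t) ← compare′ (ih r r∈s lr t lt) where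
            (equal r≈t) → absurd (t∉s (∈-respˡ r≈t r∈s))
            (above t∈r) → absurd (t∉s (level-⊆ ls r∈s (Level⇒Low lr) t t∈r))
          level-potent lt r∈t (Level⇒Low lr) z-r)
        (λ z z∈t → do
          (r , r∈t , lr , z-r) ← level-sublevels lt z∈t
          (above r∈s) ← compare′ (jh r r∈t lr) where
            (equal s≈r) → absurd (s∉t (∈-respˡ (≈-sym s≈r) r∈t))
            (below s∈r) → absurd (s∉t (level-⊆ lt r∈t (Level⇒Low lr) s s∈r))
          level-potent ls r∈s (Level⇒Low lr) z-r))

  compare : ∀ {s t} → Level s → Level t → ◇ (Comparison s t)
  compare ls lt = compare′ (comparable _ ls _ lt)

  upper-level : ∀ {s t} → Level s → Level t → ∃ λ u → Level u × s ⊆ u × t ⊆ u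
  upper-level {s} {t} ls lt = do
    (below s∈t) ← compare ls lt where
      (equal s≈t) → return (t , lt , ≈⇒⊆ s≈t , λ _ → id)
      (above t∈s) → return (s , ls , (λ _ → id) , level-⊆ ls t∈s (Level⇒Low lt))
    return (t , lt , level-⊆ lt s∈t (Level⇒Low ls) , λ _ → id)

  -- A level without levels in it qualifies too. Where a limit in the usual sense is meant, a level
  -- in it is demanded separately.
  Limit : Car → Set
  Limit l = Level l × (∀ r → r ∈ l → Level r → ∃ λ q → q ∈ l × Level q × r ∈ q)

  Limit-def : Def₁ Limit
  Limit-def = def₁ (ap₁ Level-def (var 0) d× d∀ (d∈ (var 0) (var 1) d⇒ ap₁ Level-def (var 0) d⇒
    d∃ (d∈ (var 0) (var 2) d× ap₁ Level-def (var 0) d× d∈ (var 1) (var 0))))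

  sublevel-largest : ∀ {s r x} → Level s → Level r → (∀ q → q ∈ s → Level q → ¬ r ∈ q) → x ∈ s → Sub x r
  sublevel-largest ls lr max x∈s = do
    (q , q∈s , lq , x-q) ← level-sublevels ls x∈s
    (below q∈r) ← compare lq lr where
      (equal q≈r) → Sub-mono x-q (≈⇒⊆ q≈r)
      (above r∈q) → absurd (max q q∈s lq r∈q)
    Sub-mono x-q (level-⊆ lr q∈r (Level⇒Low lq))

-- The two theories as level structures

record LTCore (𝔐 : Model) : Set₁ where
  open Ambient 𝔐
  infix 4 _∈_
  field
    _∈_ : Car → Car → Set
    mem : Membership _∈_
    ∈-def : Def₂ _∈_
    extensionality : ∀ {a b} → (∀ z → z ∈ a ↔ z ∈ b) → a ≈ b
    separation : ∀ {F} → Def₁ F → ∀ a → ∃ λ b → ∀ x → x ∈ b ↔ x ∈ a × F x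

  lt-structure : LevelStructure 𝔐
  lt-structure = record
    { _∈_ = _∈_ ; mem = mem ; ∈-def = ∈-def
    ; Low = λ _ → ⊤
    ; Sub = λ x c → ∀ z → z ∈ x → z ∈ c
    ; Low-def = def₁ d⊤
    ; Sub-def = def₂ (d∀ (ap₂ ∈-def (var 0) (var 1) d⇒ ap₂ ∈-def (var 0) (var 2)))
    ; extensionality = extensionality
    ; separation = λ F-def {a} _ → do
        (b , b-def) ← separation F-def a
        return (b , tt , b-def)
    ; Sub-mono = λ p q z → q z ∘ p z
    ; ⊆⇒Sub = id
    ; Sub⇒⊆ = λ _ _ → id }

  lt-low-levels : LowLevels lt-structure
  lt-low-levels = record { Level⇒Low = λ _ → tt }

record BLTCore (𝔐 : Model) : Set₁ where
  open Ambient 𝔐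
  infix 4 _∈_
  field
    _∈_ : Car → Car → Set
    mem : Membership _∈_
    ∈-def : Def₂ _∈_
    extensionality : ∀ {a b} → (∀ z → z ∈ a ↔ z ∈ b) → a ≈ b
    complements : ∀ a → ∃ λ c → (∀ z → z ∈ c ↔ ¬ z ∈ a) × (¬ a ∈ a ↔ c ∈ c)
    separation : ∀ {F} → Def₁ F → ∀ {a} → ¬ a ∈ a → ∃ λ b → ¬ b ∈ b × (∀ x → x ∈ b ↔ x ∈ a × F x)
  open Membership mem

  CoSub : Car → Car → Set
  CoSub x c = ∀ z → ¬ z ∈ x → z ∈ c

  BSub : Car → Car → Set
  BSub x c = (∀ z → z ∈ x → z ∈ c) ∨ CoSub x c

  -- A complement of a low set is not included in a low set: it would be low.
  co-unbounded : ∀ {x c} → ¬ x ∈ x → ¬ c ∈ c → ¬ CoSub x c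
  co-unbounded {x} {c} low-x low-c co = do
    (y , y-def , y-high) ← complements x
    (b , low-b , b-def) ← separation (def₁ (ap₂ ∈-def (var 0) (con y))) low-c
    let b≈y = extensionality λ z → proj₂ ∘ proj₁ (b-def z) , λ z∈y → proj₂ (b-def z) (co z (proj₁ (y-def z) z∈y) , z∈y)
    low-b (∈-resp (≈-sym b≈y) (≈-sym b≈y) (proj₁ y-high low-x))

  blt-structure : LevelStructure 𝔐
  blt-structure = record
    { _∈_ = _∈_ ; mem = mem ; ∈-def = ∈-def
    ; Low = λ x → ¬ x ∈ x
    ; Sub = BSub
    ; Low-def = def₁ (d¬ (ap₂ ∈-def (var 0) (var 0)))
    ; Sub-def = def₂ (d∀ (ap₂ ∈-def (var 0) (var 1) d⇒ ap₂ ∈-def (var 0) (var 2)) d∨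
        d∀ (d¬ (ap₂ ∈-def (var 0) (var 1)) d⇒ ap₂ ∈-def (var 0) (var 2)))
    ; extensionality = extensionality
    ; separation = separation
    ; Sub-mono = λ p q n z z∉x → q z (p (λ r → n λ w w∈x → q w (r w w∈x)) z z∉x)
    ; ⊆⇒Sub = left
    ; Sub⇒⊆ = λ low-x low-c p → do
        (inj₁ q) ← cases p where
          (inj₂ q) → absurd (co-unbounded low-x low-c q)
        q }

  open Histories blt-structure hiding (_∈_; mem; ∈-def; extensionality; separation; ∈-stable; ∈-resp)

  -- If `h ∈ c`, then `h` fits in some low `e` of `c` and `h`. Either `h ⊆ e`, and then `e ∈ e`; or
  -- the complement of `h` is inside `e`, and then it takes `h` along because `h ∉ h`, making `e` a
  -- smaller counterexample.
  history-∉ : ∀ {h} → History h → ∀ c → c ∈ h → ¬ h ∈ c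
  history-∉ {h} hist@(low-h , H) = history-induction (def₁ (d¬ (d∈ (con h) (var 0)))) hist
    λ c c∈h ih h∈c → do
      (e , e∈c , e∈h , p) ← proj₁ (proj₂ (H c c∈h) h) h∈c
      (inj₁ q) ← cases p where
        (inj₂ q) → ih e e∈h e∈c (q h low-h)
      proj₁ (H e e∈h) (q e e∈h)

  -- If pot(h) were high, it would be everything, and so contain h.
  blt-low-levels : LowLevels blt-structure
  blt-low-levels = record { Level⇒Low = λ {s} level s∈s → do
    (h , hist@(low-h , H) , pot) ← level
    (c , c∈h , p) ← proj₁ (pot s) s∈s
    (inj₂ q) ← cases p where
      (inj₁ q) → proj₁ (H c c∈h) (q c (proj₂ (pot c) (return (c , c∈h , ⊆⇒Sub λ _ → id))))
    let c⊆s : c ⊆ s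
        c⊆s z z∈c = proj₂ (pot z) (return (c , c∈h , history-transitive hist c c∈h z z∈c))
        h∈s : h ∈ s
        h∈s = stable λ h∉s → h∉s (c⊆s h (q h h∉s))
    (d , d∈h , r) ← proj₁ (pot h) h∈s
    (inj₂ r) ← cases r where
      (inj₁ r) → proj₁ (H d d∈h) (r d d∈h)
    history-∉ hist d d∈h (r h low-h) }

record LTPlus (𝔐 : Model) : Set₁ where
  field core : LTCore 𝔐
  open Ambient 𝔐
  open LTCore core public using (lt-structure; lt-low-levels)
  open Levels lt-low-levels hiding (separation) public
  field
    stratification : ∀ a → ∃ λ s → Level s × a ⊆ s
    endless : ∀ {s} → Level s → ∃ λ t → Level t × s ∈ t

  separation : ∀ {F} → Def₁ F → ∀ a → ∃ λ b → ∀ x → x ∈ b ↔ x ∈ a × F x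
  separation = LTCore.separation core

record BLTPlus (𝔐 : Model) : Set₁ where
  field core : BLTCore 𝔐
  open Ambient 𝔐
  open BLTCore core public using (blt-structure; blt-low-levels; complements; CoSub; co-unbounded)
  open Levels blt-low-levels public
  field
    stratification : ∀ a → Low a → ∃ λ s → Level s × a ⊆ s
    endless : ∀ {s} → Level s → ∃ λ t → Level t × s ∈ t

-- Correspondence with the formal axioms

model-with : (𝔐 : Model) → let open Ambient 𝔐 in ∀ {_ε_} → Membership _ε_ → Model
model-with 𝔐 {_ε_} m = record { frame = Model.frame 𝔐 ; _∈_ = _ε_ ; mem = m }

module Schemas {𝔐 : Model} {_ε_ : Model.Car 𝔐 → Model.Car 𝔐 → Set} (m : Ambient.Membership 𝔐 _ε_) where
  open Ambient 𝔐
  open Truth m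

  inst1-sem : ∀ A (x : V) n {σ ρ : Env} → (∀ k → σ (k + n) ≡ ρ k) →
    sem _ε_ (inst1 A x n) σ ↔ sem _ε_ A (σ (x n) ▹ ρ)
  inst1-sem A x n e = sem-ren A λ { zero → ≈-refl ; (suc k) → ≈-reflexive (e k) }

  inst2-sem : ∀ A (x y : V) n {σ ρ : Env} → (∀ k → σ (k + n) ≡ ρ k) →
    sem _ε_ (inst2 A x y n) σ ↔ sem _ε_ A (σ (x n) ▹ σ (y n) ▹ ρ)
  inst2-sem A x y n e = sem-ren A
    λ { zero → ≈-refl ; (suc zero) → ≈-refl ; (suc (suc k)) → ≈-reflexive (e k) }

module FormalLT {𝔐 : Model} (C : LTCore 𝔐) where
  open Ambient 𝔐
  open LTCore C
  open Levels lt-low-levels using (Level; _⊆_)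

  -- This is literally what `sem` computes for the formula `level`, so axioms about levels can be
  -- used without further translation.
  FormalLevel : Car → Set
  FormalLevel s = ∃ λ h →
    (∀ x → x ∈ h → ∀ z → z ∈ x ↔ ∃ λ c → z ⊆ c × (c ∈ x × c ∈ h)) ×
    (∀ z → z ∈ s ↔ ∃ λ c → z ⊆ c × c ∈ h)

  to-level : ∀ {s} → FormalLevel s → Level s
  to-level l = do
    (h , hist , pot) ← l
    return (h
      , (tt , λ x x∈h → tt , λ z →
          (λ z∈x → do
            (c , p , q , r) ← proj₁ (hist x x∈h z) z∈x
            return (c , q , r , p)) ,
          (λ e → do
            (c , q , r , p) ← e
            proj₂ (hist x x∈h z) (return (c , p , q , r))))
      , λ z →
          (λ z∈s → do
            (c , p , q) ← proj₁ (pot z) z∈s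
            return (c , q , p)) ,
          (λ e → do
            (c , q , p) ← e
            proj₂ (pot z) (return (c , p , q))))
    where open Membership mem

  from-level : ∀ {s} → Level s → FormalLevel s
  from-level l = do
    (h , (_ , hist) , pot) ← l
    return (h
      , (λ x x∈h z →
          (λ z∈x → do
            (c , q , r , p) ← proj₁ (proj₂ (hist x x∈h) z) z∈x
            return (c , p , q , r)) ,
          (λ e → do
            (c , p , q , r) ← e
            proj₂ (proj₂ (hist x x∈h) z) (return (c , q , r , p))))
      , λ z →
          (λ z∈s → do
            (c , q , p) ← proj₁ (pot z) z∈s
            return (c , p , q)) ,
          (λ e → do
            (c , p , q) ← e
            proj₂ (pot z) (return (c , q , p))))
    where open Membership mem

formal-extensionality : ∀ 𝔐 → 𝔐 ⊨ Extensionality → let open Model 𝔐 in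
  ∀ {a b} → (∀ z → z ∈ a ↔ z ∈ b) → a ≈ b
formal-extensionality 𝔐 t {a} {b} e = t (λ _ → Model.pt 𝔐) a b e

formal-separation : ∀ 𝔐 → (∀ A → 𝔐 ⊨ Separation A) → let open Model 𝔐 ; open Definability 𝔐 in
  ∀ {F} → Def₁ F → ∀ a → ∃ λ b → ∀ x → x ∈ b ↔ x ∈ a × F x
formal-separation 𝔐 t F-def a with Definability.schema₁ 𝔐 F-def
... | A , ρ , e = do
    (b , b-def) ← t A ρ a
    return (b , λ x →
      -- `k ∸ 3` is the variable of the third binder, here the innermost one.
      let p , q = inst1-sem A (λ k → k ∸ 3) 3 {x ▹ b ▹ a ▹ ρ} (λ k → cong (x ▹ b ▹ a ▹ ρ) (+-comm k 3))
      in (λ x∈b → let x∈a , s = proj₁ (b-def x) x∈b in x∈a , proj₁ (e x) (p s)) ,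
         (λ (x∈a , f) → proj₂ (b-def x) (x∈a , q (proj₂ (e x) f))))
  where
  open Model 𝔐
  open Schemas {𝔐} mem

lt-core : ∀ 𝔐 → 𝔐 ⊨ Extensionality → (∀ A → 𝔐 ⊨ Separation A) → LTCore 𝔐
lt-core 𝔐 x s = record
  { _∈_ = Model._∈_ 𝔐 ; mem = Model.mem 𝔐 ; ∈-def = def₂ (d∈ (var 0) (var 1))
  ; extensionality = formal-extensionality 𝔐 x ; separation = formal-separation 𝔐 s }
  where open Definability 𝔐

lt-plus : ∀ 𝔐 → Models LT⁺ 𝔐 → LTPlus 𝔐
lt-plus 𝔐 t = record
  { core = core
  ; stratification = λ a → do
      (s , l , p) ← t _ (lt⁺-lt lt-strat) (λ _ → pt) a
      return (s , to-level l , p)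
  ; endless = λ {s} l → do
      (u , m , p) ← t _ lt⁺-endless (λ _ → pt) s (from-level l)
      return (u , to-level m , p) }
  where
  open Ambient 𝔐
  core = lt-core 𝔐 (t _ (lt⁺-lt lt-ext)) (λ A → t _ (lt⁺-lt (lt-sep A)))
  open FormalLT core

module _ {𝔐 : Model} (L : LTPlus 𝔐) where
  open Ambient 𝔐
  open LTPlus L

  models-separation : ∀ A → model-with 𝔐 mem ⊨ Separation A
  models-separation A ρ a = do
      (b , b-def) ← separation (def-sem₁ mem ∈-def A ρ) a
      return (b , λ x →
        let p , q = inst1-sem A (λ k → k ∸ 3) 3 {x ▹ b ▹ a ▹ ρ} (λ k → cong (x ▹ b ▹ a ▹ ρ) (+-comm k 3))
        in (λ x∈b → let x∈a , s = proj₁ (b-def x) x∈b in x∈a , q s) ,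
           (λ (x∈a , s) → proj₂ (b-def x) (x∈a , p s)))
    where open Schemas {𝔐} mem

  models-lt⁺ : Models LT⁺ (model-with 𝔐 mem)
  models-lt⁺ _ (lt⁺-lt lt-ext) ρ a b = extensionality
  models-lt⁺ _ (lt⁺-lt (lt-sep A)) = models-separation A
  models-lt⁺ _ (lt⁺-lt lt-strat) ρ a = do
    (s , l , p) ← stratification a
    return (s , FormalLT.from-level core l , p)
  models-lt⁺ _ lt⁺-endless ρ s l = do
    (u , m , p) ← endless (FormalLT.to-level core l)
    return (u , FormalLT.from-level core m , p)

module FormalBLT {𝔐 : Model} (C : BLTCore 𝔐) where
  open Ambient 𝔐
  open BLTCore C
  open Levels blt-low-levels using (Level; _⊆_; ∈-stable)

  FormalLevel : Car → Set
  FormalLevel s = ∃ λ h →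
    (¬ h ∈ h × (∀ x → x ∈ h → ∀ z → z ∈ x ↔ ∃ λ c → (c ∈ x × c ∈ h) × (¬ c ∈ c × BSub z c))) ×
    (∀ z → z ∈ s ↔ ∃ λ c → c ∈ h × (¬ c ∈ c × BSub z c))

  -- The low members of a boolean history form a history with the same bpot.
  to-level : ∀ {s} → FormalLevel s → Level s
  to-level l = do
    (h , (low-h , hist) , pot) ← l
    (g , low-g , g-def) ← separation (def₁ (d¬ (ap₂ ∈-def (var 0) (var 0)))) low-h
    return (g
      , (low-g , λ x x∈g →
          let x∈h , low-x = proj₁ (g-def x) x∈g in
          low-x , λ z →
          (λ z∈x → do
            (c , (q , r) , low-c , p) ← proj₁ (hist x x∈h z) z∈x
            return (c , q , proj₂ (g-def c) (r , low-c) , p)) ,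
          (λ e → do
            (c , q , r , p) ← e
            let r′ , low-c = proj₁ (g-def c) r
            proj₂ (hist x x∈h z) (return (c , (q , r′) , low-c , p))))
      , λ z →
          (λ z∈s → do
            (c , q , low-c , p) ← proj₁ (pot z) z∈s
            return (c , proj₂ (g-def c) (q , low-c) , p)) ,
          (λ e → do
            (c , q , p) ← e
            let q′ , low-c = proj₁ (g-def c) q
            proj₂ (pot z) (return (c , q′ , low-c , p))))

  from-level : ∀ {s} → Level s → FormalLevel s
  from-level l = do
    (h , (low-h , hist) , pot) ← l
    return (h
      , (low-h , λ x x∈h z →
          (λ z∈x → do
            (c , q , r , p) ← proj₁ (proj₂ (hist x x∈h) z) z∈x
            return (c , (q , r) , proj₁ (hist c r) , p)) ,
          (λ e → do
            (c , (q , r) , _ , p) ← e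
            proj₂ (proj₂ (hist x x∈h) z) (return (c , q , r , p))))
      , λ z →
          (λ z∈s → do
            (c , q , p) ← proj₁ (pot z) z∈s
            return (c , q , proj₁ (hist c q) , p)) ,
          (λ e → do
            (c , q , _ , p) ← e
            proj₂ (pot z) (return (c , q , p))))

blt-core : ∀ 𝔐 → Models BLT 𝔐 → BLTCore 𝔐
blt-core 𝔐 t = record
  { _∈_ = Model._∈_ 𝔐 ; mem = mem ; ∈-def = def₂ (d∈ (var 0) (var 1))
  ; extensionality = formal-extensionality 𝔐 (t _ blt-ext)
  ; complements = t _ blt-comp (λ _ → pt)
  ; separation = sep }
  where
  open Model 𝔐
  open Definability 𝔐
  open Schemas {𝔐} mem
  sep : ∀ {F} → Def₁ F → ∀ {a} → ¬ a ∈ a → ∃ λ b → ¬ b ∈ b × (∀ x → x ∈ b ↔ x ∈ a × F x)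
  sep F-def {a} low with schema₁ F-def
  ... | A , ρ , e = do
    (b , low-b , b-def) ← t _ (blt-sep A) ρ a low
    return (b , low-b , λ x →
      let p , q = inst1-sem A (λ k → k ∸ 3) 3 {x ▹ b ▹ a ▹ ρ} (λ k → cong (x ▹ b ▹ a ▹ ρ) (+-comm k 3))
      in (λ x∈b → let x∈a , s = proj₁ (b-def x) x∈b in x∈a , proj₁ (e x) (p s)) ,
         (λ (x∈a , f) → proj₂ (b-def x) (x∈a , q (proj₂ (e x) f))))

blt-plus : ∀ 𝔐 → Models BLT⁺ 𝔐 → BLTPlus 𝔐
blt-plus 𝔐 t = record
  { core = core
  ; stratification = λ a low → do
      (s , l , p) ← t _ (blt⁺-blt blt-strat) (λ _ → pt) a low
      return (s , to-level l , p)
  ; endless = λ {s} l → do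
      (u , m , p) ← t _ blt⁺-endless (λ _ → pt) s (from-level l)
      return (u , to-level m , p) }
  where
  open Ambient 𝔐
  core = blt-core 𝔐 (λ A p → t A (blt⁺-blt p))
  open FormalBLT core

module _ {𝔐 : Model} (L : BLTPlus 𝔐) where
  open Ambient 𝔐
  open BLTPlus L

  models-blt : Models BLT (model-with 𝔐 mem)
  models-blt _ blt-ext ρ a b = extensionality
  models-blt _ blt-comp ρ a = complements a
  models-blt _ (blt-sep A) ρ a low = do
      (b , low-b , b-def) ← separation (def-sem₁ mem ∈-def A ρ) low
      return (b , low-b , λ x →
        let p , q = inst1-sem A (λ k → k ∸ 3) 3 {x ▹ b ▹ a ▹ ρ} (λ k → cong (x ▹ b ▹ a ▹ ρ) (+-comm k 3))
        in (λ x∈b → let x∈a , s = proj₁ (b-def x) x∈b in x∈a , q s) ,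
           (λ (x∈a , s) → proj₂ (b-def x) (x∈a , p s)))
    where open Schemas {𝔐} mem
  models-blt _ blt-strat ρ a low = do
    (s , l , p) ← stratification a low
    return (s , FormalBLT.from-level core l , p)

  models-blt⁺ : Models BLT⁺ (model-with 𝔐 mem)
  models-blt⁺ A (blt⁺-blt p) = models-blt A p
  models-blt⁺ _ blt⁺-endless ρ s l = do
    (u , m , p) ← endless (FormalBLT.to-level core l)
    return (u , FormalBLT.from-level core m , p)

-- Comparison of two hierarchies of levels on the same domain: under these
-- conditions every level of the first is included in a level of the second. The
-- clauses about limits make up for the lack of replacement.

record Transfer {𝔐 : Model} {S₁ S₂ : LevelStructure 𝔐} (L₁ : LowLevels S₁) (L₂ : LowLevels S₂) : Set₁ where
  open Ambient 𝔐
  module A = Levels L₁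
  module B = Levels L₂
  infix 4 _∈ᴬ_ _∈ᴮ_
  _∈ᴬ_ : Car → Car → Set
  _∈ᴬ_ = A._∈_
  _∈ᴮ_ : Car → Car → Set
  _∈ᴮ_ = B._∈_

  field
    collect : ∀ {F} → Def₁ F → ∀ {t} → A.Level t → (∀ x → F x → x ∈ᴬ t) →
      ∃ λ b → B.Low b × (∀ x → x ∈ᴮ b ↔ F x) × (∀ l → A.Limit l → t ∈ᴬ l → b ∈ᴬ l)
    limit-∈ : ∀ {b c l} → B.Low b → A.Limit l → b ∈ᴬ l → c ∈ᴮ b → c ∈ᴬ l
    bound : ∀ {b} → B.Low b → ∃ λ t → A.Level t × (∀ y → B.Sub y b → y ∈ᴬ t)
    limit-bound : ∀ {b l} → B.Low b → A.Limit l → b ∈ᴬ l → ∃ λ t → A.Level t × t ∈ᴬ l × (∀ y → B.Sub y b → y ∈ᴬ t)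
    -- The room between `v` and `w` is for `g`, which may raise the level by one.
    cover-sub : ∀ {r v w} → A.Level r → B.Level v → B.Level w → v ∈ᴮ w →
      (∀ x → x ∈ᴬ r → x ∈ᴮ v) → ∀ x → A.Sub x r → B.Sub x w

  Next : Car → Car → Set
  Next v w = B.Level w × (∀ z → z ∈ᴮ w ↔ B.Sub z v)

  next-∋ : ∀ {v w} → Next v w → v ∈ᴮ w
  next-∋ (_ , e) = proj₂ (e _) (B.⊆⇒Sub λ _ → id)

  make-next : ∀ {v t} → B.Level v → A.Level t → (∀ y → B.Sub y v → y ∈ᴬ t) →
    ∃ λ w → Next v w × (∀ l → A.Limit l → t ∈ᴬ l → w ∈ᴬ l)
  make-next {v} lv lt p = do
    (w , low , w-def , w-lim) ← collect (def₁ (ap₂ B.Sub-def (var 0) (con v))) lt p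
    return (w , (B.next-level lv low w-def , w-def) , w-lim)

  next : ∀ {v} → B.Level v → ∃ (Next v)
  next lv = do
    (t , lt , p) ← bound (B.Level⇒Low lv)
    (w , n , _) ← make-next lv lt p
    return (w , n)

  next-limit : ∀ {v w l} → B.Level v → Next v w → A.Limit l → v ∈ᴬ l → w ∈ᴬ l
  next-limit lv (_ , e) lim v∈l = do
    (t , lt , t∈l , p) ← limit-bound (B.Level⇒Low lv) lim v∈l
    (w′ , (_ , e′) , w-lim) ← make-next lv lt p
    A.∈-respˡ (B.extensionality λ z → proj₂ (e z) ∘ proj₁ (e′ z) , proj₂ (e′ z) ∘ proj₁ (e z)) (w-lim _ lim t∈l)

  Covered : Car → Set
  Covered s = ∃ λ v → B.Level v × (∀ x → x ∈ᴬ s → x ∈ᴮ v) × (∀ l → A.Limit l → s ∈ᴬ l → v ∈ᴬ l)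

  Covered-def : Def₁ Covered
  Covered-def = def₁ (d∃ (ap₁ B.Level-def (var 0) d×
    d∀ (A.d∈ (var 0) (var 2) d⇒ B.d∈ (var 0) (var 1)) d×
    d∀ (ap₁ A.Limit-def (var 0) d⇒ A.d∈ (var 2) (var 0) d⇒ A.d∈ (var 1) (var 0))))

  record LimitCover (l v : Car) : Set where
    field
      is-level : B.Level v
      covers : ∀ x → x ∈ᴬ l → x ∈ᴮ v
      limits : ∀ m → A.Limit m → l ∈ᴬ m → v ∈ᴬ m
      inside : ∀ {x} → x ∈ᴮ v → x ∈ᴬ l
      levels : ∀ {r} → B.Level r → r ∈ᴬ l → r ∈ᴮ v

  -- Instead of collecting the covers of the levels below `l`, take all levels of the second
  -- hierarchy that are elements of `l`. The last clause of `Covered` ensures that the covers given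
  -- by `ih` are among them.
  limit-cover : ∀ {l} → A.Limit l → (∀ r → r ∈ᴬ l → A.Level r → Covered r) → ∃ (LimitCover l)
  limit-cover {l} lim@(ll , _) ih = do
    (v , low , v-def , v-lim) ← collect
      (def₁ (d∃ ((ap₁ B.Level-def (var 0) d× A.d∈ (var 0) (con l)) d× ap₂ B.Sub-def (var 1) (var 0)))) ll
      λ z p → do
        (r , (lr , r∈l) , z-r) ← p
        (t , lt , t∈l , q) ← limit-bound (B.Level⇒Low lr) lim r∈l
        A.level-⊆ ll t∈l (A.Level⇒Low lt) z (q z z-r)
    return (v , record
      { is-level = B.make-level (def₁ (ap₁ B.Level-def (var 0) d× A.d∈ (var 0) (con l))) low
          (λ _ → proj₁) (λ r q (lr , r∈l) q∈r lq → lq , limit-∈ (B.Level⇒Low lr) lim r∈l q∈r) v-def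
      ; covers = λ x x∈l → do
          (r , r∈l , lr , x-r) ← A.level-sublevels ll x∈l
          (w , lw , w-cov , w-lim) ← ih r r∈l lr
          let w∈l = w-lim l lim r∈l
          (w′ , nw) ← next lw
          proj₂ (v-def x) (return (w′ , (proj₁ nw , next-limit lw nw lim w∈l) ,
            cover-sub lr lw (proj₁ nw) (next-∋ nw) w-cov x x-r))
      ; limits = v-lim
      ; inside = λ {x} x∈v → do
          (r , (lr , r∈l) , x-r) ← proj₁ (v-def x) x∈v
          (t , lt , t∈l , q) ← limit-bound (B.Level⇒Low lr) lim r∈l
          A.level-⊆ ll t∈l (A.Level⇒Low lt) x (q x x-r)
      ; levels = λ {r} lr r∈l → proj₂ (v-def r) (return (r , (lr , r∈l) , B.⊆⇒Sub λ _ → id)) })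

  non-limit : ∀ {s} → ¬ (∀ r → r ∈ᴬ s → A.Level r → ∃ λ q → q ∈ᴬ s × A.Level q × r ∈ᴬ q) →
    ∃ λ r → r ∈ᴬ s × A.Level r × ¬ (Σ Car λ q → q ∈ᴬ s × A.Level q × r ∈ᴬ q)
  non-limit ¬lim n = ¬lim λ r r∈s lr k → n (r , r∈s , lr , k)

  cover : ∀ s → A.Level s → Covered s
  cover = A.level-induction Covered-def λ s ls ih → do
    (inj₁ lim) ← em (∀ r → r ∈ᴬ s → A.Level r → ∃ λ q → q ∈ᴬ s × A.Level q × r ∈ᴬ q) where
      (inj₂ ¬lim) → do
        (r , r∈s , lr , max) ← non-limit ¬lim
        (v , lv , v-cov , v-lim) ← ih r r∈s lr
        -- Two steps up: by `cover-sub`, what fits in `r` fits in `w`, and `u` has it as an element.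
        (w , nw) ← next lv
        (u , nu) ← next (proj₁ nw)
        return (u , proj₁ nu
          , (λ x x∈s → proj₂ (proj₂ nu x) (cover-sub lr lv (proj₁ nw) (next-∋ nw) v-cov x
              (A.sublevel-largest ls lr (λ q q∈s lq r∈q → max (q , q∈s , lq , r∈q)) x∈s)))
          , λ l lim s∈l → next-limit (proj₁ nw) nu lim (next-limit lv nw lim
              (v-lim l lim (A.level-⊆ (proj₁ lim) s∈l (A.Level⇒Low ls) r r∈s))))
    (v , c) ← limit-cover (ls , lim) ih
    return (v , LimitCover.is-level c , LimitCover.covers c , LimitCover.limits c)

  limit-transfer : ∀ {l} → A.Limit l → (∃ λ r → A.Level r × r ∈ᴬ l) →
    ∃ λ v → B.Limit v × (∃ λ r → B.Level r × r ∈ᴮ v)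
  limit-transfer {l} lim ne = do
    (v , c) ← limit-cover lim λ r _ → cover r
    let open LimitCover c
    return (v
      , (is-level , λ r r∈v lr → do
          (w , nw) ← next lr
          return (w , levels (proj₁ nw) (next-limit lr nw lim (inside r∈v)) , proj₁ nw , next-∋ nw))
      , do
          (r , lr , r∈l) ← ne
          (w , lw , _ , w-lim) ← cover r lr
          return (w , lw , levels lw (w-lim l lim r∈l)))

-- Let Z be the class of iterates of ∅ under D. Mapping v ∈ Z to S v, S v to D v,
-- and everything else to itself is a bijection from the universe onto the class
-- of non-empty sets (a Hilbert hotel).

module _ (𝔐 : Model) where
  open Ambient 𝔐

  Shift : (Car → Set) → (Car → Car → Set) → (Car → Car → Set) → Car → Car → Set
  Shift Z S D x y = (Z x → S x y) × (∀ v → Z v → S v x → D v y) × (¬ Z x → ¬ (∃ λ v → Z v × S v x) → x ≈ y)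

  record ShiftData : Set₁ where
    field
      Empty Z : Car → Set
      S D : Car → Car → Set
      Z-def : Def₁ Z
      S-def : Def₂ S
      D-def : Def₂ D
      S-functional : ∀ {v u u′} → S v u → S v u′ → u ≈ u′
      D-functional : ∀ {v u u′} → D v u → D v u′ → u ≈ u′
      S-total : ∀ v → ∃ (S v)
      D-total : ∀ v → ∃ (D v)
      S-injective : ∀ {v v′ u} → Z v → Z v′ → S v u → S v′ u → v ≈ v′
      D-injective : ∀ {v v′ u} → Z v → Z v′ → D v u → D v′ u → v ≈ v′
      S-nonempty : ∀ {v u} → Z v → S v u → ¬ Empty u
      D-nonempty : ∀ {v u} → D v u → ¬ Empty u
      S-odd : ∀ {v u} → Z v → S v u → ¬ Z u
      Z-empty : ∀ {x} → Empty x → Z x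
      Z-step : ∀ {v x} → Z v → D v x → Z x
      Z-unfold : ∀ {x} → Z x → Empty x ∨ (∃ λ v → Z v × D v x)

    Gr : Car → Car → Set
    Gr = Shift Z S D

    Gr-def : Def₂ Gr
    Gr-def = def₂ ((ap₁ Z-def (var 0) d⇒ ap₂ S-def (var 0) (var 1)) d×
      d∀ (ap₁ Z-def (var 0) d⇒ ap₂ S-def (var 0) (var 1) d⇒ ap₂ D-def (var 0) (var 2)) d×
      (d¬ (ap₁ Z-def (var 0)) d⇒ d¬ (d∃ (ap₁ Z-def (var 0) d× ap₂ S-def (var 0) (var 1))) d⇒
        d≈ (var 0) (var 1)))

    -- Even and odd refer to positions in the sequence `∅`, `S ∅`, `D ∅`, `S (D ∅)`, and so on,
    -- along which `Gr` moves each term one place.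
    data Kind (x : Car) : Set where
      even : Z x → Kind x
      odd : ∀ v → Z v → S v x → Kind x
      other : ¬ Z x → ¬ (∃ λ v → Z v × S v x) → Kind x

    kind : ∀ x → ◇ (Kind x)
    kind x n = n (other (n ∘ even) λ e → e λ (v , Zv , Svx) → n (odd v Zv Svx))

    instance
      S-stable : ∀ {x y} → Stable (S x y)
      S-stable = stable₂ S-def
      D-stable : ∀ {x y} → Stable (D x y)
      D-stable = stable₂ D-def

    gr-even : ∀ {x y} → Z x → S x y → Gr x y
    gr-even Zx Sxy = (λ _ → Sxy) , (λ v Zv Svx → absurd (S-odd Zv Svx Zx)) , λ ¬Zx → absurd (¬Zx Zx)

    gr-odd : ∀ {v x y} → Z v → S v x → D v y → Gr x y
    gr-odd Zv Svx Dvy = (λ Zx → absurd (S-odd Zv Svx Zx)) ,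
      (λ v′ Zv′ Sv′x → resp₂ D-def (S-injective Zv Zv′ Svx Sv′x) ≈-refl Dvy) ,
      λ _ none → absurd (none (return (_ , Zv , Svx)))

    gr-other : ∀ {x y} → ¬ Z x → ¬ (∃ λ v → Z v × S v x) → x ≈ y → Gr x y
    gr-other ¬Zx none e = (λ Zx → absurd (¬Zx Zx)) , (λ v Zv Svx → absurd (none (return (v , Zv , Svx)))) , λ _ _ → e

    gr-total : ∀ x → ∃ (Gr x)
    gr-total x = do
      (even Zx) ← kind x where
        (odd v Zv Svx) → do
          (y , Dvy) ← D-total v
          return (y , gr-odd Zv Svx Dvy)
        (other ¬Zx none) → return (x , gr-other ¬Zx none ≈-refl)
      (y , Sxy) ← S-total x
      return (y , gr-even Zx Sxy)

    gr-functional : ∀ {x y y′} → Gr x y → Gr x y′ → y ≈ y′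
    gr-functional {x} (a , b , c) (a′ , b′ , c′) = do
      (even Zx) ← kind x where
        (odd v Zv Svx) → D-functional (b v Zv Svx) (b′ v Zv Svx)
        (other ¬Zx none) → ≈-trans (≈-sym (c ¬Zx none)) (c′ ¬Zx none)
      S-functional (a Zx) (a′ Zx)

    gr-injective : ∀ {x x′ y} → Gr x y → Gr x′ y → x ≈ x′
    gr-injective {x} {x′} {y} (a , b , c) (a′ , b′ , c′) = do
      k ← kind x
      k′ ← kind x′
      by-kinds k k′
      where
      by-kinds : Kind x → Kind x′ → x ≈ x′
      by-kinds (even Zx) (even Zx′) = S-injective Zx Zx′ (a Zx) (a′ Zx′)
      by-kinds (even Zx) (odd v Zv Svx′) = absurd (S-odd Zx (a Zx) (Z-step Zv (b′ v Zv Svx′)))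
      by-kinds (even Zx) (other ¬Zx′ none′) =
        absurd (none′ (return (x , Zx , resp₂ S-def ≈-refl (≈-sym (c′ ¬Zx′ none′)) (a Zx))))
      by-kinds (odd v Zv Svx) (even Zx′) = absurd (S-odd Zx′ (a′ Zx′) (Z-step Zv (b v Zv Svx)))
      by-kinds (odd v Zv Svx) (odd v′ Zv′ Sv′x′) = S-functional
        (resp₂ S-def (D-injective Zv Zv′ (b v Zv Svx) (b′ v′ Zv′ Sv′x′)) ≈-refl Svx) Sv′x′
      by-kinds (odd v Zv Svx) (other ¬Zx′ none′) =
        absurd (¬Zx′ (resp₁ Z-def (≈-sym (c′ ¬Zx′ none′)) (Z-step Zv (b v Zv Svx))))
      by-kinds (other ¬Zx none) (even Zx′) =
        absurd (none (return (x′ , Zx′ , resp₂ S-def ≈-refl (≈-sym (c ¬Zx none)) (a′ Zx′))))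
      by-kinds (other ¬Zx none) (odd v Zv Svx′) =
        absurd (¬Zx (resp₁ Z-def (≈-sym (c ¬Zx none)) (Z-step Zv (b′ v Zv Svx′))))
      by-kinds (other ¬Zx none) (other ¬Zx′ none′) = ≈-trans (c ¬Zx none) (≈-sym (c′ ¬Zx′ none′))

    gr-nonempty : ∀ {x y} → Gr x y → ¬ Empty y
    gr-nonempty {x} (a , b , c) ey = do
      (even Zx) ← kind x where
        (odd v Zv Svx) → D-nonempty (b v Zv Svx) ey
        (other ¬Zx none) → ¬Zx (resp₁ Z-def (≈-sym (c ¬Zx none)) (Z-empty ey))
      S-nonempty Zx (a Zx) ey

    gr-onto : ∀ y → ¬ Empty y → ∃ λ x → Gr x y
    gr-onto y ne = do
      (even Zy) ← kind y where
        (odd v Zv Svy) → return (v , gr-even Zv Svy)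
        (other ¬Zy none) → return (y , gr-other ¬Zy none ≈-refl)
      (inj₂ e) ← cases (Z-unfold Zy) where
        (inj₁ e) → absurd (ne e)
      (v , Zv , Dvy) ← e
      (x , Svx) ← S-total v
      return (x , gr-odd Zv Svx Dvy)

-- The data for LT: S v = v ∪ {∅} and D v = {v ∪ {∅}}

module LTShift (𝔐 : Model) (_∈_ : Model.Car 𝔐 → Model.Car 𝔐 → Set) where
  open Ambient 𝔐

  Empty : Car → Set
  Empty x = ∀ z → ¬ z ∈ x

  S : Car → Car → Set
  S v u = ∀ t → t ∈ u ↔ t ∈ v ∨ Empty t

  D : Car → Car → Set
  D v u = ∀ z → z ∈ u ↔ S v z

  -- The set `w` traces `x` back: each of its elements is empty or `D` of another. As sets are
  -- well-founded, such a trace can end only at `∅`.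
  Z : Car → Set
  Z x = ∃ λ w → x ∈ w × (∀ u → u ∈ w → (∃ λ v → v ∈ w × D v u) ∨ Empty u)

  Fl : Car → Set
  Fl y = ∀ e → Empty e → e ∈ y

  -- x ε y is "g x ∈ y, exclusive or ∅ ∈ y", for g the bijection given by Shift.
  Eps : Car → Car → Set
  Eps x y = ∀ x′ → Shift 𝔐 Z S D x x′ → (Fl y → ¬ x′ ∈ y) × (¬ Fl y → x′ ∈ y)

  module _ (∈-def : Def₂ _∈_) where

    Empty-def : ∀ i → Def (λ ρ → Empty (ρ i))
    Empty-def i = d∀ (d¬ (ap₂ ∈-def (var 0) (var (suc i))))

    S-def′ : ∀ i j → Def (λ ρ → S (ρ i) (ρ j))
    S-def′ i j = d∀ (ap₂ ∈-def (var 0) (var (suc j)) d↔ (ap₂ ∈-def (var 0) (var (suc i)) d∨ Empty-def 0))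

    D-def′ : ∀ i j → Def (λ ρ → D (ρ i) (ρ j))
    D-def′ i j = d∀ (ap₂ ∈-def (var 0) (var (suc j)) d↔ S-def′ (suc i) 0)

    S-def₂ : Def₂ S
    S-def₂ = def₂ (S-def′ 0 1)

    D-def₂ : Def₂ D
    D-def₂ = def₂ (D-def′ 0 1)

    Z-def′ : Def₁ Z
    Z-def′ = def₁ (d∃ (ap₂ ∈-def (var 1) (var 0) d×
      d∀ (ap₂ ∈-def (var 0) (var 1) d⇒ (d∃ (ap₂ ∈-def (var 0) (var 2) d× D-def′ 0 1) d∨
        Empty-def 0))))

module LTFacts {𝔐 : Model} (L : LTPlus 𝔐) where
  open Ambient 𝔐
  open LTPlus L public
  open LTShift 𝔐 _∈_ public

  d-empty : ∀ i → Def (λ ρ → Empty (ρ i))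
  d-empty = Empty-def ∈-def

  empty : ∃ Empty
  empty = do
    (e , e-def) ← separation (def₁ d⊥) pt
    return (e , λ z z∈e → proj₂ (proj₁ (e-def z) z∈e))

  empty-unique : ∀ {d e} → Empty d → Empty e → d ≈ e
  empty-unique p q = antisym (λ z → absurd ∘ p z) (λ z → absurd ∘ q z)

  room : ∀ a → ∃ λ t → Level t × a ⊆ t × a ∈ t × (∀ e → Empty e → e ∈ t)
  room a = do
    (s , ls , a⊆s) ← stratification a
    (t , lt , s∈t) ← endless ls
    return (t , lt , (λ z → level-⊆ lt s∈t tt z ∘ a⊆s z) , level-potent lt s∈t tt a⊆s ,
      λ e p → level-potent lt s∈t tt (λ z → absurd ∘ p z))

  -- A non-empty term is some `D v`, whose only element `v ∪ {∅}` is not empty.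
  Z-∌ : ∀ {v e} → Z v → Empty e → ¬ e ∈ v
  Z-∌ {v} {e} Zv p e∈v = do
    (w , v∈w , w-def) ← Zv
    (inj₁ q) ← cases (w-def v v∈w) where
      (inj₂ q) → q e e∈v
    (u , u∈w , Duv) ← q
    p e (proj₂ (proj₁ (Duv e) e∈v e) (right p))

  lt-shift : ShiftData 𝔐
  lt-shift = record
    { Empty = Empty ; Z = Z ; S = S ; D = D
    ; Z-def = Z-def′ ∈-def ; S-def = S-def₂ ∈-def ; D-def = D-def₂ ∈-def
    ; S-functional = S-fun
    ; D-functional = λ p q → extensionality λ z → proj₂ (q z) ∘ proj₁ (p z) , proj₂ (p z) ∘ proj₁ (q z)
    ; S-total = S-tot
    ; D-total = λ v → do
        (z , p) ← S-tot v
        (t , _ , _ , z∈t , _) ← room z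
        (u , u-def) ← separation (def₁ (ap₂ (S-def₂ ∈-def) (con v) (var 0))) t
        return (u , λ y → proj₂ ∘ proj₁ (u-def y) ,
          λ q → proj₂ (u-def y) (∈-respˡ (S-fun p q) z∈t , q))
    ; S-injective = S-inj
    ; D-injective = λ {v} Zv Zv′ p q → do
        (z , r) ← S-tot v
        S-inj Zv Zv′ r (proj₁ (q z) (proj₂ (p z) r))
    ; S-nonempty = λ _ p e → do
        (d , q) ← empty
        e d (proj₂ (p d) (right q))
    ; D-nonempty = λ {v} p e → do
        (z , r) ← S-tot v
        e z (proj₂ (p z) r)
    ; S-odd = λ Zv p Zu → do
        (d , q) ← empty
        Z-∌ Zu q (proj₂ (p d) (right q))
    ; Z-empty = λ {x} p → do
        (t , _ , _ , x∈t , _) ← room x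
        (w , w-def) ← separation (def₁ (d-empty 0)) t
        return (w , proj₂ (w-def x) (x∈t , p) , λ u u∈w → right (proj₂ (proj₁ (w-def u) u∈w)))
    ; Z-step = λ {v} {x} Zv p → do
        (w , v∈w , w-def) ← Zv
        (s , ls , w⊆s , _ , _) ← room w
        (t , lt , _ , x∈t , _) ← room x
        (m , _ , s⊆m , t⊆m) ← upper-level ls lt
        (w′ , w′-def) ← separation (def₁ (d∈ (var 0) (con w) d∨ d≈ (var 0) (con x))) m
        let inc : ∀ y → y ∈ w → y ∈ w′
            inc y y∈w = proj₂ (w′-def y) (s⊆m y (w⊆s y y∈w) , left y∈w)
        return (w′ , proj₂ (w′-def x) (t⊆m x x∈t , right ≈-refl) , λ u u∈w′ → do
          (inj₁ u∈w) ← cases (proj₂ (proj₁ (w′-def u) u∈w′)) where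
            (inj₂ u≈x) → left (return (v , inc v v∈w ,
              λ z → proj₁ (p z) ∘ ∈-respʳ u≈x , ∈-respʳ (≈-sym u≈x) ∘ proj₂ (p z)))
          (inj₁ q) ← cases (w-def u u∈w) where
            (inj₂ e) → right e
          (y , y∈w , Dyu) ← q
          left (return (y , inc y y∈w , Dyu)))
    ; Z-unfold = λ {x} Zx → do
        (w , x∈w , w-def) ← Zx
        (inj₂ e) ← cases (w-def x x∈w) where
          (inj₁ q) → right (do
            (v , v∈w , Dvx) ← q
            return (v , return (w , v∈w , w-def) , Dvx))
        left e
    }
    where
    S-fun : ∀ {v u u′} → S v u → S v u′ → u ≈ u′
    S-fun p q = extensionality λ z → proj₂ (q z) ∘ proj₁ (p z) , proj₂ (p z) ∘ proj₁ (q z)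
    S-tot : ∀ v → ∃ (S v)
    S-tot v = do
      (t , lt , v⊆t , _ , ∅∈t) ← room v
      (u , u-def) ← separation (def₁ (d∈ (var 0) (con v) d∨ d-empty 0)) t
      return (u , λ x → proj₂ ∘ proj₁ (u-def x) , λ p → proj₂ (u-def x)
        ((do (inj₁ x∈v) ← cases p where
               (inj₂ e) → ∅∈t x e
             v⊆t x x∈v) , p))
    S-⊆ : ∀ {v v′ u} → Z v → S v u → S v′ u → v ⊆ v′
    S-⊆ Zv p q z z∈v = do
      (inj₁ r) ← cases (proj₁ (q z) (proj₂ (p z) (left z∈v))) where
        (inj₂ e) → absurd (Z-∌ Zv e z∈v)
      r
    S-inj : ∀ {v v′ u} → Z v → Z v′ → S v u → S v′ u → v ≈ v′
    S-inj Zv Zv′ p q = antisym (S-⊆ Zv p q) (S-⊆ Zv′ q p)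

  open ShiftData lt-shift public using (Gr; Gr-def; even; odd; other; kind; gr-total; gr-functional; gr-injective;
    gr-nonempty; gr-onto; gr-even; Z-empty; Z-step)

-- Boolean sets inside LT⁺

module FromLT {𝔐 : Model} (L : LTPlus 𝔐) where
  open Ambient 𝔐
  open LTFacts L

  infix 4 _ε_
  _ε_ : Car → Car → Set
  _ε_ = Eps

  ε-def : Def₂ _ε_
  ε-def = def₂ (d∀ (ap₂ Gr-def (var 1) (var 0) d⇒
    ((fl d⇒ d¬ (d∈ (var 0) (var 2))) d× (d¬ fl d⇒ d∈ (var 0) (var 2)))))
    where
    fl : Def (λ ρ → Fl (ρ 2))
    fl = d∀ (d-empty 0 d⇒ d∈ (var 0) (var 3))

  ε-mem : Membership _ε_
  ε-mem = record { ∈-stable = stable-Π ; ∈-resp = resp₂ ε-def }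

  fl : ∀ {e y} → Empty e → e ∈ y → Fl y
  fl p e∈y d q = ∈-respˡ (empty-unique p q) e∈y

  ε-low : ∀ {x x′ y} → Gr x x′ → ¬ Fl y → x ε y ↔ x′ ∈ y
  ε-low g ¬f = (λ p → proj₂ (p _ g) ¬f) ,
    (λ q x″ g′ → (λ f → absurd (¬f f)) , λ _ → ∈-respˡ (gr-functional g g′) q)

  ε-high : ∀ {x x′ y} → Gr x x′ → Fl y → x ε y ↔ ¬ x′ ∈ y
  ε-high g f = (λ p → proj₁ (p _ g) f) ,
    (λ q x″ g′ → (λ _ → q ∘ ∈-respˡ (gr-functional g′ g)) , λ ¬f → absurd (¬f f))

  -- `g` never lowers the level: `g x` is `x ∪ {∅}`, `{x}` or `x`. By `gr-up` it raises it by at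
  -- most one.
  gr-down : ∀ {s x x′} → Level s → Gr x x′ → x′ ∈ s → x ∈ s
  gr-down {s} {x} {x′} ls (a , b , c) x′∈s = do
    (even Zx) ← kind x where
      (odd v Zv Svx) → level-⊆ ls x′∈s tt x (proj₂ (b v Zv Svx x) Svx)
      (other ¬Zx none) → ∈-respˡ (≈-sym (c ¬Zx none)) x′∈s
    level-potent ls x′∈s tt λ z z∈x → proj₂ (a Zx z) (left z∈x)

  gr-up : ∀ {s t x x′} → Level s → Level t → s ∈ t → Gr x x′ → x ∈ s → x′ ∈ t
  gr-up {s} {t} {x} ls lt s∈t (a , b , c) x∈s = do
    (even Zx) ← kind x where
      (odd v Zv Svx) → level-potent lt s∈t tt λ z z∈x′ →
        ∈-respˡ (ShiftData.S-functional lt-shift Svx (proj₁ (b v Zv Svx z) z∈x′)) x∈s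
      (other ¬Zx none) → level-⊆ lt s∈t tt _ (∈-respˡ (c ¬Zx none) x∈s)
    level-potent lt s∈t tt λ z z∈x′ → do
      (inj₁ z∈x) ← cases (proj₁ (a Zx z) z∈x′) where
        (inj₂ e) → level-potent ls x∈s tt λ w → absurd ∘ e w
      level-⊆ ls x∈s tt z z∈x

  -- If `g y ∈ y`, then `y` would belong to every level that includes it, by `gr-down`. This makes
  -- being high, in the sense of `ε`, the same as having `∅` as an element.
  gr-∉ : ∀ {y y′} → Gr y y′ → ¬ y′ ∈ y
  gr-∉ {y} {y′} g y′∈y = do
    (s , ls , y⊆s) ← stratification y
    level-induction
      (def₁ (d∀ (d∀ (d∈ (var 0) (var 1) d⇒ d∈ (var 0) (var 2)) d⇒
        d∀ (ap₂ Gr-def (var 1) (var 0) d⇒ d¬ (d∈ (var 0) (var 1))))))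
      (λ s ls ih y y⊆s y′ g y′∈y → do
        (r , r∈s , lr , y⊆r) ← level-sublevels ls (gr-down ls g (y⊆s y′ y′∈y))
        ih r r∈s lr y y⊆r y′ g y′∈y)
      s ls y y⊆s y′ g y′∈y

  ε-self : ∀ {y} → y ε y ↔ Fl y
  ε-self {y} = (λ p → do
      (y′ , g) ← gr-total y
      (inj₁ f) ← em (Fl y) where
        (inj₂ ¬f) → absurd (gr-∉ g (proj₁ (ε-low g ¬f) p))
      f) ,
    (λ f y′ g → (λ _ → gr-∉ g) , λ ¬f → absurd (¬f f))

  -- A test point for the mark: if `g x` is in neither set, then `x` is an `ε`-member of just the
  -- high ones among them.
  outside : ∀ a b → ∃ λ y → ¬ Empty y × ¬ y ∈ a × ¬ y ∈ b
  outside a b = do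
    (s , ls , a⊆s , _) ← room a
    (t , lt , b⊆t , _) ← room b
    (m , lm , s⊆m , t⊆m) ← upper-level ls lt
    (n , ln , m∈n) ← endless lm
    let n∉m : ¬ n ∈ m
        n∉m n∈m = level-irrefl lm (level-⊆ lm n∈m tt m m∈n)
    return (n , (λ e → e m m∈n) , (λ n∈a → n∉m (s⊆m n (a⊆s n n∈a))) , λ n∈b → n∉m (t⊆m n (b⊆t n n∈b)))

  private
    flags-agree : ∀ {a b} → (∀ z → z ε a ↔ z ε b) → Fl a → Fl b
    flags-agree {a} {b} p f = do
      (y , ne , y∉a , y∉b) ← outside a b
      (x , g) ← gr-onto y ne
      (inj₁ f′) ← em (Fl b) where
        (inj₂ ¬f) → absurd (y∉b (proj₁ (ε-low g ¬f) (proj₁ (p x) (proj₂ (ε-high g f) y∉a))))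
      f′

    ε-⊆ : ∀ {a b} → (∀ z → z ε a ↔ z ε b) → a ⊆ b
    ε-⊆ {a} {b} p z z∈a = do
      (inj₂ ne) ← em (Empty z) where
        (inj₁ e) → flags-agree p (fl e z∈a) z e
      (x , g) ← gr-onto z ne
      (inj₁ f) ← em (Fl a) where
        (inj₂ ¬f) → proj₁ (ε-low g (¬f ∘ flags-agree (λ z → proj₂ (p z) , proj₁ (p z))))
          (proj₁ (p x) (proj₂ (ε-low g ¬f) z∈a))
      stable λ z∉b → proj₁ (ε-high g f) (proj₂ (p x) (proj₂ (ε-high g (flags-agree p f)) z∉b)) z∈a

  ε-extensionality : ∀ {a b} → (∀ z → z ε a ↔ z ε b) → a ≈ b
  ε-extensionality p = antisym (ε-⊆ p) (ε-⊆ λ z → proj₂ (p z) , proj₁ (p z))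

  ε-complements : ∀ a → ∃ λ c → (∀ z → z ε c ↔ ¬ z ε a) × (¬ a ε a ↔ c ε c)
  ε-complements a = do
    (e , e-empty) ← empty
    (t , lt , a⊆t , _ , ∅∈t) ← room a
    -- `c` differs from `a` only in whether it contains `∅`.
    (c , c-def) ← separation (def₁ ((d¬ (d-empty 0) d⇒ d∈ (var 0) (con a)) d×
      (d-empty 0 d⇒ d¬ (d∈ (con e) (con a))))) t
    let flip-fl : Fl c → ¬ Fl a
        flip-fl f f′ = proj₂ (proj₂ (proj₁ (c-def e) (f e e-empty))) e-empty (f′ e e-empty)
        flip-¬fl : ¬ Fl a → Fl c
        flip-¬fl ¬f d p = proj₂ (c-def d) (∅∈t d p , (λ ne → absurd (ne p)) , λ _ e∈a → ¬f (fl e-empty e∈a))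
        same₁ : ∀ {y} → ¬ Empty y → y ∈ a → y ∈ c
        same₁ ne y∈a = proj₂ (c-def _) (a⊆t _ y∈a , (λ _ → y∈a) , λ p → absurd (ne p))
        same₂ : ∀ {y} → ¬ Empty y → y ∈ c → y ∈ a
        same₂ ne y∈c = proj₁ (proj₂ (proj₁ (c-def _) y∈c)) ne
    return (c , (λ z →
        (λ p q → do
          (z′ , g) ← gr-total z
          let ne = gr-nonempty g
          (inj₁ f) ← em (Fl a) where
            (inj₂ ¬f) → proj₁ (ε-high g (flip-¬fl ¬f)) p (same₁ ne (proj₁ (ε-low g ¬f) q))
          proj₁ (ε-high g f) q (same₂ ne (proj₁ (ε-low g λ f′ → flip-fl f′ f) p))) ,
        (λ p → do
          (z′ , g) ← gr-total z
          let ne = gr-nonempty g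
          (inj₁ f) ← em (Fl a) where
            (inj₂ ¬f) → proj₂ (ε-high g (flip-¬fl ¬f)) λ q → p (proj₂ (ε-low g ¬f) (same₂ ne q))
          proj₂ (ε-low g λ f′ → flip-fl f′ f) (stable λ q → p (proj₂ (ε-high g f) λ r → q (same₁ ne r))))) ,
      (λ p → proj₂ ε-self (flip-¬fl λ f → p (proj₂ ε-self f))) ,
      (λ p q → flip-fl (proj₁ ε-self p) (proj₁ ε-self q)))

  ε-separation : ∀ {F} → Def₁ F → ∀ {a} → ¬ a ε a → ∃ λ b → ¬ b ε b × (∀ x → x ε b ↔ x ε a × F x)
  ε-separation {F} F-def {a} low = do
      let ¬fa : ¬ Fl a
          ¬fa = low ∘ proj₂ ε-self
      (b , b-def) ← separation (def₁ (d∃ (ap₂ Gr-def (var 0) (var 1) d× ap₁ F-def (var 0)))) a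
      let ¬fb : ¬ Fl b
          ¬fb f = ¬fa λ e p → proj₁ (proj₁ (b-def e) (f e p))
      return (b , ¬fb ∘ proj₁ ε-self , λ x →
        (λ p → do
          (x′ , g) ← gr-total x
          let x′∈a , q = proj₁ (b-def x′) (proj₁ (ε-low g ¬fb) p)
          (y , g′ , Fy) ← q
          proj₂ (ε-low g ¬fa) x′∈a , resp₁ F-def (gr-injective g′ g) Fy) ,
        (λ (p , Fx) → do
          (x′ , g) ← gr-total x
          proj₂ (ε-low g ¬fb) (proj₂ (b-def x′) (proj₁ (ε-low g ¬fa) p , return (x , g , Fx)))))
    where
    instance
      F-stable : ∀ {x} → Stable (F x)
      F-stable = stable₁ F-def

  blt-core′ : BLTCore 𝔐
  blt-core′ = record
    { _∈_ = _ε_ ; mem = ε-mem ; ∈-def = ε-def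
    ; extensionality = ε-extensionality ; complements = ε-complements ; separation = ε-separation }

  module C = BLTCore blt-core′
  module B = Levels C.blt-low-levels

  ε-collect : ∀ {F} → Def₁ F → ∀ {t} → Level t → (∀ x → F x → x ∈ t) →
    ∃ λ b → ¬ Fl b × (∀ x → x ε b ↔ F x) × (∀ u → Level u → t ∈ u → b ⊆ u)
  ε-collect {F} F-def {t} lt F⊆t = do
      (u , lu , t∈u) ← endless lt
      (b , b-def) ← separation (def₁ (d∃ (ap₂ Gr-def (var 0) (var 1) d× ap₁ F-def (var 0)))) u
      let ¬fb : ¬ Fl b
          ¬fb f = do
            (e , p) ← empty
            (x , g , _) ← proj₂ (proj₁ (b-def e) (f e p))
            gr-nonempty g p
      return (b , ¬fb , (λ x →
        (λ p → do
          (x′ , g) ← gr-total x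
          (y , g′ , Fy) ← proj₂ (proj₁ (b-def x′) (proj₁ (ε-low g ¬fb) p))
          resp₁ F-def (gr-injective g′ g) Fy) ,
        (λ Fx → do
          (x′ , g) ← gr-total x
          proj₂ (ε-low g ¬fb) (proj₂ (b-def x′) (gr-up lt lu t∈u g (F⊆t x Fx) , return (x , g , Fx))))) ,
        λ w lw t∈w z z∈b → do
          (x , g , Fx) ← proj₂ (proj₁ (b-def z) z∈b)
          gr-up lt lw t∈w g (F⊆t x Fx))
    where
    instance
      F-stable : ∀ {x} → Stable (F x)
      F-stable = stable₁ F-def

  -- Complementing changes only whether `∅` is an element, so the boolean notion of fitting becomes
  -- inclusion up to `∅`.
  sub-⊆ : ∀ {y b} → ¬ b ε b → B.Sub y b → ∀ z → z ∈ y → z ∈ b ∨ Empty z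
  sub-⊆ {y} {b} low-b p z z∈y = do
    (inj₂ ne) ← em (Empty z) where
      (inj₁ e) → right e
    (x , g) ← gr-onto z ne
    let ¬fb = low-b ∘ proj₂ ε-self
    (inj₁ q) ← cases p where
      (inj₂ co) → do
        (inj₁ f) ← em (Fl y) where
          (inj₂ ¬f) → absurd (C.co-unbounded (¬f ∘ proj₁ ε-self) low-b co)
        left (proj₁ (ε-low g ¬fb) (co x λ xεy → proj₁ (ε-high g f) xεy z∈y))
    let ¬fy = B.Low-⊆ low-b q ∘ proj₂ ε-self
    left (proj₁ (ε-low g ¬fb) (q x (proj₂ (ε-low g ¬fy) z∈y)))

  ε-∈ : ∀ {s b c} → Level s → ¬ b ε b → b ⊆ s → c ε b → c ∈ s
  ε-∈ {c = c} ls low b⊆s cεb = do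
    (c′ , g) ← gr-total c
    gr-down ls g (b⊆s c′ (proj₁ (ε-low g (low ∘ proj₂ ε-self)) cεb))

  sub-bound : ∀ {b s t} → ¬ b ε b → Level s → Level t → s ∈ t → b ⊆ s → (∀ e → Empty e → e ∈ s) →
    ∀ y → B.Sub y b → y ∈ t
  sub-bound low ls lt s∈t b⊆s ∅∈s y p = level-potent lt s∈t tt λ z z∈y → do
    (inj₁ z∈b) ← cases (sub-⊆ low p z z∈y) where
      (inj₂ e) → ∅∈s z e
    b⊆s z z∈b

  transfer : Transfer lt-low-levels C.blt-low-levels
  transfer = record
    { collect = λ F-def lt F⊆t → do
        (b , ¬fb , b-def , b-loc) ← ε-collect F-def lt F⊆t
        return (b , ¬fb ∘ proj₁ ε-self , b-def , λ l (ll , lim) t∈l → do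
          (q , q∈l , lq , t∈q) ← lim _ t∈l lt
          level-potent ll q∈l tt (b-loc q lq t∈q))
    ; limit-∈ = λ low (ll , _) b∈l cεb → ε-∈ ll low (level-⊆ ll b∈l tt) cεb
    ; bound = λ {b} low → do
        (s , ls , b⊆s , _ , ∅∈s) ← room b
        (t , lt , s∈t) ← endless ls
        return (t , lt , sub-bound low ls lt s∈t b⊆s ∅∈s)
    ; limit-bound = λ {b} low (ll , lim) b∈l → do
        (r , r∈l , lr , b⊆r) ← level-sublevels ll b∈l
        -- `s` contains `∅` in addition to the elements of `b`; `t` then contains the subsets of
        -- `b ∪ {∅}`.
        (s , s∈l , ls , r∈s) ← lim r r∈l lr
        (t , t∈l , lt , s∈t) ← lim s s∈l ls
        return (t , lt , t∈l , sub-bound low ls lt s∈t (λ z → level-⊆ ls r∈s tt z ∘ b⊆r z)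
          λ e p → level-potent ls r∈s tt λ w → absurd ∘ p w)
    ; cover-sub = λ {r} {v} {w} lr lv lw v∈w cov x x⊆r → do
        let v⊆w = B.level-⊆ lw v∈w (B.Level⇒Low lv)
            into : ∀ {u u′} → Gr u u′ → u′ ∈ x → u ε w
            into g u′∈x = v⊆w _ (cov _ (gr-down lr g (x⊆r _ u′∈x)))
        (inj₁ f) ← em (Fl x) where
          (inj₂ ¬f) → left λ u uεx → do
            (u′ , g) ← gr-total u
            into g (proj₁ (ε-low g ¬f) uεx)
        right λ u ¬uεx → do
          (u′ , g) ← gr-total u
          into g (stable λ u′∉x → ¬uεx (proj₂ (ε-high g f) u′∉x)) }

  module T = Transfer transfer

  blt-plus′ : BLTPlus 𝔐
  blt-plus′ = record
    { core = blt-core′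
    ; stratification = λ a low → do
        (s , ls , a⊆s) ← stratification a
        (v , lv , cov , _) ← T.cover s ls
        return (v , lv , λ u uεa → cov u (ε-∈ ls low a⊆s uεa))
    ; endless = λ lv → do
        (w , n) ← T.next lv
        return (w , proj₁ n , T.next-∋ n) }

-- The data for BLT: S v is the complement of v, and D v = {v}

module BLTShift (𝔐 : Model) (_∈_ : Model.Car 𝔐 → Model.Car 𝔐 → Set) where
  open Ambient 𝔐

  Empty : Car → Set
  Empty x = ∀ z → ¬ z ∈ x

  S : Car → Car → Set
  S v u = ∀ z → z ∈ u ↔ ¬ z ∈ v

  D : Car → Car → Set
  D v u = ∀ z → z ∈ u ↔ z ≈ v

  Z : Car → Set
  Z x = ∃ λ w → ¬ w ∈ w × x ∈ w × (∀ u → u ∈ w → (∃ λ v → v ∈ w × D v u) ∨ Empty u)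

  -- For g the bijection given by Shift: ∅ belongs to the high sets, and g u belongs
  -- to y iff u is in whichever of y and its complement is low.
  In : Car → Car → Set
  In x y = (Empty x → y ∈ y) × (∀ u → Shift 𝔐 Z S D u x → (y ∈ y → ¬ u ∈ y) × (¬ y ∈ y → u ∈ y))

  module _ (∈-def : Def₂ _∈_) where

    Empty-def : ∀ i → Def (λ ρ → Empty (ρ i))
    Empty-def i = d∀ (d¬ (ap₂ ∈-def (var 0) (var (suc i))))

    S-def : Def₂ S
    S-def = def₂ (d∀ (ap₂ ∈-def (var 0) (var 2) d↔ d¬ (ap₂ ∈-def (var 0) (var 1))))

    D-def : Def₂ D
    D-def = def₂ (d∀ (ap₂ ∈-def (var 0) (var 2) d↔ d≈ (var 0) (var 1)))

    Z-def : Def₁ Z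
    Z-def = def₁ (d∃ (d¬ (ap₂ ∈-def (var 0) (var 0)) d× ap₂ ∈-def (var 1) (var 0) d×
      d∀ (ap₂ ∈-def (var 0) (var 1) d⇒ (d∃ (ap₂ ∈-def (var 0) (var 2) d× ap₂ D-def (var 0) (var 1)) d∨
        Empty-def 0))))

module BLTFacts {𝔐 : Model} (L : BLTPlus 𝔐) where
  open Ambient 𝔐
  open BLTPlus L public
  open BLTShift 𝔐 _∈_ public

  d-empty : ∀ i → Def (λ ρ → Empty (ρ i))
  d-empty = Empty-def ∈-def

  S-fun : ∀ {v u u′} → S v u → S v u′ → u ≈ u′
  S-fun p q = extensionality λ z → proj₂ (q z) ∘ proj₁ (p z) , proj₂ (p z) ∘ proj₁ (q z)

  S-tot : ∀ v → ∃ (S v)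
  S-tot v = do
    (u , p , _) ← complements v
    return (u , p)

  S-sym : ∀ {v u} → S v u → S u v
  S-sym p z = (λ z∈v z∈u → proj₁ (p z) z∈u z∈v) , λ z∉u → stable λ z∉v → z∉u (proj₂ (p z) z∉v)

  S-high : ∀ {v u} → S v u → Low v → u ∈ u
  S-high {v} p low = do
    (c , q , high , _) ← complements v
    ∈-resp (S-fun q p) (S-fun q p) (high low)

  S-low : ∀ {v u} → S v u → v ∈ v → Low u
  S-low {v} p v∈v u∈u = do
    (c , q , _ , high) ← complements v
    high (∈-resp (S-fun p q) (S-fun p q) u∈u) v∈v

  Sub-co : ∀ {v u r} → S v u → Sub v r → Sub u r
  Sub-co p q = do
    (inj₁ v⊆r) ← cases q where
      (inj₂ co) → left λ z z∈u → co z (proj₁ (p z) z∈u)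
    right λ z z∉u → v⊆r z (stable λ z∉v → z∉u (proj₂ (p z) z∉v))

  sub-high : ∀ {y s} → Low s → Sub y s → y ∈ y → CoSub y s
  sub-high low-s p y∈y z z∉y = do
    (inj₂ co) ← cases p where
      (inj₁ y⊆s) → absurd (Low-⊆ low-s y⊆s y∈y)
    co z z∉y

  empty : ∃ Empty
  empty = do
    (inj₁ high) ← em (pt ∈ pt) where
      (inj₂ low) → none low
    (c , p) ← S-tot pt
    none (S-low p high)
    where
    none : ∀ {a} → Low a → ∃ Empty
    none low = do
      (e , _ , e-def) ← separation (def₁ d⊥) low
      return (e , λ z z∈e → proj₂ (proj₁ (e-def z) z∈e))

  empty-unique : ∀ {d e} → Empty d → Empty e → d ≈ e
  empty-unique p q = antisym (λ z → absurd ∘ p z) (λ z → absurd ∘ q z)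

  empty-∈ : ∀ {s x e} → Level s → x ∈ s → Empty e → e ∈ s
  empty-∈ ls x∈s p = do
    (r , r∈s , lr , _) ← level-sublevels ls x∈s
    level-potent ls r∈s (Level⇒Low lr) (⊆⇒Sub λ z → absurd ∘ p z)

  -- A high set is included in no level, but it belongs to one, because it fits wherever its
  -- complement does.
  room : ∀ x → ∃ λ t → Level t × x ∈ t
  room x = do
    (inj₁ high) ← em (x ∈ x) where
      (inj₂ low) → do
        (s , ls , x⊆s) ← stratification x low
        (t , lt , s∈t) ← endless ls
        return (t , lt , level-potent lt s∈t (Level⇒Low ls) (⊆⇒Sub x⊆s))
    (c , p) ← S-tot x
    (s , ls , c⊆s) ← stratification c (S-low p high)
    (t , lt , s∈t) ← endless ls
    return (t , lt , level-potent lt s∈t (Level⇒Low ls) (Sub-co (S-sym p) (⊆⇒Sub c⊆s)))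

  D-low : ∀ {v u} → D v u → Low u
  D-low {v} p = do
    (t , lt , v∈t) ← room v
    Low-⊆ (Level⇒Low lt) λ z z∈u → ∈-respˡ (≈-sym (proj₁ (p z) z∈u)) v∈t

  Z-low : ∀ {x} → Z x → Low x
  Z-low {x} Zx = do
    (w , _ , x∈w , w-def) ← Zx
    (inj₁ q) ← cases (w-def x x∈w) where
      (inj₂ e) → λ x∈x → e x x∈x
    (v , _ , Dvx) ← q
    D-low Dvx

  blt-shift : ShiftData 𝔐
  blt-shift = record
    { Empty = Empty ; Z = Z ; S = S ; D = D
    ; Z-def = Z-def ∈-def ; S-def = S-def ∈-def ; D-def = D-def ∈-def
    ; S-functional = S-fun
    ; D-functional = λ p q → extensionality λ z → proj₂ (q z) ∘ proj₁ (p z) , proj₂ (p z) ∘ proj₁ (q z)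
    ; S-total = S-tot
    ; D-total = λ v → do
        (t , lt , v∈t) ← room v
        (u , _ , u-def) ← separation (def₁ (d≈ (var 0) (con v))) (Level⇒Low lt)
        return (u , λ y → proj₂ ∘ proj₁ (u-def y) , λ q → proj₂ (u-def y) (∈-respˡ (≈-sym q) v∈t , q))
    ; S-injective = λ _ _ p q → S-fun (S-sym p) (S-sym q)
    ; D-injective = λ {v} _ _ p q → proj₁ (q v) (proj₂ (p v) ≈-refl)
    ; S-nonempty = λ Zv p e → e _ (S-high p (Z-low Zv))
    ; D-nonempty = λ {v} p e → e v (proj₂ (p v) ≈-refl)
    ; S-odd = λ Zv p Zu → Z-low Zu (S-high p (Z-low Zv))
    ; Z-empty = λ {x} p → do
        (t , lt , x∈t) ← room x
        (w , low , w-def) ← separation (def₁ (d-empty 0)) (Level⇒Low lt)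
        return (w , low , proj₂ (w-def x) (x∈t , p) , λ u u∈w → right (proj₂ (proj₁ (w-def u) u∈w)))
    ; Z-step = λ {v} {x} Zv p → do
        (w , low , v∈w , w-def) ← Zv
        (s , ls , w⊆s) ← stratification w low
        (t , lt , x∈t) ← room x
        (m , lm , s⊆m , t⊆m) ← upper-level ls lt
        (w′ , low′ , w′-def) ← separation (def₁ (d∈ (var 0) (con w) d∨ d≈ (var 0) (con x))) (Level⇒Low lm)
        let inc : ∀ y → y ∈ w → y ∈ w′
            inc y y∈w = proj₂ (w′-def y) (s⊆m y (w⊆s y y∈w) , left y∈w)
        return (w′ , low′ , proj₂ (w′-def x) (t⊆m x x∈t , right ≈-refl) , λ u u∈w′ → do
          (inj₁ u∈w) ← cases (proj₂ (proj₁ (w′-def u) u∈w′)) where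
            (inj₂ u≈x) → left (return (v , inc v v∈w ,
              λ z → proj₁ (p z) ∘ ∈-respʳ u≈x , ∈-respʳ (≈-sym u≈x) ∘ proj₂ (p z)))
          (inj₁ q) ← cases (w-def u u∈w) where
            (inj₂ e) → right e
          (y , y∈w , Dyu) ← q
          left (return (y , inc y y∈w , Dyu)))
    ; Z-unfold = λ {x} Zx → do
        (w , low , x∈w , w-def) ← Zx
        (inj₂ e) ← cases (w-def x x∈w) where
          (inj₁ q) → right (do
            (v , v∈w , Dvx) ← q
            return (v , return (w , low , v∈w , w-def) , Dvx))
        left e
    }

  open ShiftData blt-shift public using (Gr; Gr-def; even; odd; other; kind; gr-total; gr-functional; gr-injective;
    gr-nonempty; gr-onto; gr-even; Z-empty; Z-step)

-- Well-founded sets inside BLT⁺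

module FromBLT {𝔐 : Model} (L : BLTPlus 𝔐) where
  open Ambient 𝔐
  open BLTFacts L

  infix 4 _∈′_
  _∈′_ : Car → Car → Set
  _∈′_ = In

  ∈′-def : Def₂ _∈′_
  ∈′-def = def₂ ((d-empty 0 d⇒ d∈ (var 1) (var 1)) d×
    d∀ (ap₂ Gr-def (var 0) (var 1) d⇒
      ((d∈ (var 2) (var 2) d⇒ d¬ (d∈ (var 0) (var 2))) d× (d¬ (d∈ (var 2) (var 2)) d⇒ d∈ (var 0) (var 2)))))

  ∈′-mem : Membership _∈′_
  ∈′-mem = record { ∈-stable = stable-× ; ∈-resp = resp₂ ∈′-def }
  open Membership ∈′-mem using () renaming (∈-resp to ∈′-resp)

  in-empty : ∀ {x y} → Empty x → x ∈′ y ↔ y ∈ y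
  in-empty e = (λ p → proj₁ p e) , (λ h → (λ _ → h) , λ u g → absurd (gr-nonempty g e))

  in-low : ∀ {u x y} → Gr u x → Low y → x ∈′ y ↔ u ∈ y
  in-low g low = (λ p → proj₂ (proj₂ p _ g) low) ,
    (λ u∈y → (λ e → absurd (gr-nonempty g e)) ,
      λ u′ g′ → (λ h → absurd (low h)) , λ _ → ∈-respˡ (gr-injective g g′) u∈y)

  in-high : ∀ {u x y} → Gr u x → y ∈ y → x ∈′ y ↔ ¬ u ∈ y
  in-high g high = (λ p → proj₁ (proj₂ p _ g) high) ,
    (λ u∉y → (λ e → absurd (gr-nonempty g e)) ,
      λ u′ g′ → (λ _ → u∉y ∘ ∈-respˡ (gr-injective g′ g)) , λ low → absurd (low high))

  S-∈ : ∀ {s v u} → Level s → S v u → v ∈ s → u ∈ s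
  S-∈ ls p v∈s = do
    (r , r∈s , lr , q) ← level-sublevels ls v∈s
    level-potent ls r∈s (Level⇒Low lr) (Sub-co p q)

  -- A set and its complement fit inside the same sets, so complementing stays within a level, and
  -- only the passage to a singleton can leave it.
  gr-down : ∀ {s x x′} → Level s → Gr x x′ → x′ ∈ s → x ∈ s
  gr-down {s} {x} {x′} ls (a , b , c) x′∈s = do
    (even Zx) ← kind x where
      (odd v Zv Svx) → S-∈ ls Svx (level-⊆ ls x′∈s (D-low (b v Zv Svx)) v (proj₂ (b v Zv Svx v) ≈-refl))
      (other ¬Zx none) → ∈-respˡ (≈-sym (c ¬Zx none)) x′∈s
    S-∈ ls (S-sym (a Zx)) x′∈s

  gr-up : ∀ {s t x x′} → Level s → Level t → s ∈ t → Gr x x′ → x ∈ s → x′ ∈ t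
  gr-up {s} {t} {x} ls lt s∈t (a , b , c) x∈s = do
    let s⊆t = level-⊆ lt s∈t (Level⇒Low ls)
    (even Zx) ← kind x where
      (odd v Zv Svx) → level-potent lt s∈t (Level⇒Low ls) (⊆⇒Sub λ z z∈x′ →
        ∈-respˡ (≈-sym (proj₁ (b v Zv Svx z) z∈x′)) (S-∈ ls (S-sym Svx) x∈s))
      (other ¬Zx none) → s⊆t _ (∈-respˡ (c ¬Zx none) x∈s)
    s⊆t _ (S-∈ ls (a Zx) x∈s)

  in-∈ : ∀ {s a u x} → Level s → Sub a s → Gr u x → x ∈′ a → u ∈ s
  in-∈ {s} {a} {u} ls p g q = do
    (inj₁ high) ← em (a ∈ a) where
      (inj₂ low) → Sub⇒⊆ low (Level⇒Low ls) p u (proj₁ (in-low g low) q)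
    sub-high (Level⇒Low ls) p high u (proj₁ (in-high g high) q)

  in-bound : ∀ {s t a x} → Level s → Level t → s ∈ t → Sub a s → x ∈′ a → x ∈ t
  in-bound {x = x} ls lt s∈t p q = do
    (inj₂ ne) ← em (Empty x) where
      (inj₁ e) → empty-∈ lt s∈t e
    (u , g) ← gr-onto x ne
    gr-up ls lt s∈t g (in-∈ ls p g q)

  in-sub : ∀ {s b y} → Level s → Sub b s → (∀ z → z ∈′ y → z ∈′ b) → Sub y s
  in-sub {s} {b} {y} ls p q = do
    (inj₁ high) ← em (y ∈ y) where
      (inj₂ low) → left λ u u∈y → do
        (x , g) ← gr-total u
        in-∈ ls p g (q x (proj₂ (in-low g low) u∈y))
    right λ u u∉y → do
      (x , g) ← gr-total u
      in-∈ ls p g (q x (proj₂ (in-high g high) u∉y))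

  in-∅ : ∀ {e y} → Empty e → ¬ y ∈′ e
  in-∅ {e} {y} p q = do
    (inj₂ ne) ← em (Empty y) where
      (inj₁ r) → p e (proj₁ (in-empty r) q)
    (z , g) ← gr-onto y ne
    p z (proj₁ (in-low g (p e)) q)

  ∈′-extensionality : ∀ {a b} → (∀ z → z ∈′ a ↔ z ∈′ b) → a ≈ b
  ∈′-extensionality {a} {b} p = extensionality λ u → half p u , half (λ z → proj₂ (p z) , proj₁ (p z)) u
    where
    half : ∀ {a b} → (∀ z → z ∈′ a ↔ z ∈′ b) → a ⊆ b
    half {a} {b} p u u∈a = do
      (e , e-empty) ← empty
      (x , g) ← gr-total u
      (inj₁ high) ← em (a ∈ a) where
        (inj₂ low) → proj₁ (in-low g λ h → low (proj₁ (in-empty e-empty) (proj₂ (p e) (proj₂ (in-empty e-empty) h))))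
          (proj₁ (p x) (proj₂ (in-low g low) u∈a))
      let high′ = proj₁ (in-empty e-empty) (proj₁ (p e) (proj₂ (in-empty e-empty) high))
      stable λ u∉b → proj₁ (in-high g high) (proj₂ (p x) (proj₂ (in-high g high′) u∉b)) u∈a

  ∈′-collect : ∀ {F} → Def₁ F → ∀ {t} → Level t → (∀ x → F x → x ∈ t) →
    ∃ λ b → (∀ x → x ∈′ b ↔ F x) × Sub b t
  ∈′-collect {F} F-def {t} lt F⊆t = do
      (e , e-empty) ← empty
      (w , low , w-def) ← separation (def₁ (d∃ (ap₂ Gr-def (var 1) (var 0) d× ap₁ F-def (var 0)))) (Level⇒Low lt)
      let w-∈ : ∀ {u x} → Gr u x → u ∈ w → F x
          w-∈ {u} g u∈w = do
            (x , g′ , Fx) ← proj₂ (proj₁ (w-def u) u∈w)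
            resp₁ F-def (gr-functional g′ g) Fx
          ∈-w : ∀ {u x} → Gr u x → F x → u ∈ w
          ∈-w {u} {x} g Fx = proj₂ (w-def u) (gr-down lt g (F⊆t x Fx) , return (x , g , Fx))
          w⊆t : w ⊆ t
          w⊆t u = proj₁ ∘ proj₁ (w-def u)
      (inj₁ Fe) ← em (F e) where
        (inj₂ ¬Fe) → return (w , (λ x →
          (λ p → do
            (inj₂ ne) ← em (Empty x) where
              (inj₁ e′) → absurd (low (proj₁ (in-empty e′) p))
            (u , g) ← gr-onto x ne
            w-∈ g (proj₁ (in-low g low) p)) ,
          (λ Fx → do
            (inj₂ ne) ← em (Empty x) where
              (inj₁ e′) → absurd (¬Fe (resp₁ F-def (empty-unique e′ e-empty) Fx))
            (u , g) ← gr-onto x ne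
            proj₂ (in-low g low) (∈-w g Fx))) , ⊆⇒Sub w⊆t)
      -- The complement of `w` is high and so receives `∅`, while the low one of the pair is still
      -- `w`.
      (b , Swb) ← S-tot w
      let high = S-high Swb low
      return (b , (λ x →
        (λ p → do
          (inj₂ ne) ← em (Empty x) where
            (inj₁ e′) → resp₁ F-def (empty-unique e-empty e′) Fe
          (u , g) ← gr-onto x ne
          w-∈ g (proj₂ (S-sym Swb u) (proj₁ (in-high g high) p))) ,
        (λ Fx → do
          (inj₂ ne) ← em (Empty x) where
            (inj₁ e′) → proj₂ (in-empty e′) high
          (u , g) ← gr-onto x ne
          proj₂ (in-high g high) (proj₁ (S-sym Swb u) (∈-w g Fx)))) , Sub-co Swb (⊆⇒Sub w⊆t))
    where
    instance
      F-stable : ∀ {x} → Stable (F x)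
      F-stable = stable₁ F-def

  ∈′-separation : ∀ {F} → Def₁ F → ∀ a → ∃ λ b → ∀ x → x ∈′ b ↔ x ∈′ a × F x
  ∈′-separation {F} F-def a = do
    (s , ls , a∈s) ← room a
    (t , lt , s∈t) ← endless ls
    (b , b-def , _) ← ∈′-collect {λ x → x ∈′ a × F x} (def₁ (ap₂ ∈′-def (var 0) (con a) d× ap₁ F-def (var 0))) lt
      λ x (x∈a , _) → in-bound ls lt s∈t (level-transitive ls a a∈s) x∈a
    return (b , b-def)

  lt-core′ : LTCore 𝔐
  lt-core′ = record
    { _∈_ = _∈′_ ; mem = ∈′-mem ; ∈-def = ∈′-def
    ; extensionality = ∈′-extensionality ; separation = ∈′-separation }

  module C = LTCore lt-core′
  module B = Levels C.lt-low-levels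

  -- Read through `∈′`, the complement of `u` in `Z` is `u ∪ {∅}`, and the singleton of `y` has the
  -- one element `g y`, which is `u` when `u` is the complement of `y`.
  ∈′-gr-up : ∀ {v w u x} → B.Level v → B.Level w → v ∈′ w → Gr u x → u ∈′ v → x ∈′ w
  ∈′-gr-up {v} {w} {u} {x} lv lw v∈w g@(a , b , c) u∈v = do
    (even Zu) ← kind u where
      (odd y Zy Syu) → B.level-potent lw v∈w tt λ z z∈x → do
        let low = D-low (b y Zy Syu)
        (inj₂ ne) ← em (Empty z) where
          (inj₁ e) → absurd (low (proj₁ (in-empty e) z∈x))
        (z′ , g′) ← gr-onto z ne
        let z′≈y = proj₁ (b y Zy Syu z′) (proj₁ (in-low g′ low) z∈x)
            z≈u = gr-functional (resp₂ Gr-def z′≈y ≈-refl g′) (gr-even Zy Syu)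
        ∈′-resp (≈-sym z≈u) ≈-refl u∈v
      (other ¬Zu none) → ∈′-resp (c ¬Zu none) ≈-refl (B.level-⊆ lw v∈w tt u u∈v)
    B.level-potent lw v∈w tt λ z z∈x → do
      let low = Z-low Zu
          high = S-high (a Zu) low
      (inj₂ ne) ← em (Empty z) where
        (inj₁ e) → B.level-potent lv u∈v tt λ y y∈z → absurd (in-∅ e y∈z)
      (z′ , g′) ← gr-onto z ne
      B.level-⊆ lv u∈v tt z (proj₂ (in-low g′ low) (proj₂ (S-sym (a Zu) z′) (proj₁ (in-high g′ high) z∈x)))

  transfer : Transfer blt-low-levels C.lt-low-levels
  transfer = record
    { collect = λ F-def lt F⊆t → do
        (b , b-def , b-t) ← ∈′-collect F-def lt F⊆t
        return (b , tt , b-def , λ l (ll , _) t∈l → level-potent ll t∈l (Level⇒Low lt) b-t)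
    ; limit-∈ = λ _ (ll , lim) b∈l c∈b → do
        (r , r∈l , lr , b-r) ← level-sublevels ll b∈l
        (s , s∈l , ls , r∈s) ← lim r r∈l lr
        level-⊆ ll s∈l (Level⇒Low ls) _ (in-bound lr ls r∈s b-r c∈b)
    ; bound = λ {b} _ → do
        (s , ls , b∈s) ← room b
        (t , lt , s∈t) ← endless ls
        return (t , lt , λ y p → level-potent lt s∈t (Level⇒Low ls) (in-sub ls (level-transitive ls b b∈s) p))
    ; limit-bound = λ {b} _ (ll , lim) b∈l → do
        (r , r∈l , lr , b-r) ← level-sublevels ll b∈l
        (t , t∈l , lt , r∈t) ← lim r r∈l lr
        return (t , lt , t∈l , λ y p → level-potent lt r∈t (Level⇒Low lr) (in-sub lr b-r p))
    ; cover-sub = λ {r} {v} {w} lr lv lw v∈w cov x x-r z z∈x → do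
        (inj₂ ne) ← em (Empty z) where
          (inj₁ e) → B.level-potent lw v∈w tt λ y y∈z → absurd (in-∅ e y∈z)
        (u , g) ← gr-onto z ne
        ∈′-gr-up lv lw v∈w g (cov u (in-∈ lr x-r g z∈x)) }

  module T = Transfer transfer

  lt-plus′ : LTPlus 𝔐
  lt-plus′ = record
    { core = lt-core′
    ; stratification = λ a → do
        (s , ls , a∈s) ← room a
        (t , lt , s∈t) ← endless ls
        (v , lv , cov , _) ← T.cover t lt
        return (v , lv , λ x x∈a → cov x (in-bound ls lt s∈t (level-transitive ls a a∈s) x∈a))
    ; endless = λ lv → do
        (w , n) ← T.next lv
        return (w , proj₁ n , T.next-∋ n) }

-- The interpreting formulas; by computation, interpreted epsᶠ is Eps and interpreted
-- inᶠ is In. The order of the disjuncts in zᶠ matters for this: sem would read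
-- ¬' (emptyᶠ u) as an existential statement.

emptyᶠ : ℕ → Fm
emptyᶠ i = ∀' (¬' (0 ∈' suc i))

_∨'_ : Fm → Fm → Fm
A ∨' B = ¬' A ⇒ B

∃' : Fm → Fm
∃' A = ¬' (∀' (¬' A))

shiftᶠ : (ℕ → Fm) → (ℕ → ℕ → Fm) → (ℕ → ℕ → Fm) → ℕ → ℕ → Fm
shiftᶠ z s d x y = (z x ⇒ s x y) ∧' (∀' (z 0 ⇒ s 0 (suc x) ⇒ d 0 (suc y)) ∧'
  (¬' z x ⇒ ¬' (∃' (z 0 ∧' s 0 (suc x))) ⇒ x ≈' y))

module LTFormulas where

  sᶠ : ℕ → ℕ → Fm
  sᶠ v u = ∀' ((0 ∈' suc u) ⇔ ((0 ∈' suc v) ∨' emptyᶠ 0))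

  dᶠ : ℕ → ℕ → Fm
  dᶠ v u = ∀' ((0 ∈' suc u) ⇔ sᶠ (suc v) 0)

  zᶠ : ℕ → Fm
  zᶠ x = ∃' ((suc x ∈' 0) ∧' ∀' ((0 ∈' 1) ⇒ (∃' ((0 ∈' 2) ∧' dᶠ 0 1) ∨' emptyᶠ 0)))

  flᶠ : ℕ → Fm
  flᶠ y = ∀' (emptyᶠ 0 ⇒ 0 ∈' suc y)

  epsᶠ : Fm
  epsᶠ = ∀' (shiftᶠ zᶠ sᶠ dᶠ 1 0 ⇒ ((flᶠ 2 ⇒ ¬' (0 ∈' 2)) ∧' (¬' flᶠ 2 ⇒ 0 ∈' 2)))

module BLTFormulas where

  sᶠ : ℕ → ℕ → Fm
  sᶠ v u = ∀' ((0 ∈' suc u) ⇔ (¬' (0 ∈' suc v)))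

  dᶠ : ℕ → ℕ → Fm
  dᶠ v u = ∀' ((0 ∈' suc u) ⇔ (0 ≈' suc v))

  zᶠ : ℕ → Fm
  zᶠ x = ∃' ((¬' (0 ∈' 0)) ∧' ((suc x ∈' 0) ∧' ∀' ((0 ∈' 1) ⇒ (∃' ((0 ∈' 2) ∧' dᶠ 0 1) ∨' emptyᶠ 0))))

  inᶠ : Fm
  inᶠ = (emptyᶠ 0 ⇒ 1 ∈' 1) ∧'
    ∀' (shiftᶠ zᶠ sᶠ dᶠ 0 1 ⇒ ((2 ∈' 2 ⇒ ¬' (0 ∈' 2)) ∧' (¬' (2 ∈' 2) ⇒ 0 ∈' 2)))

open LTFormulas using (epsᶠ)
open BLTFormulas using (inᶠ)

-- The two constructions undo each other

module _ (𝔐 : Model) where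
  open Ambient 𝔐

  -- Agreement of `S` and of `D` is asked on `Z` only, since the two versions differ elsewhere:
  -- adding `∅` to a set that has it is not complementation.
  shift-cong : ∀ {Z Z′ S S′ D D′} → (∀ v → Z v ↔ Z′ v) → (∀ {v} u → Z v → S v u ↔ S′ v u) →
    (∀ {v} u → Z v → D v u ↔ D′ v u) → ∀ {x y} → Shift 𝔐 Z S D x y → Shift 𝔐 Z′ S′ D′ x y
  shift-cong z s d {x} {y} (a , b , c) =
    (λ Zx′ → let Zx = proj₂ (z x) Zx′ in proj₁ (s y Zx) (a Zx)) ,
    (λ v Zv′ Svx → let Zv = proj₂ (z v) Zv′ in proj₁ (d y Zv) (b v Zv (proj₂ (s x Zv) Svx))) ,
    (λ ¬Z none → c (¬Z ∘ proj₁ (z x)) λ e → e λ (v , Zv , Svx) →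
      none (return (v , proj₁ (z v) Zv , proj₁ (s x Zv) Svx)))

module LTInverse {𝔐 : Model} (L : LTPlus 𝔐) where
  open Ambient 𝔐
  open LTFacts L
  open FromLT L hiding (module B; module C; module T)
  module B = BLTFacts blt-plus′

  empty-ε : ∀ {x} → Empty x → B.Empty x
  empty-ε {x} p z zεx = do
    (z′ , g) ← gr-total z
    p z′ (proj₁ (ε-low g λ f → p x (f x p)) zεx)

  ε-empty : ∀ {x} → B.Empty x → Empty x
  ε-empty p z z∈x = do
    (e , q) ← empty
    q z (∈-respʳ (B.empty-unique p (empty-ε q)) z∈x)

  -- `v` omits `∅`, so adding it reverses the mark and nothing else.
  S-ε : ∀ {v u} → Z v → S v u → B.S v u
  S-ε {v} {u} Zv p z =
    (λ zεu zεv → do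
      (z′ , g) ← gr-total z
      proj₁ (ε-high g fu) zεu (proj₂ (p z′) (left (proj₁ (ε-low g ¬fv) zεv)))) ,
    (λ ¬zεv → do
      (z′ , g) ← gr-total z
      proj₂ (ε-high g fu) λ z′∈u → do
        (inj₁ z′∈v) ← cases (proj₁ (p z′) z′∈u) where
          (inj₂ e) → gr-nonempty g e
        ¬zεv (proj₂ (ε-low g ¬fv) z′∈v))
    where
    ¬fv : ¬ Fl v
    ¬fv f = do
      (e , q) ← empty
      Z-∌ Zv q (f e q)
    fu : Fl u
    fu e q = proj₂ (p e) (right q)

  -- The `ε`-members of `{v ∪ {∅}}` are the `z` with `g z = v ∪ {∅} = g v`.
  D-ε : ∀ {v u} → Z v → D v u → B.D v u
  D-ε {v} {u} Zv p z =
    (λ zεu → do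
      (z′ , g) ← gr-total z
      gr-injective g (gr-even Zv (proj₁ (p z′) (proj₁ (ε-low g ¬fu) zεu)))) ,
    (λ z≈v → do
      (v′ , g) ← gr-total v
      proj₂ (ε-low (resp₂ Gr-def (≈-sym z≈v) ≈-refl g) ¬fu) (proj₂ (p v′) (proj₁ g Zv)))
    where
    ¬fu : ¬ Fl u
    ¬fu f = do
      (e , q) ← empty
      ShiftData.S-nonempty lt-shift Zv (proj₁ (p e) (f e q)) q

  -- The converse comes for free: the one relation is total and the other is functional.
  ε-S : ∀ {v u} → Z v → B.S v u → S v u
  ε-S {v} Zv p = do
    (u′ , q) ← ShiftData.S-total lt-shift v
    resp₂ (S-def₂ ∈-def) ≈-refl (B.S-fun (S-ε Zv q) p) q

  ε-D : ∀ {v u} → Z v → B.D v u → D v u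
  ε-D {v} Zv p = do
    (u′ , q) ← ShiftData.D-total lt-shift v
    resp₂ (D-def₂ ∈-def) ≈-refl (ShiftData.D-functional B.blt-shift (D-ε Zv q) p) q

  Z-ε : ∀ {x} → Z x → B.Z x
  Z-ε {x} Zx = do
    (w , x∈w , w-def) ← Zx
    (s , ls , w⊆s) ← stratification w
    (b , ¬fb , b-def , _) ← ε-collect (def₁ (d∈ (var 0) (con w))) ls w⊆s
    return (b , ¬fb ∘ proj₁ ε-self , proj₂ (b-def x) x∈w , λ u uεb → do
      (inj₁ q) ← cases (w-def u (proj₁ (b-def u) uεb)) where
        (inj₂ e) → right (empty-ε e)
      (v , v∈w , Dvu) ← q
      left (return (v , proj₂ (b-def v) v∈w , D-ε (return (w , v∈w , w-def)) Dvu)))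

  -- The two versions of `D` agree at `v` only once `v` is known to be in `Z`. Hence an induction on
  -- levels, in which the member of an `ε`-singleton lies lower than the singleton.
  ε-Z : ∀ {x} → B.Z x → Z x
  ε-Z {x} Zx = do
    (w , low , xεw , w-def) ← Zx
    (s , ls , x⊆s) ← stratification x
    level-induction
      (def₁ (d∀ (d∀ (d∈ (var 0) (var 1) d⇒ d∈ (var 0) (var 2)) d⇒ ap₂ ε-def (var 0) (con w) d⇒
        ap₁ (Z-def′ ∈-def) (var 0))))
      (λ s ls ih u u⊆s uεw → do
        (inj₁ q) ← cases (w-def u uεw) where
          (inj₂ e) → Z-empty (ε-empty e)
        (v , vεw , Dvu) ← q
        (r , r∈s , lr , v⊆r) ← level-sublevels ls (ε-∈ ls (B.D-low Dvu) u⊆s (proj₂ (Dvu v) ≈-refl))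
        let Zv = ih r r∈s lr v v⊆r vεw
        Z-step Zv (ε-D Zv Dvu))
      s ls x x⊆s xεw

  gr-ε : ∀ {x y} → Gr x y → B.Gr x y
  gr-ε = shift-cong 𝔐 (λ _ → Z-ε , ε-Z) (λ _ Zv → S-ε Zv , ε-S Zv) (λ u Zv → D-ε {u = u} Zv , ε-D {u = u} Zv)

  ε-gr : ∀ {x y} → B.Gr x y → Gr x y
  ε-gr = shift-cong 𝔐 (λ _ → ε-Z , Z-ε) (λ _ Zv → ε-S (ε-Z Zv) , S-ε (ε-Z Zv)) (λ u Zv → ε-D {u = u} (ε-Z Zv) , D-ε {u = u} (ε-Z Zv))

  lt-inverse : ∀ x y → x ∈ y ↔ B.In x y
  lt-inverse x y =
    (λ x∈y → (λ e → proj₂ ε-self (fl (ε-empty e) x∈y)) , λ u g →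
      (λ yεy uεy → proj₁ (ε-high (ε-gr g) (proj₁ ε-self yεy)) uεy x∈y) ,
      (λ low → proj₂ (ε-low (ε-gr g) (low ∘ proj₂ ε-self)) x∈y)) ,
    (λ (p , q) → do
      (inj₂ ne) ← em (Empty x) where
        (inj₁ e) → proj₁ ε-self (p (empty-ε e)) x e
      (u , g) ← gr-onto x ne
      (inj₁ f) ← em (Fl y) where
        (inj₂ ¬f) → proj₁ (ε-low g ¬f) (proj₂ (q u (gr-ε g)) (¬f ∘ proj₁ ε-self))
      stable λ x∉y → proj₁ (q u (gr-ε g)) (proj₂ ε-self f) (proj₂ (ε-high g f) x∉y))

module BLTInverse {𝔐 : Model} (L : BLTPlus 𝔐) where
  open Ambient 𝔐
  open BLTFacts L
  open FromBLT L hiding (module B; module C; module T)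
  module B = LTFacts lt-plus′

  empty-in : ∀ {x} → Empty x → B.Empty x
  empty-in p z = in-∅ p

  in-empty′ : ∀ {x} → B.Empty x → Empty x
  in-empty′ p z z∈x = do
    (e , q) ← empty
    q z (∈-respʳ (B.empty-unique p (empty-in q)) z∈x)

  S-in : ∀ {v u} → Z v → S v u → B.S v u
  S-in {v} {u} Zv p t =
    (λ t∈u → do
      (inj₂ ne) ← em (Empty t) where
        (inj₁ e) → right (empty-in e)
      (y , g) ← gr-onto t ne
      left (proj₂ (in-low g low) (proj₂ (S-sym p y) (proj₁ (in-high g high) t∈u)))) ,
    (λ q → do
      (inj₁ t∈v) ← cases q where
        (inj₂ e) → proj₂ (in-empty (in-empty′ e)) high
      (inj₂ ne) ← em (Empty t) where
        (inj₁ e) → proj₂ (in-empty e) high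
      (y , g) ← gr-onto t ne
      proj₂ (in-high g high) (proj₁ (S-sym p y) (proj₁ (in-low g low) t∈v)))
    where
    low = Z-low Zv
    high = S-high p low

  in-S : ∀ {v u} → Z v → B.S v u → S v u
  in-S {v} Zv p = do
    (u′ , q) ← S-tot v
    resp₂ (S-def ∈-def) ≈-refl (ShiftData.S-functional B.lt-shift (S-in Zv q) p) q

  D-in : ∀ {v u} → Z v → D v u → B.D v u
  D-in {v} {u} Zv p z =
    (λ z∈u → do
      (inj₂ ne) ← em (Empty z) where
        (inj₁ e) → absurd (low (proj₁ (in-empty e) z∈u))
      (y , g) ← gr-onto z ne
      S-in Zv (proj₁ (resp₂ Gr-def (proj₁ (p y) (proj₁ (in-low g low) z∈u)) ≈-refl g) Zv)) ,
    (λ q → proj₂ (in-low (gr-even Zv (in-S Zv q)) low) (proj₂ (p v) ≈-refl))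
    where
    low = D-low p

  in-D : ∀ {v u} → Z v → B.D v u → D v u
  in-D {v} Zv p = do
    (u′ , q) ← ShiftData.D-total blt-shift v
    resp₂ (D-def ∈-def) ≈-refl (ShiftData.D-functional B.lt-shift (D-in Zv q) p) q

  Z-in : ∀ {x} → Z x → B.Z x
  Z-in {x} Zx = do
    (w , low , x∈w , w-def) ← Zx
    (s , ls , w⊆s) ← stratification w low
    (b , b-def , _) ← ∈′-collect (def₁ (d∈ (var 0) (con w))) ls w⊆s
    return (b , proj₂ (b-def x) x∈w , λ u u∈b → do
      (inj₁ q) ← cases (w-def u (proj₁ (b-def u) u∈b)) where
        (inj₂ e) → right (empty-in e)
      (v , v∈w , Dvu) ← q
      left (return (v , proj₂ (b-def v) v∈w , D-in (return (w , low , v∈w , w-def)) Dvu)))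

  in-Z : ∀ {x} → B.Z x → Z x
  in-Z {x} Zx = do
    (w , x∈w , w-def) ← Zx
    (s , ls , x⊆s) ← B.stratification x
    B.level-induction
      (def₁ (d∀ (d∀ (B.d∈ (var 0) (var 1) d⇒ B.d∈ (var 0) (var 2)) d⇒ B.d∈ (var 0) (con w) d⇒
        ap₁ (Z-def ∈-def) (var 0))))
      (λ s ls ih u u⊆s u∈w → do
        (inj₁ q) ← cases (w-def u u∈w) where
          (inj₂ e) → Z-empty (in-empty′ e)
        (v , v∈w , Dvu) ← q
        -- The element of `u` is `v ∪ {∅}` and not `v`, but levels are closed under subsets.
        (t , Svt) ← ShiftData.S-total B.lt-shift v
        (r , r∈s , lr , v⊆r) ← B.level-sublevels ls
          (B.level-potent ls (u⊆s t (proj₂ (Dvu t) Svt)) tt λ z z∈v → proj₂ (Svt z) (left z∈v))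
        let Zv = ih r r∈s lr v v⊆r v∈w
        Z-step Zv (in-D Zv Dvu))
      s ls x x⊆s x∈w

  gr-in : ∀ {x y} → Gr x y → B.Gr x y
  gr-in = shift-cong 𝔐 (λ _ → Z-in , in-Z) (λ _ Zv → S-in Zv , in-S Zv) (λ u Zv → D-in {u = u} Zv , in-D {u = u} Zv)

  in-gr : ∀ {x y} → B.Gr x y → Gr x y
  in-gr = shift-cong 𝔐 (λ _ → in-Z , Z-in) (λ _ Zv → in-S (in-Z Zv) , S-in (in-Z Zv)) (λ u Zv → in-D {u = u} (in-Z Zv) , D-in {u = u} (in-Z Zv))

  fl-high : ∀ {y} → B.Fl y ↔ y ∈ y
  fl-high = (λ f → do
      (e , p) ← empty
      proj₁ (in-empty p) (f e (empty-in p))) ,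
    (λ high e p → proj₂ (in-empty (in-empty′ p)) high)

  blt-inverse : ∀ x y → x ∈ y ↔ B.Eps x y
  blt-inverse x y =
    (λ x∈y x′ g →
      (λ f x′∈y → proj₁ (in-high (in-gr g) (proj₁ fl-high f)) x′∈y x∈y) ,
      (λ ¬f → proj₂ (in-low (in-gr g) (¬f ∘ proj₂ fl-high)) x∈y)) ,
    (λ p → do
      (x′ , g) ← gr-total x
      (inj₁ high) ← em (y ∈ y) where
        (inj₂ low) → proj₁ (in-low g low) (proj₂ (p x′ (gr-in g)) (low ∘ proj₁ fl-high))
      stable λ x∉y → proj₁ (p x′ (gr-in g)) (proj₂ fl-high high) (proj₂ (in-high g high) x∉y))

lt⁺-blt⁺ : DefEquiv LT⁺ BLT⁺
lt⁺-blt⁺ = def-equiv {I = inᶠ} {J = epsᶠ}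
  (record
    { interprets = λ 𝔐 t → models-lt⁺ (FromBLT.lt-plus′ (blt-plus 𝔐 t))
    ; inverse = λ 𝔐 t → BLTInverse.blt-inverse (blt-plus 𝔐 t) })
  (record
    { interprets = λ 𝔐 t → models-blt⁺ (FromLT.blt-plus′ (lt-plus 𝔐 t))
    ; inverse = λ 𝔐 t → LTInverse.lt-inverse (lt-plus 𝔐 t) })

-- ZF proves LT⁺

module FromZF (𝔐 : Model) (zf : Models ZF 𝔐) where
  open Ambient 𝔐

  zf-core : LTCore 𝔐
  zf-core = lt-core 𝔐 (zf _ zf-ext) (λ A → zf _ (zf-sep A))

  open LTCore zf-core public using (lt-structure; lt-low-levels; separation)
  open Levels lt-low-levels hiding (separation)

  private
    ρ₀ : Env
    ρ₀ _ = pt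

  pairing : ∀ a b → ∃ λ c → a ∈ c × b ∈ c
  pairing = zf _ zf-pair ρ₀

  union : ∀ a → ∃ λ u → ∀ y x → x ∈ y × y ∈ a → x ∈ u
  union = zf _ zf-union ρ₀

  power : ∀ a → ∃ λ p → ∀ x → x ⊆ a → x ∈ p
  power = zf _ zf-pow ρ₀

  replacement : ∀ {R} → Def₂ R → ∀ a → (∀ x → x ∈ a → ∃! (R x)) → ∃ λ b → ∀ x → x ∈ a → ∃ λ y → y ∈ b × R x y
  replacement {R} R-def a f with Definability.schema₂ 𝔐 R-def
  ... | A , ρ , e = do
      (b , p) ← zf _ (zf-rep A) ρ a λ x x∈a → do
        (y , r , uniq) ← f x x∈a
        return (y , proj₂ (at₃ x y) (proj₂ (e x y) r) ,
          λ y′ s → uniq y′ (proj₁ (e x y′) (proj₁ (at₄ x y y′) s)))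
      return (b , λ x x∈a → do
        (y , y∈b , s) ← p x x∈a
        return (y , y∈b , proj₁ (e x y) (proj₁ (at₄′ b x y) s)))
    where
    open Schemas {𝔐} mem
    at₃ : ∀ x y → sem _∈_ (inst2 A (λ k → k ∸ 2) (λ k → k ∸ 3) 3) (y ▹ x ▹ a ▹ ρ) ↔ sem _∈_ A (x ▹ y ▹ ρ)
    at₃ x y = inst2-sem A _ _ 3 λ k → cong (y ▹ x ▹ a ▹ ρ) (+-comm k 3)
    at₄ : ∀ x y y′ → sem _∈_ (inst2 A (λ k → k ∸ 2) (λ k → k ∸ 4) 4) (y′ ▹ y ▹ x ▹ a ▹ ρ) ↔ sem _∈_ A (x ▹ y′ ▹ ρ)
    at₄ x y y′ = inst2-sem A _ _ 4 λ k → cong (y′ ▹ y ▹ x ▹ a ▹ ρ) (+-comm k 4)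
    at₄′ : ∀ b x y → sem _∈_ (inst2 A (λ k → k ∸ 3) (λ k → k ∸ 4) 4) (y ▹ x ▹ b ▹ a ▹ ρ) ↔ sem _∈_ A (x ▹ y ▹ ρ)
    at₄′ b x y = inst2-sem A _ _ 4 λ k → cong (y ▹ x ▹ b ▹ a ▹ ρ) (+-comm k 4)

  binary-union : ∀ a b → ∃ λ c → a ⊆ c × b ⊆ c
  binary-union a b = do
    (p , a∈p , b∈p) ← pairing a b
    (c , q) ← union p
    return (c , (λ z z∈a → q a z (z∈a , a∈p)) , λ z z∈b → q b z (z∈b , b∈p))

  adjoin : ∀ a b → ∃ λ c → ∀ z → z ∈ c ↔ z ∈ a ∨ z ≈ b
  adjoin a b = do
    (d , b∈d , _) ← pairing b b
    (e , a⊆e , d⊆e) ← binary-union a d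
    (c , c-def) ← separation (def₁ (d∈ (var 0) (con a) d∨ d≈ (var 0) (con b))) e
    return (c , λ z → proj₂ ∘ proj₁ (c-def z) , λ p → proj₂ (c-def z)
      ((do (inj₁ z∈a) ← cases p where
             (inj₂ z≈b) → d⊆e z (∈-respˡ (≈-sym z≈b) b∈d)
           a⊆e z z∈a) , p))

  endless : ∀ {s} → Level s → ∃ λ t → Level t × s ∈ t
  endless {s} ls = do
    (p , p-def) ← power s
    (t , t-def) ← separation (def₁ (ap₂ Sub-def (var 0) (con s))) p
    let e : ∀ z → z ∈ t ↔ z ⊆ s
        e z = proj₂ ∘ proj₁ (t-def z) , λ q → proj₂ (t-def z) (p-def z q , q)
    return (t , next-level ls tt e , proj₂ (e s) λ _ → id)

  Ranked : Car → Set
  Ranked x = ∃ λ s → Level s × x ⊆ s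

  Ranked-def : Def₁ Ranked
  Ranked-def = def₁ (d∃ (ap₁ Level-def (var 0) d× d⊆ 1 0))

  ranked-∈ : ∀ {x y} → Ranked x → y ∈ x → Ranked y
  ranked-∈ {y = y} p y∈x = do
    (s , ls , x⊆s) ← p
    (r , _ , lr , y⊆r) ← level-sublevels ls (x⊆s y y∈x)
    return (r , lr , y⊆r)

  -- Replacement needs a unique value, so the least level including `x` is taken.
  Least : Car → Car → Set
  Least x s = (Level s × x ⊆ s) × (∀ r → Level r → x ⊆ r → s ⊆ r)

  Least-def : Def₂ Least
  Least-def = def₂ ((ap₁ Level-def (var 1) d× d⊆ 0 1) d× d∀ (ap₁ Level-def (var 0) d⇒ d⊆ 1 0 d⇒ d⊆ 2 0))

  least : ∀ {x} → Ranked x → ∃ (Least x)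
  least {x} p = do
    (s , ls , x⊆s) ← p
    level-induction (def₁ (ap₂ Sub-def (con x) (var 0) d⇒ d∃ (ap₂ Least-def (con x) (var 0))))
      (λ s ls ih x⊆s → do
        (inj₁ e) ← em (∃ λ r → r ∈ s × Level r × x ⊆ r) where
          (inj₂ none) → return (s , (ls , x⊆s) , λ r lr x⊆r → do
            (below s∈r) ← compare ls lr where
              (equal s≈r) → ≈⇒⊆ s≈r
              (above r∈s) → absurd (none (return (r , r∈s , lr , x⊆r)))
            level-⊆ lr s∈r tt)
        (r , r∈s , lr , x⊆r) ← e
        ih r r∈s lr x⊆r)
      s ls x⊆s

  ranked : ∀ a → (∀ x → x ∈ a → Ranked x) → Ranked a
  ranked a f = do
    (b , b-def) ← replacement Least-def a λ x x∈a → do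
      (s , p@((ls , x⊆s) , min)) ← least (f x x∈a)
      return (s , p , λ s′ ((ls′ , x⊆s′) , min′) → antisym (min′ s ls x⊆s) (min s′ ls′ x⊆s′))
    (u , u-def) ← union b
    (p , p-def) ← power u
    let G : Car → Set
        -- Replacement may put other things than least levels into `b`, hence the condition that `s`
        -- is a level.
        G r = Level r × (∃ λ s → s ∈ b × Level s × r ⊆ s)
        G-def : Def₁ G
        G-def = def₁ (ap₁ Level-def (var 0) d× d∃ (d∈ (var 0) (con b) d× ap₁ Level-def (var 0) d× d⊆ 1 0))
    (t , t-def) ← separation (def₁ (d∃ (ap₁ G-def (var 0) d× d⊆ 1 0))) p
    let e : ∀ z → z ∈ t ↔ ∃ λ r → G r × z ⊆ r
        e z = proj₂ ∘ proj₁ (t-def z) , λ q → proj₂ (t-def z) (p-def z (λ w w∈z → do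
          (r , (_ , q′) , z⊆r) ← q
          (s , s∈b , _ , r⊆s) ← q′
          u-def s w (r⊆s w (z⊆r w w∈z) , s∈b)) , q)
    return (t , make-level G-def tt (λ _ → proj₁)
      (λ r q (_ , g) q∈r lq → lq , (do
        (s , s∈b , ls , r⊆s) ← g
        return (s , s∈b , ls , level-⊆ ls (r⊆s q q∈r) tt))) e
      , λ x x∈a → do
        (s , s∈b , (ls , x⊆s) , _) ← b-def x x∈a
        proj₂ (e x) (return (s , (ls , return (s , s∈b , ls , λ _ → id)) , x⊆s)))

  ranked-no-cycle : ∀ {n m} → Ranked n → n ∈ m → ¬ m ∈ n
  ranked-no-cycle {n} {m} p n∈m m∈n = do
    (s , ls , n⊆s) ← p
    level-induction (def₁ (d∀ (d∀ (d⊆ 1 2 d⇒ d∈ (var 1) (var 0) d⇒ d¬ (d∈ (var 0) (var 1))))))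
      (λ s ls ih n m n⊆s n∈m m∈n → do
        (r , r∈s , lr , m⊆r) ← level-sublevels ls (n⊆s m m∈n)
        ih r r∈s lr m n m⊆r m∈n n∈m)
      s ls n m n⊆s n∈m m∈n

  Empty : Car → Set
  Empty e = ∀ z → ¬ z ∈ e

  Succ : Car → Car → Set
  Succ n s = ∀ z → z ∈ s ↔ z ∈ n ∨ z ≈ n

  d-empty : ∀ i → Def (λ ρ → Empty (ρ i))
  d-empty i = d∀ (d¬ (d∈ (var 0) (var (suc i))))

  Succ-def : Def₂ Succ
  Succ-def = def₂ (d∀ (d∈ (var 0) (var 2) d↔ (d∈ (var 0) (var 1) d∨ d≈ (var 0) (var 1))))

  succ-injective : ∀ {n m s} → Ranked n → Succ n s → Succ m s → n ≈ m
  succ-injective {n} {m} rn p q = do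
    (inj₁ n∈m) ← cases (proj₁ (q n) (proj₂ (p n) (right ≈-refl))) where
      (inj₂ n≈m) → n≈m
    (inj₁ m∈n) ← cases (proj₁ (p m) (proj₂ (q m) (right ≈-refl))) where
      (inj₂ m≈n) → ≈-sym m≈n
    absurd (ranked-no-cycle rn n∈m m∈n)

  Inductive : Car → Set
  Inductive i = (∀ e → Empty e → e ∈ i) × (∀ n → n ∈ i → ∀ s → Succ n s → s ∈ i)

  Inductive-def : Def₁ Inductive
  Inductive-def = def₁ (d∀ (d-empty 0 d⇒ d∈ (var 0) (var 1)) d×
    d∀ (d∈ (var 0) (var 1) d⇒ d∀ (ap₂ Succ-def (var 1) (var 0) d⇒ d∈ (var 0) (var 2))))

  inductive-set : ∃ Inductive
  inductive-set = do
    (i , zero-i , suc-i) ← zf _ zf-inf ρ₀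
    return (i
      , (λ e p → do
          (d , d∈i , q) ← zero-i
          ∈-respˡ (antisym (λ z → absurd ∘ q z) (λ z → absurd ∘ p z)) d∈i)
      , λ n n∈i s p → do
          (t , t∈i , q) ← suc-i n n∈i
          ∈-respˡ (extensionality λ z → proj₂ (p z) ∘ proj₁ (q z) , proj₂ (q z) ∘ proj₁ (p z)) t∈i)

  record Omega (ω : Car) : Set₁ where
    field
      ω-inductive : Inductive ω
      ω-induction : ∀ {F} → Def₁ F → (∀ e → Empty e → F e) →
        (∀ n → n ∈ ω → F n → ∀ s → Succ n s → F s) → ∀ n → n ∈ ω → F n

  omega : ∀ {i} → Inductive i → ∀ {ω} →
    (∀ n → n ∈ ω ↔ n ∈ i × (∀ j → Inductive j → n ∈ j)) → Omega ω
  omega {i} (i-zero , i-suc) {ω} ω-def = record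
    { ω-inductive = ω-zero , ω-suc
    ; ω-induction = λ {F} F-def base step n n∈ω →
        let instance
              F-stable : ∀ {x} → Stable (F x)
              F-stable = stable₁ F-def
        in do
        (j , j-def) ← separation F-def ω
        proj₂ (proj₁ (j-def n) (proj₂ (proj₁ (ω-def n) n∈ω) j
          ( (λ e p → proj₂ (j-def e) (ω-zero e p , base e p))
          , λ m m∈j s p → let m∈ω , Fm = proj₁ (j-def m) m∈j in
              proj₂ (j-def s) (ω-suc m m∈ω s p , step m m∈ω Fm s p)))) }
    where
    ω-zero : ∀ e → Empty e → e ∈ ω
    ω-zero e p = proj₂ (ω-def e) (i-zero e p , λ j (j-zero , _) → j-zero e p)
    ω-suc : ∀ n → n ∈ ω → ∀ s → Succ n s → s ∈ ω
    ω-suc n n∈ω s p = let n∈i , n∈all = proj₁ (ω-def n) n∈ω in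
      proj₂ (ω-def s) (i-suc n n∈i s p , λ j ind → proj₂ ind n (n∈all j ind) s p)

  -- Given an unranked a, follow the unranked sets reachable from a in n steps; a
  -- stage is stored together with its index n, which is its only ranked element.
  module Unranked {a ω : Car} (a-unranked : ¬ Ranked a) (Ω : Omega ω) where
    open Omega Ω

    NextStage : Car → Car → Set
    NextStage p q = ∀ z → z ∈ q ↔
      (Ranked z → ∃ λ n → n ∈ p × Ranked n × Succ n z) ×
      (¬ Ranked z → ∃ λ y → y ∈ p × ¬ Ranked y × z ∈ y)

    step-def : Def₂ (λ p z → (Ranked z → ∃ λ n → n ∈ p × Ranked n × Succ n z) ×
      (¬ Ranked z → ∃ λ y → y ∈ p × ¬ Ranked y × z ∈ y))
    step-def = def₂ (
      (ap₁ Ranked-def (var 1) d⇒ d∃ (d∈ (var 0) (var 1) d× ap₁ Ranked-def (var 0) d× ap₂ Succ-def (var 0) (var 2))) d×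
      (d¬ (ap₁ Ranked-def (var 1)) d⇒ d∃ (d∈ (var 0) (var 1) d× d¬ (ap₁ Ranked-def (var 0)) d× d∈ (var 2) (var 0))))

    NextStage-def : Def₂ NextStage
    NextStage-def = def₂ (d∀ (d∈ (var 0) (var 2) d↔ ap₂ step-def (var 1) (var 0)))

    next-functional : ∀ {p q q′} → NextStage p q → NextStage p q′ → q ≈ q′
    next-functional f g = extensionality λ z → proj₂ (g z) ∘ proj₁ (f z) , proj₂ (f z) ∘ proj₁ (g z)

    next-total : ∀ p → ∃ (NextStage p)
    next-total p = do
      (u , u-def) ← union p
      (c , u⊆c , p⊆c) ← binary-union u p
      -- The successor of an index `n` in `p` is a subset of `⋃p ∪ p`, so it is bounded by this
      -- power set.
      (w , w-def) ← power c
      (m , u⊆m , w⊆m) ← binary-union u w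
      (q , q-def) ← separation (def₁ (ap₂ step-def (con p) (var 0))) m
      return (q , λ z → proj₂ ∘ proj₁ (q-def z) , λ s@(s₁ , s₂) → proj₂ (q-def z) ((do
        (inj₁ rz) ← em (Ranked z) where
          (inj₂ ¬rz) → do
            (y , y∈p , _ , z∈y) ← s₂ ¬rz
            u⊆m z (u-def y z (z∈y , y∈p))
        (n , n∈p , _ , e) ← s₁ rz
        w⊆m z (w-def z λ x x∈z → do
          (inj₁ x∈n) ← cases (proj₁ (e x) x∈z) where
            (inj₂ x≈n) → p⊆c x (∈-respˡ (≈-sym x≈n) n∈p)
          u⊆c x (u-def n x (x∈n , n∈p)))) , s))

    ω-ranked : ∀ n → n ∈ ω → Ranked n
    ω-ranked = ω-induction Ranked-def (λ e p → ranked e λ x → absurd ∘ p x)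
      λ n _ rn s p → ranked s λ x x∈s → do
        (inj₁ x∈n) ← cases (proj₁ (p x) x∈s) where
          (inj₂ x≈n) → resp₁ Ranked-def (≈-sym x≈n) rn
        ranked-∈ rn x∈n

    IsStart : Car → Set
    IsStart p = ∀ z → z ∈ p ↔ z ≈ a ∨ Empty z

    start : ∃ IsStart
    start = do
      (e , e-def) ← separation (def₁ d⊥) a
      let e-empty : Empty e
          e-empty z z∈e = proj₂ (proj₁ (e-def z) z∈e)
      (p , a∈p , e∈p) ← pairing a e
      (q , q-def) ← separation (def₁ (d≈ (var 0) (con a) d∨ d-empty 0)) p
      return (q , λ z → proj₂ ∘ proj₁ (q-def z) , λ s → proj₂ (q-def z) ((do
        (inj₁ z≈a) ← cases s where
          (inj₂ z-empty) → ∈-respˡ (antisym (λ x → absurd ∘ e-empty x) (λ x → absurd ∘ z-empty x)) e∈p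
        ∈-respˡ (≈-sym z≈a) a∈p) , s))

    start-def : Def₁ IsStart
    start-def = def₁ (d∀ (d∈ (var 0) (var 1) d↔ (d≈ (var 0) (con a) d∨ d-empty 0)))

    start-unique : ∀ {p q} → IsStart p → IsStart q → p ≈ q
    start-unique f g = extensionality λ z → proj₂ (g z) ∘ proj₁ (f z) , proj₂ (f z) ∘ proj₁ (g z)

    -- Recursion by a tracing set, as for `Z`.
    Stage : Car → Set
    Stage p = ∃ λ f → p ∈ f × (∀ q → q ∈ f → (∃ λ r → r ∈ f × NextStage r q) ∨ IsStart q)

    Stage-def : Def₁ Stage
    Stage-def = def₁ (d∃ (d∈ (var 1) (var 0) d× d∀ (d∈ (var 0) (var 1) d⇒
      (d∃ (d∈ (var 0) (var 2) d× ap₂ NextStage-def (var 0) (var 1)) d∨ ap₁ start-def (var 0)))))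

    stage-start : ∀ {p} → IsStart p → Stage p
    stage-start {p} s = do
      (c , p∈c , _) ← pairing p p
      (f , f-def) ← separation start-def c
      return (f , proj₂ (f-def p) (p∈c , s) , λ q q∈f → right (proj₂ (proj₁ (f-def q) q∈f)))

    stage-next : ∀ {p q} → Stage p → NextStage p q → Stage q
    stage-next {p} {q} st n = do
      (f , p∈f , f-def) ← st
      (g , g-def) ← adjoin f q
      return (g , proj₂ (g-def q) (right ≈-refl) , λ x x∈g → do
        (inj₁ x∈f) ← cases (proj₁ (g-def x) x∈g) where
          (inj₂ x≈q) → left (return (p , proj₂ (g-def p) (left p∈f) , resp₂ NextStage-def ≈-refl (≈-sym x≈q) n))
        (inj₁ e) ← cases (f-def x x∈f) where
          (inj₂ s) → right s
        (r , r∈f , m) ← e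
        left (return (r , proj₂ (g-def r) (left r∈f) , m)))

    data Origin (p : Car) : Set where
      initial : IsStart p → Origin p
      later : ∀ r → Stage r → NextStage r p → Origin p

    origin : ∀ {p} → Stage p → ◇ (Origin p)
    origin {p} st = do
      (f , p∈f , f-def) ← st
      (inj₁ e) ← cases (f-def p p∈f) where
        (inj₂ s) → return (initial s)
      (r , r∈f , n) ← e
      return (later r (return (f , r∈f , f-def)) n)

    At : Car → Car → Set
    At n p = Stage p × n ∈ p

    At-def : Def₂ At
    At-def = def₂ (ap₁ Stage-def (var 1) d× d∈ (var 0) (var 1))

    next-at : ∀ {n p q s} → Ranked n → Ranked s → NextStage p q → At n p → Succ n s → At s q
    next-at rn rs nx (st , n∈p) p = stage-next st nx ,
      proj₂ (nx _) ((λ _ → return (_ , n∈p , rn , p)) , λ ¬rs → absurd (¬rs rs))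

    -- The index stored in a stage determines the stage. The empty index forces the initial one; a
    -- successor forces a later one, and `succ-injective` identifies the index of its predecessor.
    stages : ∀ n → n ∈ ω → ∃! (At n)
    stages = ω-induction (def₁ (d∃ (ap₂ At-def (var 1) (var 0) d× d∀ (ap₂ At-def (var 2) (var 0) d⇒ d≈ (var 0) (var 1)))))
      (λ e e-empty → do
        (p , s) ← start
        return (p , (stage-start s , proj₂ (s e) (right e-empty)) , λ q (st , e∈q) → do
          (initial s′) ← origin st where
            (later r _ n) → absurd (do
              (m , _ , _ , x) ← proj₁ (proj₁ (n e) e∈q) (ranked e λ x → absurd ∘ e-empty x)
              e-empty m (proj₂ (x m) (right ≈-refl)))
          start-unique s′ s))
      λ n n∈ω ih s x → do
        let rn = ω-ranked n n∈ω
            rs = ω-ranked s (proj₂ ω-inductive n n∈ω s x)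
        (p , at , uniq) ← ih
        (q , nx) ← next-total p
        return (q , next-at rn rs nx at x , λ q′ (st , s∈q′) → do
          (later r st′ nx′) ← origin st where
            (initial i) → absurd (do
              (inj₁ s≈a) ← cases (proj₁ (i s) s∈q′) where
                (inj₂ s-empty) → s-empty n (proj₂ (x n) (right ≈-refl))
              a-unranked (resp₁ Ranked-def s≈a rs))
          (m , m∈r , rm , x′) ← proj₁ (proj₁ (nx′ s) s∈q′) rs
          let r≈p = uniq r (st′ , ∈-respˡ (≈-sym (succ-injective rn x x′)) m∈r)
          next-functional (resp₂ NextStage-def r≈p ≈-refl nx′) nx)

    unranked-∈ : ∀ {x} → ¬ Ranked x → ∃ λ y → y ∈ x × ¬ Ranked y
    unranked-∈ {x} ¬rx none = ¬rx (ranked x λ y y∈x → stable λ ¬ry → none (y , y∈x , ¬ry))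

    -- Foundation gives an element-minimal `x` among all unranked sets that are reached. Being
    -- unranked, `x` has an unranked element, and the next stage reaches it.
    contradictory : Bot
    contradictory = do
      (P , P-def) ← replacement At-def ω stages
      (u , u-def) ← union P
      (B , B-def) ← separation (def₁ (d¬ (ap₁ Ranked-def (var 0)) d×
        d∃ (d∈ (var 0) (con ω) d× d∃ (ap₂ At-def (var 1) (var 0) d× d∈ (var 2) (var 0))))) u
      let reached : ∀ {n p x} → n ∈ ω → At n p → x ∈ p → ¬ Ranked x → x ∈ B
          reached {n} {p} {x} n∈ω at x∈p ¬rx = proj₂ (B-def x) ((do
            (q , q∈P , at′) ← P-def n n∈ω
            (_ , _ , uniq) ← stages n n∈ω
            u-def q x (∈-respʳ (≈-trans (uniq p at) (≈-sym (uniq q at′))) x∈p , q∈P)) ,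
            ¬rx , return (n , n∈ω , return (p , at , x∈p)))
      (e , e-def) ← separation (def₁ d⊥) a
      let e-empty : Empty e
          e-empty z z∈e = proj₂ (proj₁ (e-def z) z∈e)
      (p₀ , s₀) ← start
      (x , x∈B , min) ← zf _ zf-fnd ρ₀ B (return (a ,
        reached (proj₁ ω-inductive e e-empty) (stage-start s₀ , proj₂ (s₀ e) (right e-empty))
          (proj₂ (s₀ a) (left ≈-refl)) a-unranked))
      let _ , ¬rx , w = proj₁ (B-def x) x∈B
      (n , n∈ω , w′) ← w
      (p , at , x∈p) ← w′
      (y , y∈x , ¬ry) ← unranked-∈ ¬rx
      (q , nx) ← next-total p
      (s , x⁺) ← adjoin n n
      let s∈ω = proj₂ ω-inductive n n∈ω s x⁺
      min y y∈x (reached s∈ω (next-at (ω-ranked n n∈ω) (ω-ranked s s∈ω) nx at x⁺)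
        (proj₂ (nx y) ((λ ry → absurd (¬ry ry)) , λ _ → return (x , x∈p , ¬rx , y∈x))) ¬ry)

  all-ranked : ∀ a → Ranked a
  all-ranked a = stable λ ¬ra → do
    (i , ind) ← inductive-set
    (ω , ω-def) ← separation (def₁ (d∀ (ap₁ Inductive-def (var 0) d⇒ d∈ (var 1) (var 0)))) i
    Unranked.contradictory ¬ra (omega ind ω-def)

  zf-lt-plus : LTPlus 𝔐
  zf-lt-plus = record { core = zf-core ; stratification = all-ranked ; endless = endless }

  -- `l` is the supremum of the levels that omit some element of the inductive set `i`. If `r` omits
  -- `n`, then the next level omits the successor of `n`, because `n` is an element of that
  -- successor; so there is no last such level.
  infinite-limit : ∃ λ l → Limit l × (∃ λ r → Level r × r ∈ l)
  infinite-limit = do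
    (i , i-zero , i-suc) ← inductive-set
    (s , ls , i⊆s) ← all-ranked i
    let G : Car → Set
        G r = Level r × (∃ λ n → n ∈ i × ¬ n ∈ r)
        G-def : Def₁ G
        G-def = def₁ (ap₁ Level-def (var 0) d× d∃ (d∈ (var 0) (con i) d× d¬ (d∈ (var 0) (var 1))))
    (l , l-def) ← separation (def₁ (d∃ (ap₁ G-def (var 0) d× d⊆ 1 0))) s
    let e : ∀ z → z ∈ l ↔ ∃ λ r → G r × z ⊆ r
        e z = proj₂ ∘ proj₁ (l-def z) , λ q → proj₂ (l-def z) ((do
          (r , (lr , p) , z⊆r) ← q
          (n , n∈i , n∉r) ← p
          (above r∈s) ← compare ls lr where
            (below s∈r) → absurd (n∉r (level-⊆ lr s∈r tt n (i⊆s n n∈i)))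
            (equal s≈r) → absurd (n∉r (∈-respʳ s≈r (i⊆s n n∈i)))
          level-potent ls r∈s tt z⊆r) , q)
        ll : Level l
        ll = make-level G-def tt (λ _ → proj₁) (λ r q (lr , p) q∈r lq → lq , (do
          (n , n∈i , n∉r) ← p
          return (n , n∈i , λ n∈q → n∉r (level-⊆ lr q∈r tt n n∈q)))) e
    (d , d-def) ← separation (def₁ d⊥) i
    let d-empty′ : Empty d
        d-empty′ z z∈d = proj₂ (proj₁ (d-def z) z∈d)
        ld : Level d
        ld = make-level {λ _ → Bot} (def₁ d⊥) tt (λ _ → absurd) (λ _ _ b → absurd b)
          λ z → absurd ∘ d-empty′ z , λ q → absurd (q λ (_ , b , _) → b)
        Gd : G d
        Gd = ld , return (d , i-zero d d-empty′ , d-empty′ d)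
    return (l
      , (ll , λ r r∈l lr → do
          (r′ , (_ , p) , r⊆r′) ← proj₁ (e r) r∈l
          (n , n∈i , n∉r′) ← p
          (w , w-def) ← power r
          (t , t-def) ← separation (def₁ (ap₂ Sub-def (var 0) (con r))) w
          let t-pot : ∀ z → z ∈ t ↔ z ⊆ r
              t-pot z = proj₂ ∘ proj₁ (t-def z) , λ q → proj₂ (t-def z) (w-def z q , q)
              lt = next-level lr tt t-pot
          (s , x) ← adjoin n n
          let Gt : G t
              Gt = lt , return (s , i-suc n n∈i s x , λ s∈t →
                n∉r′ (r⊆r′ n (proj₁ (t-pot s) s∈t n (proj₂ (x n) (right ≈-refl)))))
          return (t , proj₂ (e t) (return (t , Gt , λ _ → id)) , lt , proj₂ (t-pot r) λ _ → id))
      , return (d , ld , proj₂ (e d) (return (d , Gd , λ _ → id))))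

-- ZF and BLT_ZF

module ZFModelsBLT (𝔐 : Model) (zf : Models ZF 𝔐) where
  open Ambient 𝔐
  open FromZF 𝔐 zf using (zf-lt-plus; infinite-limit; replacement)
  open LTFacts zf-lt-plus
  open FromLT zf-lt-plus using (_ε_; ε-def; ε-mem; ε-self; ε-∈; blt-core′; blt-plus′; module T)
  open FormalBLT blt-core′ using (from-level; to-level)

  models-bltzf : Models BLT-ZF (model-with 𝔐 ε-mem)
  models-bltzf A (bltzf-blt p) = models-blt blt-plus′ A p
  models-bltzf _ bltzf-inf ρ = do
    (l , lim , ne) ← infinite-limit
    (v , (lv , v-lim) , ne′) ← T.limit-transfer lim ne
    return (v , from-level lv
      , (do
          (r , lr , r∈v) ← ne′
          return (r , from-level lr , r∈v))
      , λ q (lq , q∈v) → do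
          (r , r∈v , lr , q∈r) ← v-lim q q∈v (to-level lq)
          return (r , from-level lr , q∈r , r∈v))
  models-bltzf _ (bltzf-unb A) ρ total a low = do
      (s , ls , a⊆s) ← stratification a
      -- Replacement ranges over the elements of a set, so the `ε`-members of `a` are first
      -- collected.
      (c , c-def) ← separation (def₁ (ap₂ ε-def (var 0) (con a))) s
      (b , b-def) ← replacement (def-sem₂ ε-mem ε-def A ρ) c λ x _ → do
        (y , p , uniq) ← total x
        return (y , proj₁ (at₂ x y) p , λ y′ q → uniq y′ (proj₂ (at₃ x y y′) q))
      (t , lt , b⊆t) ← stratification b
      (v , lv , cov , _) ← T.cover t lt
      return (v , from-level lv , λ x xεa → do
        (y , y∈b , p) ← b-def x (proj₂ (c-def x) (ε-∈ ls low a⊆s xεa , xεa))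
        return (y , cov y (b⊆t y y∈b) , proj₂ (at₄ v x y) p))
    where
    open Schemas {𝔐} ε-mem
    at₂ : ∀ x y → sem _ε_ (inst2 A (λ k → k ∸ 1) (λ k → k ∸ 2) 2) (y ▹ x ▹ ρ) ↔ sem _ε_ A (x ▹ y ▹ ρ)
    at₂ x y = inst2-sem A _ _ 2 λ k → cong (y ▹ x ▹ ρ) (+-comm k 2)
    at₃ : ∀ x y y′ → sem _ε_ (inst2 A (λ k → k ∸ 1) (λ k → k ∸ 3) 3) (y′ ▹ y ▹ x ▹ ρ) ↔ sem _ε_ A (x ▹ y′ ▹ ρ)
    at₃ x y y′ = inst2-sem A _ _ 3 λ k → cong (y′ ▹ y ▹ x ▹ ρ) (+-comm k 3)
    at₄ : ∀ s x y → sem _ε_ (inst2 A (λ k → k ∸ 3) (λ k → k ∸ 4) 4) (y ▹ x ▹ s ▹ a ▹ ρ) ↔ sem _ε_ A (x ▹ y ▹ ρ)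
    at₄ s x y = inst2-sem A _ _ 4 λ k → cong (y ▹ x ▹ s ▹ a ▹ ρ) (+-comm k 4)

module FromBLTZF (𝔐 : Model) (t : Models BLT-ZF 𝔐) where
  open Ambient 𝔐

  bltzf-core : BLTCore 𝔐
  bltzf-core = blt-core 𝔐 (λ A p → t A (bltzf-blt p))

  open BLTCore bltzf-core using (blt-low-levels)
  open Levels blt-low-levels
  open FormalBLT bltzf-core using (from-level; to-level)

  infinite-limit : ∃ λ l → Limit l × (∃ λ r → Level r × r ∈ l)
  infinite-limit = do
    (s , ls , ne , lim) ← t _ bltzf-inf (λ _ → pt)
    return (s
      , (to-level ls , λ q q∈s lq → do
          (r , lr , q∈r , r∈s) ← lim q (from-level lq , q∈s)
          return (r , r∈s , to-level lr , q∈r))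
      , (do
          (q , lq , q∈s) ← ne
          return (q , to-level lq , q∈s)))

  unbounded : ∀ {R} → Def₂ R → (∀ x → ∃! (R x)) → ∀ a → Low a → ∃ λ s → Level s × (∀ x → x ∈ a → ∃ λ y → y ∈ s × R x y)
  unbounded {R} R-def f a low with Definability.schema₂ 𝔐 R-def
  ... | A , ρ , e = do
      (s , ls , p) ← t _ (bltzf-unb A) ρ (λ x → do
        (y , r , uniq) ← f x
        return (y , proj₂ (at₂ x y) (proj₂ (e x y) r) ,
          λ y′ q → uniq y′ (proj₁ (e x y′) (proj₁ (at₃ x y y′) q)))) a low
      return (s , to-level ls , λ x x∈a → do
        (y , y∈s , q) ← p x x∈a
        return (y , y∈s , proj₁ (e x y) (proj₁ (at₄ s x y) q)))
    where
    open Schemas {𝔐} mem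
    at₂ : ∀ x y → sem _∈_ (inst2 A (λ k → k ∸ 1) (λ k → k ∸ 2) 2) (y ▹ x ▹ ρ) ↔ sem _∈_ A (x ▹ y ▹ ρ)
    at₂ x y = inst2-sem A _ _ 2 λ k → cong (y ▹ x ▹ ρ) (+-comm k 2)
    at₃ : ∀ x y y′ → sem _∈_ (inst2 A (λ k → k ∸ 1) (λ k → k ∸ 3) 3) (y′ ▹ y ▹ x ▹ ρ) ↔ sem _∈_ A (x ▹ y′ ▹ ρ)
    at₃ x y y′ = inst2-sem A _ _ 3 λ k → cong (y′ ▹ y ▹ x ▹ ρ) (+-comm k 3)
    at₄ : ∀ s x y → sem _∈_ (inst2 A (λ k → k ∸ 3) (λ k → k ∸ 4) 4) (y ▹ x ▹ s ▹ a ▹ ρ) ↔ sem _∈_ A (x ▹ y ▹ ρ)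
    at₄ s x y = inst2-sem A _ _ 4 λ k → cong (y ▹ x ▹ s ▹ a ▹ ρ) (+-comm k 4)

  bltzf-plus : BLTPlus 𝔐
  bltzf-plus = record
    { core = bltzf-core
    ; stratification = λ a low → do
        (s , ls , p) ← t _ (bltzf-blt blt-strat) (λ _ → pt) a low
        return (s , to-level ls , p)
    ; endless = λ {s} ls → do
        (l , (ll , _) , ne) ← infinite-limit
        (r , _ , r∈l) ← ne
        -- Unbounded for the function with constant value `s`, on a set known to have an element.
        (u , lu , p) ← unbounded {λ _ y → y ≈ s} (def₂ (d≈ (var 1) (con s)))
          (λ _ → return (s , ≈-refl , λ _ → id)) l (Level⇒Low ll)
        (y , y∈u , y≈s) ← p r r∈l
        return (u , lu , ∈-respˡ y≈s y∈u) }

module BLTModelsZF (𝔐 : Model) (t : Models BLT-ZF 𝔐) where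
  open Ambient 𝔐
  open FromBLTZF 𝔐 t using (infinite-limit; unbounded; bltzf-plus)
  module B = BLTFacts bltzf-plus
  open FromBLT bltzf-plus using (lt-plus′; ∈′-def; ∈′-mem; in-bound; module T)
  open LTFacts lt-plus′

  replacement : ∀ {R} → Def₂ R → ∀ a → (∀ x → x ∈ a → ∃! (R x)) → ∃ λ b → ∀ x → x ∈ a → ∃ λ y → y ∈ b × R x y
  replacement {R} R-def a f = do
      (s , ls , a∈s) ← B.room a
      (u , lu , s∈u) ← B.endless ls
      (c , low-c , c-def) ← B.separation (def₁ (d∈ (var 0) (con a))) (B.Level⇒Low lu)
      -- Unbounded asks for a function on the whole universe, so `R` is continued by the identity
      -- outside `a`.
      (w , lw , p) ← unbounded {λ x y → (x ∈ a → R x y) × (¬ x ∈ a → y ≈ x)}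
        (def₂ ((d∈ (var 0) (con a) d⇒ ap₂ R-def (var 0) (var 1)) d×
          (d¬ (d∈ (var 0) (con a)) d⇒ d≈ (var 1) (var 0))))
        (λ x → do
          (inj₁ x∈a) ← em (x ∈ a) where
            (inj₂ x∉a) → return (x , ((λ x∈a → absurd (x∉a x∈a)) , λ _ → ≈-refl) , λ y q → proj₂ q x∉a)
          (y , r , uniq) ← f x x∈a
          return (y , ((λ _ → r) , λ x∉a → absurd (x∉a x∈a)) , λ y′ q → uniq y′ (proj₁ q x∈a)))
        c low-c
      (v , lv , cov , _) ← T.cover w lw
      return (v , λ x x∈a → do
        (y , y∈w , q) ← p x (proj₂ (c-def x) (in-bound ls lu s∈u (B.level-transitive ls a a∈s) x∈a , x∈a))
        return (y , cov y y∈w , proj₁ q x∈a))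
    where
    instance
      R-stable : ∀ {x y} → Stable (R x y)
      R-stable = stable₂ R-def

  models-zf : Models ZF (model-with 𝔐 ∈′-mem)
  models-zf _ zf-ext ρ a b = extensionality
  models-zf _ zf-fnd ρ a ne none = do
    (x , x∈a) ← ne
    (s , ls , x⊆s) ← stratification x
    level-induction (def₁ (d∀ (d⊆ 0 1 d⇒ d¬ (d∈ (var 0) (con a)))))
      (λ s ls ih x x⊆s x∈a → none (x , x∈a , λ y y∈x y∈a → do
        (r , r∈s , lr , y⊆r) ← level-sublevels ls (x⊆s y y∈x)
        ih r r∈s lr y y⊆r y∈a))
      s ls x x⊆s x∈a
  models-zf _ zf-pair ρ a b = do
    (s , ls , _ , a∈s , _) ← room a
    (u , lu , _ , b∈u , _) ← room b
    (m , _ , s⊆m , u⊆m) ← upper-level ls lu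
    return (m , s⊆m a a∈s , u⊆m b b∈u)
  models-zf _ zf-union ρ a = do
    (s , ls , a⊆s) ← stratification a
    return (s , λ y x (x∈y , y∈a) → level-⊆ ls (a⊆s y y∈a) tt x x∈y)
  models-zf _ zf-pow ρ a = do
    (s , ls , a⊆s) ← stratification a
    (u , lu , s∈u) ← endless ls
    return (u , λ x x⊆a → level-potent lu s∈u tt λ z z∈x → a⊆s z (x⊆a z z∈x))
  models-zf _ zf-inf ρ = do
    (l′ , lim′ , ne′) ← infinite-limit
    (l , (ll , lim) , ne) ← T.limit-transfer lim′ ne′
    return (l
      , (do
          (e , p) ← empty
          (r , _ , r∈l) ← ne
          return (e , level-potent ll r∈l tt (λ z → absurd ∘ p z) , p))
      , λ x x∈l → do
          (r , r∈l , lr , x⊆r) ← level-sublevels ll x∈l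
          (q , q∈l , lq , r∈q) ← lim r r∈l lr
          (s , s-def) ← separation (def₁ (d∈ (var 0) (con x) d∨ d≈ (var 0) (con x))) q
          let x∈q = level-potent lq r∈q tt x⊆r
          return (s , level-potent ll q∈l tt (λ z → proj₁ ∘ proj₁ (s-def z))
            , λ z → proj₂ ∘ proj₁ (s-def z) , λ p → proj₂ (s-def z) ((do
                (inj₁ z∈x) ← cases p where
                  (inj₂ z≈x) → ∈-respˡ (≈-sym z≈x) x∈q
                level-⊆ lq x∈q tt z z∈x) , p)))
  models-zf _ (zf-sep A) = models-separation lt-plus′ A
  models-zf _ (zf-rep A) ρ a f = do
      (b , p) ← replacement (def-sem₂ ∈′-mem ∈′-def A ρ) a λ x x∈a → do
        (y , q , uniq) ← f x x∈a
        return (y , proj₁ (at₃ x y) q , λ y′ r → uniq y′ (proj₂ (at₄ x y y′) r))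
      return (b , λ x x∈a → do
        (y , y∈b , q) ← p x x∈a
        return (y , y∈b , proj₂ (at₄′ b x y) q))
    where
    open Schemas {𝔐} ∈′-mem
    at₃ : ∀ x y → sem _∈_ (inst2 A (λ k → k ∸ 2) (λ k → k ∸ 3) 3) (y ▹ x ▹ a ▹ ρ) ↔ sem _∈_ A (x ▹ y ▹ ρ)
    at₃ x y = inst2-sem A _ _ 3 λ k → cong (y ▹ x ▹ a ▹ ρ) (+-comm k 3)
    at₄ : ∀ x y y′ → sem _∈_ (inst2 A (λ k → k ∸ 2) (λ k → k ∸ 4) 4) (y′ ▹ y ▹ x ▹ a ▹ ρ) ↔ sem _∈_ A (x ▹ y′ ▹ ρ)
    at₄ x y y′ = inst2-sem A _ _ 4 λ k → cong (y′ ▹ y ▹ x ▹ a ▹ ρ) (+-comm k 4)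
    at₄′ : ∀ b x y → sem _∈_ (inst2 A (λ k → k ∸ 3) (λ k → k ∸ 4) 4) (y ▹ x ▹ b ▹ a ▹ ρ) ↔ sem _∈_ A (x ▹ y ▹ ρ)
    at₄′ b x y = inst2-sem A _ _ 4 λ k → cong (y ▹ x ▹ b ▹ a ▹ ρ) (+-comm k 4)

zf-bltzf : DefEquiv ZF BLT-ZF
zf-bltzf = def-equiv {I = inᶠ} {J = epsᶠ}
  (record
    { interprets = λ 𝔐 t → BLTModelsZF.models-zf 𝔐 t
    ; inverse = λ 𝔐 t → BLTInverse.blt-inverse (FromBLTZF.bltzf-plus 𝔐 t) })
  (record
    { interprets = λ 𝔐 t → ZFModelsBLT.models-bltzf 𝔐 t
    ; inverse = λ 𝔐 t → LTInverse.lt-inverse (FromZF.zf-lt-plus 𝔐 t) })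

theorem16 : DefEquiv ZF BLT-ZF × DefEquiv LT⁺ BLT⁺
theorem16 = zf-bltzf , lt⁺-blt⁺
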